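{- $n_2(9,3;7)\ge 51>49=\overline{n}_2(9,3;7)$ and $n_2(9,3;10)\ge 76>74=\overline{n}_2(9,3;10)$.
   Context: All dimensions are vector-space dimensions; a hyperplane of $\mathbb{F}_q^r$ is an $(r-1)$-dimensional subspace. A projective $h-(n,r,s)_q$ system is a multiset of $n$ subspaces of $\mathbb{F}_q^r$, each of dimension at most $h$, such that each hyperplane contains at most $s$ of these subspaces (counted with multiplicity) and some hyperplane contains exactly $s$ of them. $n_q(r,h;s)$ denotes the maximum $n$ such that a projective $h-(n,r,s)_q$ system exists. Moreover $\overline{n}_q(r,h;s):=n_{q^h}(\lceil r/h\rceil,1;s)$; in particular $\overline{n}_2(9,3;s)=n_8(3,1;s)$. -}

module Defs where

open import Algebra.Apartness.Bundles using (HeytingField; HeytingCommutativeRing)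
open import Algebra.Apartness.Structures using (IsHeytingField)
open import Algebra.Bundles using (CommutativeRing)
import Algebra.Definitions as AlgDefs
import Algebra.Definitions.RawMonoid as RawMonoidDefs
import Algebra.Properties.Ring as RingProperties
import Algebra.Structures as AlgStructs
open import Data.Bool using (Bool; true; false; _xor_; _∧_)
import Data.Bool.Properties as Boolₚ
open import Data.Fin using (Fin)
open import Data.Fin.Properties using (2↔Bool; *↔×)
open import Data.Fin.Subset using (Subset; ∣_∣)
import Data.Fin.Subset as Sub
open import Data.Nat using (ℕ; suc; _+_; _∸_; _^_; _≤_; NonZero)
open import Data.Nat.DivMod using (_/_)
open import Data.Product using (Σ; _×_; _,_; ∃-syntax)
open import Data.Product.Function.NonDependent.Propositional using (_×-↔_)
import Data.Product.Properties as ×ₚ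
open import Data.Vec.Functional using (Vector; zipWith; map; replicate)
import Data.Vec.Functional.Relation.Binary.Equality.Setoid as VecEq
open import Function using (_∘_; _⇔_; id)
open import Function.Bundles using (Inverse)
open import Function.Properties.Inverse using (↔-sym; ↔-trans)
open import Level using (0ℓ)
open import Relation.Binary.Definitions using (DecidableEquality; _Respects_)
open import Relation.Binary.PropositionalEquality
  using (_≡_; _≢_; refl; cong; cong₂; isEquivalence; setoid; decSetoid)
import Relation.Binary.Properties.DecSetoid as DecSetoidₚ
open import Relation.Nullary using (Dec; contradiction)
open import Relation.Nullary.Decidable using (map′; _×-dec_; _→-dec_; ¬?; from-yes)
open import Relation.Unary using (Pred; Decidable; _∈_; _⊆_)

record FiniteField (q : ℕ) : Set₁ where
  field
    heytingField : HeytingField 0ℓ 0ℓ 0ℓ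

  commutativeRing : CommutativeRing 0ℓ 0ℓ
  commutativeRing =
    HeytingCommutativeRing.commutativeRing (HeytingField.heytingCommutativeRing heytingField)

  field
    enumeration : Inverse (CommutativeRing.setoid commutativeRing) (setoid (Fin q))

module LinearAlgebra {q : ℕ} (F : FiniteField q) (r : ℕ) where

  open CommutativeRing (FiniteField.commutativeRing F) public
    using (Carrier; _≈_; 0#; 1#)
    renaming (_+_ to _+ᶠ_; _*_ to _*ᶠ_)
  open CommutativeRing (FiniteField.commutativeRing F)
    using (+-rawMonoid) renaming (setoid to ≈-setoid)
  open RawMonoidDefs +-rawMonoid using (sum)
  open VecEq ≈-setoid public using (_≋_)

  V : Set
  V = Vector Carrier r

  0ᵛ : V
  0ᵛ = replicate r 0#

  infixl 6 _+ᵛ_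
  infixl 7 _*ᵛ_

  _+ᵛ_ : V → V → V
  _+ᵛ_ = zipWith _+ᶠ_

  _*ᵛ_ : Carrier → V → V
  a *ᵛ v = map (a *ᶠ_) v

  linComb : ∀ {d} → Vector Carrier d → Vector V d → V
  linComb c b j = sum (λ i → c i *ᶠ b i j)

  record Subspace : Set₁ where
    field
      Member    : Pred V 0ℓ
      resp      : Member Respects _≋_
      0-closed  : 0ᵛ ∈ Member
      +-closed  : ∀ {u v} → u ∈ Member → v ∈ Member → u +ᵛ v ∈ Member
      *-closed  : ∀ a {v} → v ∈ Member → a *ᵛ v ∈ Member

  open Subspace public using (Member)

  infix 4 _⊑_
  _⊑_ : Subspace → Subspace → Set
  U ⊑ W = Member U ⊆ Member W

  record IsBasis (W : Subspace) {d : ℕ} (b : Vector V d) : Set where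
    field
      members     : ∀ i → b i ∈ Member W
      independent : ∀ c → linComb c b ≋ 0ᵛ → ∀ i → c i ≈ 0#
      spanning    : ∀ {v} → v ∈ Member W → ∃[ c ] linComb c b ≋ v

  HasDim : Subspace → ℕ → Set
  HasDim W d = Σ (Vector V d) (IsBasis W)

  -- Avoids r ∸ 1, so that the zero space has no hyperplanes.
  IsHyperplane : Subspace → Set
  IsHyperplane H = ∃[ d ] suc d ≡ r × HasDim H d

  -- A multiset of n subspaces is given by a family indexed by Fin n; indices
  -- are counted, so repeated subspaces count with multiplicity.
  ContainsExactly : ∀ {n} → Subspace → Vector Subspace n → ℕ → Set
  ContainsExactly {n} H W k =
    Σ (Subset n) λ I → (∀ i → (i Sub.∈ I) ⇔ (W i ⊑ H)) × ∣ I ∣ ≡ k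

  record IsProjectiveSystem (h s : ℕ) {n : ℕ} (W : Vector Subspace n) : Set₁ where
    field
      dim≤     : ∀ i → ∃[ d ] d ≤ h × HasDim (W i) d
      atMost   : ∀ H → IsHyperplane H → ∃[ k ] k ≤ s × ContainsExactly H W k
      attained : ∃[ H ] IsHyperplane H × ContainsExactly H W s

-- A projective h-(n,r,s)_q system.
ProjectiveSystem : ∀ {q} → FiniteField q → (h n r s : ℕ) → Set₁
ProjectiveSystem F h n r s = Σ (Vector Subspace n) (IsProjectiveSystem h s)
  where open LinearAlgebra F r

-- n_q(r,h;s) = N, for F the field of order q.
IsN : ∀ {q} → FiniteField q → (r h s N : ℕ) → Set₁
IsN F r h s N =
  ProjectiveSystem F h N r s × (∀ m → ProjectiveSystem F h m r s → m ≤ N)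

⌈_/_⌉ : (r h : ℕ) .{{_ : NonZero h}} → ℕ
⌈ r / h ⌉ = (r + (h ∸ 1)) / h

-- n̄_q(r,h;s) = N, for K the field of order q ^ h.
IsN̄ : ∀ q r h .{{_ : NonZero h}} → FiniteField (q ^ h) → (s N : ℕ) → Set₁
IsN̄ q r h K s N = IsN K ⌈ r / h ⌉ 1 s N

private
  module DiscreteField
    {A : Set} (_≟_ : DecidableEquality A) {_+_ _*_ : A → A → A} { -_ : A → A} {0# 1# : A}
    (isCommutativeRing : AlgStructs.IsCommutativeRing _≡_ _+_ _*_ -_ 0# 1#)
    (0≢1 : 0# ≢ 1#)
    (inverse : ∀ x → x ≢ 0# → ∃[ y ] (y * x) ≡ 1#)
    where

    commutativeRing : CommutativeRing 0ℓ 0ℓ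
    commutativeRing = record { isCommutativeRing = isCommutativeRing }

    open CommutativeRing commutativeRing
      using (_-_; ring; *-comm; zeroʳ; -‿inverseʳ)
      renaming (trans to ≡-trans; sym to ≡-sym)
    open RingProperties ring using (x∙y⁻¹≈ε⇒x≈y)

    isHeytingField : IsHeytingField _≡_ _≢_ _+_ _*_ -_ 0# 1#
    isHeytingField = record
      { isHeytingCommutativeRing = record
        { isCommutativeRing   = isCommutativeRing
        ; isApartnessRelation = DecSetoidₚ.≉-isApartnessRelation (decSetoid _≟_)
        ; #⇒invertible        = λ {x} {y} x≢y →
            let z , z*d≡1 = inverse (x - y) (x≢y ∘ x∙y⁻¹≈ε⇒x≈y x y)
            in z , z*d≡1 , ≡-trans (*-comm (x - y) z) z*d≡1
        ; invertible⇒#        = λ { {x} (z , z*d≡1 , _) refl →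
            0≢1 (≡-trans (≡-sym (zeroʳ z))
                  (≡-trans (cong (z *_) (≡-sym (-‿inverseʳ x))) z*d≡1)) }
        }
      ; tight = DecSetoidₚ.≉-tight (decSetoid _≟_)
      }

𝔽₂ : FiniteField 2
𝔽₂ = record
  { heytingField = record
    { isHeytingField = DiscreteField.isHeytingField Boolₚ._≟_
        (CommutativeRing.isCommutativeRing Boolₚ.xor-∧-commutativeRing)
        (λ ())
        (λ { true _ → true , refl ; false 0≢0 → contradiction refl 0≢0 })
    }
  ; enumeration = ↔-sym 2↔Bool
  }

-- The field of order 8 as 𝔽₂[x]/(x³ + x + 1); (a , b , c) is a + bx + cx².
module GF8 where

  Carrier : Set
  Carrier = Bool × Bool × Bool

  infixl 6 _⊕_
  infixl 7 _⊗_

  _⊕_ : Carrier → Carrier → Carrier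
  (a₀ , a₁ , a₂) ⊕ (b₀ , b₁ , b₂) = a₀ xor b₀ , a₁ xor b₁ , a₂ xor b₂

  -- x³ = 1 + x and x⁴ = x + x².
  _⊗_ : Carrier → Carrier → Carrier
  (a₀ , a₁ , a₂) ⊗ (b₀ , b₁ , b₂) =
    p₀ xor p₃ , p₁ xor p₃ xor p₄ , p₂ xor p₄
    where
    p₀ = a₀ ∧ b₀
    p₁ = (a₀ ∧ b₁) xor (a₁ ∧ b₀)
    p₂ = (a₀ ∧ b₂) xor (a₁ ∧ b₁) xor (a₂ ∧ b₀)
    p₃ = (a₁ ∧ b₂) xor (a₂ ∧ b₁)
    p₄ = a₂ ∧ b₂

  𝟘 𝟙 : Carrier
  𝟘 = false , false , false
  𝟙 = true , false , false

  _≟_ : DecidableEquality Carrier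
  _≟_ = ×ₚ.≡-dec Boolₚ._≟_ (×ₚ.≡-dec Boolₚ._≟_ Boolₚ._≟_)

  private
    all𝔹? : {P : Pred Bool 0ℓ} → Decidable P → Dec (∀ b → P b)
    all𝔹? P? = map′ (λ { (t , f) true → t ; (t , f) false → f })
                    (λ p → p true , p false)
                    (P? true ×-dec P? false)

    all? : {P : Pred Carrier 0ℓ} → Decidable P → Dec (∀ x → P x)
    all? P? = map′ (λ p (a , b , c) → p a b c) (λ p a b c → p (a , b , c))
      (all𝔹? λ a → all𝔹? λ b → all𝔹? λ c → P? (a , b , c))

    open AlgDefs (_≡_ {A = Carrier}) hiding (Inverse)

    ⊕-assoc : Associative _⊕_
    ⊕-assoc = from-yes (all? λ x → all? λ y → all? λ z → ((x ⊕ y) ⊕ z) ≟ (x ⊕ (y ⊕ z)))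

    ⊕-comm : Commutative _⊕_
    ⊕-comm = from-yes (all? λ x → all? λ y → (x ⊕ y) ≟ (y ⊕ x))

    ⊕-identity : Identity 𝟘 _⊕_
    ⊕-identity = from-yes (all? (λ x → (𝟘 ⊕ x) ≟ x) ×-dec all? (λ x → (x ⊕ 𝟘) ≟ x))

    ⊕-inverse : AlgDefs.Inverse _≡_ 𝟘 id _⊕_
    ⊕-inverse = from-yes (all? (λ x → (x ⊕ x) ≟ 𝟘) ×-dec all? (λ x → (x ⊕ x) ≟ 𝟘))

    ⊗-assoc : Associative _⊗_
    ⊗-assoc = from-yes (all? λ x → all? λ y → all? λ z → ((x ⊗ y) ⊗ z) ≟ (x ⊗ (y ⊗ z)))

    ⊗-comm : Commutative _⊗_
    ⊗-comm = from-yes (all? λ x → all? λ y → (x ⊗ y) ≟ (y ⊗ x))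

    ⊗-identity : Identity 𝟙 _⊗_
    ⊗-identity = from-yes (all? (λ x → (𝟙 ⊗ x) ≟ x) ×-dec all? (λ x → (x ⊗ 𝟙) ≟ x))

    distrib : _⊗_ DistributesOver _⊕_
    distrib = from-yes
      (all? (λ x → all? λ y → all? λ z → (x ⊗ (y ⊕ z)) ≟ ((x ⊗ y) ⊕ (x ⊗ z)))
       ×-dec
       all? (λ x → all? λ y → all? λ z → ((y ⊕ z) ⊗ x) ≟ ((y ⊗ x) ⊕ (z ⊗ x))))

  isCommutativeRing : AlgStructs.IsCommutativeRing _≡_ _⊕_ _⊗_ id 𝟘 𝟙
  isCommutativeRing = record
    { isRing = record
      { +-isAbelianGroup = record
        { isGroup = record
          { isMonoid = record
            { isSemigroup = record
              { isMagma = record { isEquivalence = isEquivalence ; ∙-cong = cong₂ _⊕_ }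
              ; assoc = ⊕-assoc
              }
            ; identity = ⊕-identity
            }
          ; inverse = ⊕-inverse
          ; ⁻¹-cong = id
          }
        ; comm = ⊕-comm
        }
      ; *-cong = cong₂ _⊗_
      ; *-assoc = ⊗-assoc
      ; *-identity = ⊗-identity
      ; distrib = distrib
      }
    ; *-comm = ⊗-comm
    }

  -- x⁷ = 1 for x ≠ 0.
  inv : Carrier → Carrier
  inv x = (x ⊗ x) ⊗ ((x ⊗ x) ⊗ (x ⊗ x))

  inverse : ∀ x → x ≢ 𝟘 → ∃[ y ] (y ⊗ x) ≡ 𝟙
  inverse x x≢𝟘 =
    inv x , from-yes (all? λ x → ¬? (x ≟ 𝟘) →-dec ((inv x ⊗ x) ≟ 𝟙)) x x≢𝟘

𝔽₈ : FiniteField 8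
𝔽₈ = record
  { heytingField = record
    { isHeytingField =
        DiscreteField.isHeytingField GF8._≟_ GF8.isCommutativeRing (λ ()) GF8.inverse
    }
  ; enumeration =
      ↔-sym (↔-trans (*↔× {2} {4}) (2↔Bool ×-↔ ↔-trans (*↔× {2} {2}) (2↔Bool ×-↔ 2↔Bool)))
  }

{-# OPTIONS --safe #-}
module Submission where

open import Defs
open import Data.Nat using (_>_; _≥_)
open import Data.Product using (_×_; _,_; ∃-syntax)

-- A subspace spanned by h vectors lies in a hyperplane iff its generators lie in the kernel of a nonzero
-- functional, so a projective system is a finite combinatorial object; its existence is decidable and its
-- size is bounded, hence n_q(r,h;s) exists. Explicit systems of 51 and 76 planes give the lower bounds.
--
-- Over 𝔽₈, 75 points with at most 10 per line are excluded by the first two moments of the number k of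
-- points on a line. For 50 points with at most 7 per line, the moments give a line with k ≤ 3 points of
-- the set. In the affine plane obtained by removing it, the complement has 14 + k points and meets every
-- line, and every line in the k directions of the points at infinity at least twice. Jamison's bound
-- excludes k = 0, counting excludes k = 1, and an exhaustive search excludes k = 2 and k = 3.

-- Members of a system may be zero spaces or repeat, so a system over 𝔽₈ is a family of vectors, not
-- a set of points. Both degeneracies are ruled out by counting just where it is needed: a zero
-- vector lies on 73 lines instead of 9, and a point taken twice raises the count over the nine
-- lines through it to `n + 16`. For 50 points with s = 7 and for 75 points with s = 10 this exceeds
-- `73 * s` and `9 * s` respectively. At 74 points with s = 10 the zero vector just fits, since 74 ·
-- 9 + 64 = 730, and the extremal system contains it. The bound 7 enters the affine plane because a
-- line has eight affine points, one more than may be occupied. Blocking all lines takes 15 points,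
-- against 14 for k = 0. For k = 2 and k = 3 the totals 16 and 17 are within one of 8 · 2, so nearly
-- all lines in the k directions contain exactly two points of the complement. This rigidity, with
-- the collineations that preserve the k directions, makes the search small.

-- Finite fields, spans and hyperplanes.

module FiniteVectorSpaces where

  open import Algebra.Apartness.Bundles using (HeytingField)
  open import Algebra.Bundles using (CommutativeRing)
  import Algebra.Properties.Ring as RingProperties
  import Algebra.Properties.Semiring.Sum as SemiringSum
  open import Data.Fin using (Fin; zero; suc; punchIn; punchOut)
  import Data.Fin.Properties as Finₚ
  open import Data.Nat as ℕ using (ℕ; zero; suc; _≤_; _<_; z≤n; s≤s)
  import Data.Nat.Properties as ℕₚ
  open import Data.Product using (∃-syntax; _×_; _,_; proj₁; proj₂)
  open import Data.Vec.Functional using (Vector; []; _∷_; head; tail; insertAt)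
  import Data.Vec.Functional.Properties as Vectorₚ
  open import Function using (_∘_)
  open import Function.Bundles using (Inverse)
  open import Relation.Binary using (Decidable; _Respects_)
  open import Relation.Binary.PropositionalEquality as ≡ using (_≡_; refl)
  import Relation.Binary.Reasoning.Setoid as SetoidReasoning
  open import Relation.Nullary using (Dec; yes; no; ¬_; contradiction)
  open import Relation.Nullary.Decidable using (map′; ¬?)
  import Relation.Unary as U

  -- The carrier of a field is a setoid, so running through an enumeration decides only predicates
  -- that respect its equality.
  Searchable : {A : Set} → (A → A → Set) → Set₁
  Searchable {A} _~_ = ∀ {P : A → Set} → P Respects _~_ → U.Decidable P → Dec (∃[ x ] P x)

  -- Vectors are functions, so `v` agrees with `head v ∷ tail v` only pointwise; `resp` and
  -- reflexivity bridge this. The relation is a parameter so that searches nest: scalars, vectors,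
  -- generators, families.
  search-vector : ∀ {A : Set} {_~_ : A → A → Set} → (∀ {x} → x ~ x) → Searchable _~_ →
    ∀ n → Searchable {Vector A n} (λ u v → ∀ i → u i ~ v i)
  search-vector ~-refl search zero resp P? =
    map′ ([] ,_) (λ (v , pv) → resp (λ ()) pv) (P? [])
  search-vector {_~_ = _~_} ~-refl search (suc n) {P} resp P? =
    map′ (λ (a , v , p) → a ∷ v , p)
         (λ (v , p) → head v , tail v , resp (λ { zero → ~-refl ; (suc i) → ~-refl }) p)
         (search (λ a~b (v , p) → v , resp (λ { zero → a~b ; (suc i) → ~-refl }) p)
           (λ a → search-vector ~-refl search n
             (λ u~v → resp (λ { zero → ~-refl ; (suc i) → u~v i })) (λ v → P? (a ∷ v))))

  module FieldTheory {q} (F : FiniteField q) where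

    private module HF = HeytingField (FiniteField.heytingField F)
    open CommutativeRing (FiniteField.commutativeRing F) hiding (zero)
      renaming (refl to ≈-refl; sym to ≈-sym; trans to ≈-trans; Carrier to K)
    open RingProperties ring using (-‿distribˡ-*; -‿distribʳ-*)
    open SemiringSum semiring
      using (sum; sum-cong-≋; sum-remove; ∑-distrib-+; *-distribˡ-sum; *-distribʳ-sum; sum-replicate-zero)
    open SetoidReasoning setoid
    private module E = Inverse (FiniteField.enumeration F)

    _≈?_ : Decidable _≈_
    x ≈? y = map′ (λ eq → ≈-trans (≈-sym (E.strictlyInverseʳ x))
                            (≈-trans (E.from-cong eq) (E.strictlyInverseʳ y)))
                  E.to-cong (E.to x Finₚ.≟ E.to y)

    search : Searchable _≈_
    search resp P? = map′ (λ (i , p) → E.from i , p)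
      (λ (x , p) → E.to x , resp (≈-sym (E.strictlyInverseʳ x)) p)
      (Finₚ.any? (P? ∘ E.from))

    -- If `1# ≈ 0#`, all elements coincide; then the difference of `0#` with itself is invertible,
    -- and `0#` is apart from itself.
    1≉0 : ¬ 1# ≈ 0#
    1≉0 1≈0 = HF.#-irrefl ≈-refl (HF.invertible⇒# {0#} {0#} (0# , all≈ _ _ , all≈ _ _))
      where
      all≈0 : ∀ x → x ≈ 0#
      all≈0 x = ≈-trans (≈-sym (*-identityˡ x)) (≈-trans (*-congʳ 1≈0) (zeroˡ x))
      all≈ : ∀ x y → x ≈ y
      all≈ x y = ≈-trans (all≈0 x) (≈-sym (all≈0 y))

    -- A Heyting field inverts what is apart from `0#`, whereas only `¬ x ≈ 0#` is given. Finiteness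
    -- closes the gap: a failed search for an inverse refutes apartness, and tightness then gives
    -- `x ≈ 0#`.
    inverse : ∀ x → ¬ x ≈ 0# → ∃[ y ] y * x ≈ 1#
    inverse x x≉0 with search (λ y≈z → ≈-trans (*-congʳ (≈-sym y≈z))) (λ y → (y * x) ≈? 1#)
    ... | yes p = p
    ... | no ∄y = contradiction (proj₁ (HF.tight x 0#) λ x#0 →
      let y , y*[x-0]≈1 , _ = HF.#⇒invertible x#0
      in ∄y (y , ≈-trans (*-congˡ (≈-sym x-0≈x)) y*[x-0]≈1)) x≉0
      where
      -0≈0 : - 0# ≈ 0#
      -0≈0 = ≈-trans (≈-sym (+-identityˡ _)) (-‿inverseʳ 0#)
      x-0≈x : x + - 0# ≈ x
      x-0≈x = ≈-trans (+-congˡ -0≈0) (+-identityʳ x)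

    ⟨_,_⟩ : ∀ {n} → Vector K n → Vector K n → K
    ⟨ f , v ⟩ = sum (λ i → f i * v i)

    ⟨,⟩-cong : ∀ {n} {f g v w : Vector K n} → (∀ i → f i ≈ g i) → (∀ i → v i ≈ w i) → ⟨ f , v ⟩ ≈ ⟨ g , w ⟩
    ⟨,⟩-cong {n} f≋g v≋w = sum-cong-≋ {n} (λ i → *-cong (f≋g i) (v≋w i))

    ⟨,⟩-+ : ∀ {n} (f v w : Vector K n) → ⟨ f , (λ i → v i + w i) ⟩ ≈ ⟨ f , v ⟩ + ⟨ f , w ⟩
    ⟨,⟩-+ {n} f v w = ≈-trans (sum-cong-≋ {n} (λ i → distribˡ (f i) (v i) (w i))) (∑-distrib-+ {n} _ _)

    ⟨,⟩-* : ∀ {n} a (f v : Vector K n) → ⟨ f , (λ i → a * v i) ⟩ ≈ a * ⟨ f , v ⟩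
    ⟨,⟩-* {n} a f v = ≈-trans
      (sum-cong-≋ {n} (λ i → ≈-trans (≈-sym (*-assoc _ _ _)) (≈-trans (*-congʳ (*-comm _ _)) (*-assoc _ _ _))))
      (≈-sym (*-distribˡ-sum a (λ i → f i * v i)))

    sum-zero : ∀ {n} {v : Vector K n} → (∀ i → v i ≈ 0#) → sum v ≈ 0#
    sum-zero {n} v≋0 = ≈-trans (sum-cong-≋ {n} v≋0) (sum-replicate-zero n)

    Nonzero : ∀ {n} → Vector K n → Set
    Nonzero f = ∃[ i ] ¬ f i ≈ 0#

    nonzero? : ∀ {n} (f : Vector K n) → Dec (Nonzero f)
    nonzero? f = Finₚ.any? (λ i → ¬? (f i ≈? 0#))

    Nonzero-resp : ∀ {n} {f g : Vector K n} → (∀ i → f i ≈ g i) → Nonzero f → Nonzero g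
    Nonzero-resp f≋g (i , fi≉0) = i , λ gi≈0 → fi≉0 (≈-trans (f≋g i) gi≈0)

    -- Gaussian elimination of the first coordinate.
    annihilator : ∀ {d r} → d < r → (b : Vector (Vector K r) d) →
      ∃[ f ] Nonzero f × (∀ i → ⟨ f , b i ⟩ ≈ 0#)
    annihilator {d} {suc r} (s≤s d≤r) b with Finₚ.any? (λ i → ¬? (b i zero ≈? 0#))
    ... | no ∄pivot = 1# ∷ (λ _ → 0#) , (zero , 1≉0) , λ i →
      ≈-trans (+-cong (≈-trans (*-identityˡ _) (bi0≈0 i)) (sum-zero {_} (λ j → zeroˡ (b i (suc j))))) (+-identityˡ 0#)
      where
      bi0≈0 : ∀ i → b i zero ≈ 0#
      bi0≈0 i with b i zero ≈? 0#
      ... | yes p = p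
      ... | no ¬p = contradiction (i , ¬p) ∄pivot
    annihilator {suc d} {suc r} (s≤s d<r) b | yes (p , bp≉0)
      with inv , inv*bp≈1 ← inverse (b p zero) bp≉0
      with f , f≉0 , f⊥ ← annihilator d<r
             (λ k j → b (punchIn p k) (suc j) + - (b (punchIn p k) zero * inv) * b p (suc j)) =
      g , (suc (proj₁ f≉0) , proj₂ f≉0) , g⊥
      where
      S : K
      S = ⟨ f , tail (b p) ⟩
      g : Vector K (suc r)
      g = - (inv * S) ∷ f
      c : ∀ i → K
      c i = b i zero * inv
      elim : ∀ i → ⟨ f , tail (b i) ⟩ ≈ c i * S → ⟨ g , b i ⟩ ≈ 0#
      elim i eq = begin
        - (inv * S) * b i zero + ⟨ f , tail (b i) ⟩  ≈⟨ +-cong (≈-sym (-‿distribˡ-* _ _)) eq ⟩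
        - (inv * S * b i zero) + c i * S             ≈⟨ +-congʳ (-‿cong (≈-trans (*-comm _ _) (≈-sym (*-assoc _ _ _)))) ⟩
        - (c i * S) + c i * S                        ≈⟨ -‿inverseˡ _ ⟩
        0#                                           ∎
      ci≈ : ∀ k → ⟨ f , tail (b (punchIn p k)) ⟩ ≈ c (punchIn p k) * S
      ci≈ k = begin
        X                          ≈⟨ +-identityʳ X ⟨
        X + 0#                     ≈⟨ +-congˡ (-‿inverseˡ (c i * S)) ⟨
        X + (- (c i * S) + c i * S) ≈⟨ +-assoc _ _ _ ⟨
        X + - (c i * S) + c i * S  ≈⟨ +-congʳ (≈-trans (+-congˡ (-‿distribˡ-* _ _)) X-cS≈0) ⟩
        0# + c i * S               ≈⟨ +-identityˡ _ ⟩
        c i * S                    ∎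
        where
        i = punchIn p k
        X = ⟨ f , tail (b i) ⟩
        X-cS≈0 : X + - c i * S ≈ 0#
        X-cS≈0 = ≈-trans (+-congˡ (≈-sym (⟨,⟩-* _ f _))) (≈-trans (≈-sym (⟨,⟩-+ f _ _)) (f⊥ k))
      g⊥ : ∀ i → ⟨ g , b i ⟩ ≈ 0#
      g⊥ i with p Finₚ.≟ i
      ... | yes refl = elim p (≈-trans (≈-sym (*-identityˡ S))
                         (*-congʳ (≈-trans (≈-sym inv*bp≈1) (*-comm _ _))))
      ... | no p≢i rewrite ≡.sym (Finₚ.punchIn-punchOut p≢i) = elim _ (ci≈ (punchOut p≢i))

    unit : ∀ {n} → Fin n → Vector K n
    unit zero    = 1# ∷ (λ _ → 0#)
    unit (suc i) = 0# ∷ unit i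

    ⟨,unit⟩ : ∀ {n} (f : Vector K n) i → ⟨ f , unit i ⟩ ≈ f i
    ⟨,unit⟩ f zero    = ≈-trans (+-cong (*-identityʳ _) (sum-zero {_} (λ j → zeroʳ (f (suc j))))) (+-identityʳ _)
    ⟨,unit⟩ f (suc i) = ≈-trans (+-cong (zeroʳ _) (⟨,unit⟩ (tail f) i)) (+-identityˡ _)

    sum-unit : ∀ {n} (c : Vector K n) k → sum (λ i → c i * unit i k) ≈ c k
    sum-unit c zero    = ≈-trans (+-cong (*-identityʳ _) (sum-zero {_} (λ j → zeroʳ (c (suc j))))) (+-identityʳ _)
    sum-unit c (suc k) = ≈-trans (+-cong (zeroʳ _) (sum-unit (tail c) k)) (+-identityˡ _)

    module Spaces (r : ℕ) where

      open LinearAlgebra F r public hiding (Carrier; _≈_; 0#; 1#; _+ᶠ_; _*ᶠ_)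

      linComb-∈ : ∀ (W : Subspace) {d} c (b : Vector V d) → (∀ i → b i U.∈ Member W) → linComb c b U.∈ Member W
      linComb-∈ W {zero}  c b b∈W = Subspace.0-closed W
      linComb-∈ W {suc d} c b b∈W =
        Subspace.+-closed W (Subspace.*-closed W (c zero) (b∈W zero)) (linComb-∈ W (tail c) (tail b) (b∈W ∘ suc))

      kernel : V → Subspace
      kernel f = record
        { Member   = λ v → ⟨ f , v ⟩ ≈ 0#
        ; resp     = λ u≋v fu≈0 → ≈-trans (⟨,⟩-cong (λ _ → ≈-refl) (≈-sym ∘ u≋v)) fu≈0
        ; 0-closed = sum-zero {_} (λ i → zeroʳ (f i))
        ; +-closed = λ {u} {v} fu≈0 fv≈0 → ≈-trans (⟨,⟩-+ f u v) (≈-trans (+-cong fu≈0 fv≈0) (+-identityˡ 0#))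
        ; *-closed = λ a {v} fv≈0 → ≈-trans (⟨,⟩-* a f v) (≈-trans (*-congˡ fv≈0) (zeroʳ a))
        }

      span : ∀ {d} → Vector V d → Subspace
      span {d} b = record
        { Member   = λ v → ∃[ c ] linComb c b ≋ v
        ; resp     = λ u≋v (c , eq) → c , λ j → ≈-trans (eq j) (u≋v j)
        ; 0-closed = (λ _ → 0#) , λ j → sum-zero {_} (λ i → zeroˡ (b i j))
        ; +-closed = λ (c , eq) (c′ , eq′) → (λ i → c i + c′ i) , λ j →
            ≈-trans (sum-cong-≋ {d} (λ i → distribʳ (b i j) (c i) (c′ i)))
              (≈-trans (∑-distrib-+ {d} (λ i → c i * b i j) (λ i → c′ i * b i j)) (+-cong (eq j) (eq′ j)))
        ; *-closed = λ a (c , eq) → (λ i → a * c i) , λ j →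
            ≈-trans (sum-cong-≋ {d} (λ i → *-assoc a (c i) (b i j)))
              (≈-trans (≈-sym (*-distribˡ-sum a (λ i → c i * b i j))) (*-congˡ (eq j)))
        }

      generators-∈-span : ∀ {d} (b : Vector V d) i → b i U.∈ Member (span b)
      generators-∈-span {d} b i = unit i , λ j →
        ≈-trans (sum-cong-≋ {d} (λ k → *-comm (unit i k) (b k j))) (⟨,unit⟩ (λ k → b k j) i)

      span-⊑ : ∀ {d} (b : Vector V d) W → (∀ i → b i U.∈ Member W) → span b ⊑ W
      span-⊑ b W b∈W (c , eq) = Subspace.resp W eq (linComb-∈ W c b b∈W)

      ∈-span? : ∀ {d} (b : Vector V d) → U.Decidable (Member (span b))
      ∈-span? {d} b v = search-vector ≈-refl search d
        (λ c≋c′ eq j → ≈-trans (sum-cong-≋ {d} (λ i → *-congʳ (≈-sym (c≋c′ i)))) (eq j))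
        (λ c → Finₚ.all? (λ j → linComb c b j ≈? v j))

      -- A generator is dropped exactly when it lies in the span of the later ones, which `∈-span?`
      -- decides.
      span-basis : ∀ {d} (b : Vector V d) → ∃[ d′ ] d′ ≤ d × HasDim (span b) d′
      span-basis {zero}  b = zero , z≤n , b , record
        { members = λ () ; independent = λ _ _ () ; spanning = λ v∈ → v∈ }
      span-basis {suc d} b with d′ , d′≤d , b′ , basis ← span-basis (tail b) | ∈-span? (tail b) (head b)
      ... | yes b₀∈ = d′ , ℕₚ.m≤n⇒m≤1+n d′≤d , b′ , record
        { members     = λ i → tail-⊑ (members i)
        ; independent = independent
        ; spanning    = λ v∈ → spanning (span-⊑ b (span (tail b))
            (λ { zero → b₀∈ ; (suc i) → generators-∈-span (tail b) i }) v∈)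
        }
        where
        open IsBasis basis
        tail-⊑ : span (tail b) ⊑ span b
        tail-⊑ = span-⊑ (tail b) (span b) (generators-∈-span b ∘ suc)
      ... | no b₀∉ = suc d′ , s≤s d′≤d , head b ∷ b′ , record
        { members     = λ { zero → generators-∈-span b zero ; (suc i) → tail-⊑ (members i) }
        ; independent = indep
        ; spanning    = λ (c , eq) →
            let c′ , eq′ = spanning (tail c , λ _ → ≈-refl)
            in head c ∷ c′ , λ j → ≈-trans (+-congˡ (eq′ j)) (eq j)
        }
        where
        open IsBasis basis
        tail-⊑ : span (tail b) ⊑ span b
        tail-⊑ = span-⊑ (tail b) (span b) (generators-∈-span b ∘ suc)
        c₀≈0 : ∀ c → linComb c (head b ∷ b′) ≋ 0ᵛ → head c ≈ 0#
        c₀≈0 c eq with head c ≈? 0#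
        ... | yes p = p
        -- A nonzero coefficient could be inverted, which would put the head into the span of the
        -- tail.
        ... | no c₀≉0 with inv , inv*c₀≈1 ← inverse (head c) c₀≉0 =
          contradiction (Subspace.resp (span (tail b)) b₀≋
            (Subspace.*-closed (span (tail b)) (- inv) (linComb-∈ (span (tail b)) (tail c) b′ members))) b₀∉
          where
          b₀≋ : ((- inv) *ᵛ linComb (tail c) b′) ≋ head b
          b₀≋ j = begin
            - inv * T                    ≈⟨ -‿distribˡ-* inv T ⟨
            - (inv * T)                  ≈⟨ +-identityˡ _ ⟨
            0# + - (inv * T)             ≈⟨ +-congʳ (zeroʳ inv) ⟨
            inv * 0# + - (inv * T)       ≈⟨ +-congʳ (*-congˡ (eq j)) ⟨
            inv * (head c * β + T) + - (inv * T)       ≈⟨ +-congʳ (distribˡ _ _ _) ⟩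
            inv * (head c * β) + inv * T + - (inv * T) ≈⟨ +-assoc _ _ _ ⟩
            inv * (head c * β) + (inv * T + - (inv * T)) ≈⟨ +-cong (≈-sym (*-assoc _ _ _)) (-‿inverseʳ _) ⟩
            inv * head c * β + 0#        ≈⟨ +-identityʳ _ ⟩
            inv * head c * β             ≈⟨ *-congʳ inv*c₀≈1 ⟩
            1# * β                       ≈⟨ *-identityˡ β ⟩
            β                            ∎
            where
            T = linComb (tail c) b′ j
            β = head b j
        indep : ∀ c → linComb c (head b ∷ b′) ≋ 0ᵛ → ∀ i → c i ≈ 0#
        indep c eq zero    = c₀≈0 c eq
        indep c eq (suc i) = independent (tail c)
          (λ j → ≈-trans (≈-sym (≈-trans (+-congʳ (≈-trans (*-congʳ (c₀≈0 c eq)) (zeroˡ _))) (+-identityˡ _))) (eq j)) i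

      -- Membership in a `Subspace` is an arbitrary predicate; a basis makes it decidable, as
      -- `ContainsExactly` asks for an actual subset of indices.
      ∈-hasDim? : ∀ {H d} → HasDim H d → U.Decidable (Member H)
      ∈-hasDim? {H} (b , basis) v = map′ (span-⊑ b H (IsBasis.members basis)) (IsBasis.spanning basis) (∈-span? b v)

    -- For each coordinate other than a pivot `p` with `f p` nonzero, take the unit vector and
    -- correct its entry at `p` so that `f` vanishes. A vector of the kernel is recovered from its
    -- coordinates off `p`.
    kernel-isHyperplane : ∀ {r} (f : Vector K r) → Nonzero f →
      Spaces.IsHyperplane r (Spaces.kernel r f)
    kernel-isHyperplane {suc n} f (p , fp≉0) with inv , inv*fp≈1 ← inverse (f p) fp≉0 =
      n , refl , b , record { members = members ; independent = independent ; spanning = spanning }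
      where
      open Spaces (suc n)
      f′ : Vector K n
      f′ = f ∘ punchIn p
      b : Vector V n
      b i = insertAt (unit i) p (- (f′ i * inv))
      at-p : ∀ i → b i p ≈ - (f′ i * inv)
      at-p i = reflexive (Vectorₚ.insertAt-lookup (unit i) p _)
      off-p : ∀ i k → b i (punchIn p k) ≈ unit i k
      off-p i k = reflexive (Vectorₚ.insertAt-punchIn (unit i) p _ k)
      split : ∀ v → ⟨ f , v ⟩ ≈ f p * v p + ⟨ f′ , v ∘ punchIn p ⟩
      split v = sum-remove {i = p} (λ j → f j * v j)
      members : ∀ i → ⟨ f , b i ⟩ ≈ 0#
      members i = begin
        ⟨ f , b i ⟩                                    ≈⟨ split (b i) ⟩
        f p * b i p + ⟨ f′ , b i ∘ punchIn p ⟩         ≈⟨ +-cong (*-congˡ (at-p i)) (⟨,⟩-cong (λ _ → ≈-refl) (off-p i)) ⟩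
        f p * - (f′ i * inv) + ⟨ f′ , unit i ⟩         ≈⟨ +-cong (≈-sym (-‿distribʳ-* _ _)) (⟨,unit⟩ f′ i) ⟩
        - (f p * (f′ i * inv)) + f′ i                  ≈⟨ +-congʳ (-‿cong (≈-trans (*-comm _ _) (*-assoc _ _ _))) ⟩
        - (f′ i * (inv * f p)) + f′ i                  ≈⟨ +-congʳ (-‿cong (≈-trans (*-congˡ inv*fp≈1) (*-identityʳ _))) ⟩
        - f′ i + f′ i                                  ≈⟨ -‿inverseˡ _ ⟩
        0#                                             ∎
      linComb-off-p : ∀ c k → linComb c b (punchIn p k) ≈ c k
      linComb-off-p c k = ≈-trans (sum-cong-≋ {n} (λ i → *-congˡ (off-p i k))) (sum-unit c k)
      independent : ∀ c → linComb c b ≋ 0ᵛ → ∀ i → c i ≈ 0#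
      independent c eq i = ≈-trans (≈-sym (linComb-off-p c i)) (eq (punchIn p i))
      spanning : ∀ {v} → ⟨ f , v ⟩ ≈ 0# → ∃[ c ] linComb c b ≋ v
      spanning {v} fv≈0 = c , eq
        where
        c = v ∘ punchIn p
        S = ⟨ f′ , c ⟩
        cp : linComb c b p ≈ v p
        cp = begin
          sum (λ i → c i * b i p)              ≈⟨ sum-cong-≋ {n} (λ i → ≈-trans (*-congˡ (≈-trans (at-p i) (-‿distribʳ-* _ _)))
                                                    (≈-trans (≈-sym (*-assoc _ _ _)) (*-congʳ (*-comm _ _)))) ⟩
          sum (λ i → f′ i * c i * - inv)       ≈⟨ *-distribʳ-sum (- inv) (λ i → f′ i * c i) ⟨
          S * - inv                            ≈⟨ ≈-trans (*-comm _ _) (≈-sym (-‿distribˡ-* _ _)) ⟩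
          - (inv * S)                          ≈⟨ +-identityˡ _ ⟨
          0# + - (inv * S)                     ≈⟨ +-congʳ (≈-trans (*-congˡ (≈-trans (≈-sym (split v)) fv≈0)) (zeroʳ inv)) ⟨
          inv * (f p * v p + S) + - (inv * S)  ≈⟨ +-congʳ (distribˡ _ _ _) ⟩
          inv * (f p * v p) + inv * S + - (inv * S)    ≈⟨ +-assoc _ _ _ ⟩
          inv * (f p * v p) + (inv * S + - (inv * S))  ≈⟨ +-cong (≈-sym (*-assoc _ _ _)) (-‿inverseʳ _) ⟩
          inv * f p * v p + 0#                 ≈⟨ +-identityʳ _ ⟩
          inv * f p * v p                      ≈⟨ *-congʳ inv*fp≈1 ⟩
          1# * v p                             ≈⟨ *-identityˡ _ ⟩
          v p                                  ∎
        eq : linComb c b ≋ v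
        eq j with p Finₚ.≟ j
        ... | yes refl = cp
        ... | no p≢j rewrite ≡.sym (Finₚ.punchIn-punchOut p≢j) = linComb-off-p c (punchOut p≢j)

-- Projective systems as families of generators, and the existence of the maximum.

module SpanSystems where

  open FiniteVectorSpaces
  open import Algebra.Bundles using (CommutativeRing)
  import Algebra.Properties.CommutativeMonoid.Sum as MonoidSum
  open import Data.Bool using (true; false; if_then_else_)
  open import Data.Fin using (Fin; zero; suc; funToFin; finToFun)
  import Data.Fin.Properties as Finₚ
  open import Data.Fin.Subset using (Subset; ∣_∣)
  import Data.Fin.Subset as Sub
  import Data.Fin.Subset.Properties as Subₚ
  open import Data.Nat as ℕ using (ℕ; zero; suc; _≤_; _<_; z≤n; s≤s; _*_; _^_)
  import Data.Nat.Properties as ℕₚ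
  open import Data.Product using (∃-syntax; _×_; _,_; proj₁; proj₂)
  open import Data.Vec using (tabulate)
  import Data.Vec.Properties as Vecₚ
  open import Data.Vec.Functional using (Vector; _∷_; head; tail)
  open import Function using (_∘_; _⇔_)
  open import Function.Bundles using (Inverse; Equivalence; mk⇔)
  open import Relation.Binary.PropositionalEquality as ≡ using (_≡_; refl; cong; subst)
  open import Relation.Nullary using (Dec; yes; no; contradiction; does)
  open import Relation.Nullary.Decidable using (map′; _×-dec_; dec-true; ¬?)
  import Relation.Unary as U

  ⟦_⟧ : ∀ {n} {P : Fin n → Set} → U.Decidable P → Subset n
  ⟦ P? ⟧ = tabulate (does ∘ P?)

  ∈⟦⟧ : ∀ {n} {P : Fin n → Set} (P? : U.Decidable P) i → (i Sub.∈ ⟦ P? ⟧) ⇔ P i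
  ∈⟦⟧ {P = P} P? i = mk⇔ to from
    where
    to : i Sub.∈ ⟦ P? ⟧ → P i
    to i∈ with P? i | ≡.trans (≡.sym (Vecₚ.lookup∘tabulate (does ∘ P?) i)) (Vecₚ.[]=⇒lookup i∈)
    ... | yes p | _ = p
    from : P i → i Sub.∈ ⟦ P? ⟧
    from p = Vecₚ.lookup⇒[]= i _ (≡.trans (Vecₚ.lookup∘tabulate (does ∘ P?) i) (dec-true (P? i) p))

  ∣∣-mono : ∀ {n} {P Q : Fin n → Set} (P? : U.Decidable P) (Q? : U.Decidable Q) →
    (∀ i → P i → Q i) → ∣ ⟦ P? ⟧ ∣ ≤ ∣ ⟦ Q? ⟧ ∣
  ∣∣-mono P? Q? P⊆Q = Subₚ.p⊆q⇒∣p∣≤∣q∣ λ {i} i∈ →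
    Equivalence.from (∈⟦⟧ Q? i) (P⊆Q i (Equivalence.to (∈⟦⟧ P? i) i∈))

  ∣∣-cong : ∀ {n} {P Q : Fin n → Set} (P? : U.Decidable P) (Q? : U.Decidable Q) →
    (∀ i → P i → Q i) → (∀ i → Q i → P i) → ∣ ⟦ P? ⟧ ∣ ≡ ∣ ⟦ Q? ⟧ ∣
  ∣∣-cong P? Q? P⊆Q Q⊆P = ℕₚ.≤-antisym (∣∣-mono P? Q? P⊆Q) (∣∣-mono Q? P? Q⊆P)

  open MonoidSum ℕₚ.+-0-commutativeMonoid using (sum; ∑-comm; sum-cong-≗)

  indicator : ∀ {P : Set} → Dec P → ℕ
  indicator P? = if does P? then 1 else 0

  ∣∣≡sum : ∀ {n} {P : Fin n → Set} (P? : U.Decidable P) → ∣ ⟦ P? ⟧ ∣ ≡ sum (indicator ∘ P?)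
  ∣∣≡sum {zero}  P? = refl
  ∣∣≡sum {suc n} P? with does (P? zero)
  ... | true  = cong suc (∣∣≡sum (P? ∘ suc))
  ... | false = ∣∣≡sum (P? ∘ suc)

  sum-≤ : ∀ {n} (t : Fin n → ℕ) {c} → (∀ i → t i ≤ c) → sum t ≤ n * c
  sum-≤ {zero}  t t≤ = z≤n
  sum-≤ {suc n} t t≤ = ℕₚ.+-mono-≤ (t≤ zero) (sum-≤ (t ∘ suc) (t≤ ∘ suc))

  sum-indicator-≟ : ∀ {n} (j : Fin n) → sum (λ i → indicator (j Finₚ.≟ i)) ≡ 1
  sum-indicator-≟ {suc n} zero = cong suc (zeros n)
    where
    zeros : ∀ n → sum {n} (λ _ → 0) ≡ 0
    zeros zero    = refl
    zeros (suc n) = zeros n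
  sum-indicator-≟ {suc n} (suc j) = ≡.trans (sum-cong-≗ {n} (λ i → refl)) (sum-indicator-≟ j)

  sum-ones : ∀ n → sum {n} (λ _ → 1) ≡ n
  sum-ones zero    = refl
  sum-ones (suc n) = cong suc (sum-ones n)

  -- Double counting of the pairs (i , g i).
  fibres-bound : ∀ {m k s} (g : Fin m → Fin k) → (∀ c → ∣ ⟦ (λ i → g i Finₚ.≟ c) ⟧ ∣ ≤ s) → m ≤ k * s
  fibres-bound {m} {k} {s} g fibre≤s = begin
    m                                                ≡⟨ sum-ones m ⟨
    sum {m} (λ i → 1)                                ≡⟨ sum-cong-≗ {m} (λ i → sum-indicator-≟ (g i)) ⟨
    sum {m} (λ i → sum {k} (λ c → indicator (g i Finₚ.≟ c)))  ≡⟨ ∑-comm {m} {k} _ ⟩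
    sum {k} (λ c → sum {m} (λ i → indicator (g i Finₚ.≟ c)))  ≤⟨ sum-≤ {k} _ (λ c →
       subst (_≤ s) (∣∣≡sum (λ i → g i Finₚ.≟ c)) (fibre≤s c)) ⟩
    k * s                                            ∎
    where open ℕₚ.≤-Reasoning

  -- Descends from the bound; deciding `P` at each size turns a mere bound into an attained maximum.
  maximum : ∀ {P : ℕ → Set₁} {a} B → (∀ m → Dec (P m)) → P a → (∀ m → P m → m ≤ B) →
    ∃[ N ] (P N × (∀ m → P m → m ≤ N)) × a ≤ N
  maximum {P} {a} B P? Pa bounded with P? B
  ... | yes PB = B , (PB , bounded) , bounded a Pa
  maximum {P} {a} zero P? Pa bounded | no ¬PB =
    contradiction (subst P (ℕₚ.n≤0⇒n≡0 (bounded a Pa)) Pa) ¬PB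
  maximum {P} {a} (suc B) P? Pa bounded | no ¬PB =
    maximum B P? Pa λ m Pm → ℕₚ.≤-pred (ℕₚ.≤∧≢⇒< (bounded m Pm) λ { refl → ¬PB Pm })

  module Systems {q} (F : FiniteField q) (h r s : ℕ) where

    open FieldTheory F
    open Spaces r
    open CommutativeRing (FiniteField.commutativeRing F)
      using (_≈_; 0#) renaming (Carrier to K; refl to ≈-refl; sym to ≈-sym; trans to ≈-trans)
    private module E = Inverse (FiniteField.enumeration F)

    -- Every member gets exactly `h` generators, zero or dependent ones allowed, so that the
    -- families of a given size form a searchable type.
    Family : ℕ → Set
    Family m = Fin m → Vector V h

    incident? : ∀ {m} (b : Family m) (f : V) (i : Fin m) → Dec (∀ j → ⟨ f , b i j ⟩ ≈ 0#)
    incident? b f i = Finₚ.all? (λ j → ⟨ f , b i j ⟩ ≈? 0#)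

    degree : ∀ {m} → Family m → V → ℕ
    degree b f = ∣ ⟦ incident? b f ⟧ ∣

    -- Nonzero functionals stand for hyperplanes: every hyperplane lies in the kernel of one, and
    -- each such kernel is a hyperplane.
    IsSystem : ∀ {m} → Family m → Set
    IsSystem b = (∀ f → Nonzero f → degree b f ≤ s) × (∃[ f ] Nonzero f × degree b f ≡ s)

    degree-cong : ∀ {m} (b b′ : Family m) {f f′} → (∀ i j k → b i j k ≈ b′ i j k) → f ≋ f′ →
      degree b f ≡ degree b′ f′
    degree-cong b b′ {f} {f′} b≋b′ f≋f′ = ∣∣-cong (incident? b f) (incident? b′ f′)
      (λ i p j → ≈-trans (⟨,⟩-cong (≈-sym ∘ f≋f′) (λ k → ≈-sym (b≋b′ i j k))) (p j))
      (λ i p j → ≈-trans (⟨,⟩-cong f≋f′ (b≋b′ i j)) (p j))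

    pad : ∀ {d n} → d ≤ n → Vector V d → Vector V n
    pad z≤n       b = λ _ → 0ᵛ
    pad (s≤s d≤n) b = head b ∷ pad d≤n (tail b)

    pad-all : ∀ {d n} (d≤n : d ≤ n) (b : Vector V d) (P : V → Set) → P 0ᵛ → (∀ i → P (b i)) → ∀ j → P (pad d≤n b j)
    pad-all z≤n       b P P0 Pb j       = P0
    pad-all (s≤s d≤n) b P P0 Pb zero    = Pb zero
    pad-all (s≤s d≤n) b P P0 Pb (suc j) = pad-all d≤n (tail b) P P0 (Pb ∘ suc) j

    pad-all⁻ : ∀ {d n} (d≤n : d ≤ n) (b : Vector V d) (P : V → Set) → (∀ j → P (pad d≤n b j)) → ∀ i → P (b i)
    pad-all⁻ (s≤s d≤n) b P Ppad zero    = Ppad zero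
    pad-all⁻ (s≤s d≤n) b P Ppad (suc i) = pad-all⁻ d≤n (tail b) P (Ppad ∘ suc) i

    -- A basis of `H` has fewer than `r` vectors, so a nonzero functional annihilates it. The
    -- inclusion transports counts: a member inside `H` is inside the kernel.
    hyperplane-⊑-kernel : ∀ H → IsHyperplane H → ∃[ f ] Nonzero f × H ⊑ kernel f
    hyperplane-⊑-kernel H (d , refl , b , basis) with f , f≉0 , f⊥ ← annihilator (ℕₚ.n<1+n d) b =
      f , f≉0 , λ v∈H → let c , eq = IsBasis.spanning basis v∈H in
        Subspace.resp (kernel f) eq (linComb-∈ (kernel f) c b f⊥)

    private
      ContainsExactly-unique : ∀ {m H} {W : Vector Subspace m} {k} {P : Fin m → Set} (P? : U.Decidable P) →
        (∀ i → (W i ⊑ H) ⇔ P i) → ContainsExactly H W k → ∣ ⟦ P? ⟧ ∣ ≡ k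
      ContainsExactly-unique P? eqv (I , I⇔ , refl) = ℕₚ.≤-antisym
        (Subₚ.p⊆q⇒∣p∣≤∣q∣ λ {i} i∈ → Equivalence.from (I⇔ i) (Equivalence.from (eqv i) (Equivalence.to (∈⟦⟧ P? i) i∈)))
        (Subₚ.p⊆q⇒∣p∣≤∣q∣ λ {i} i∈ → Equivalence.from (∈⟦⟧ P? i) (Equivalence.to (eqv i) (Equivalence.to (I⇔ i) i∈)))

    fromProjectiveSystem : ∀ {m} → ProjectiveSystem F h m r s → ∃[ b ] IsSystem {m} b
    fromProjectiveSystem {m} (W , isPS) = b , bound , f₀ , f₀≉0 , ℕₚ.≤-antisym (bound f₀ f₀≉0) s≤degree
      where
      open IsProjectiveSystem isPS
      basis : ∀ i → Vector V (proj₁ (dim≤ i))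
      basis i = proj₁ (proj₂ (proj₂ (dim≤ i)))
      isBasis : ∀ i → IsBasis (W i) (basis i)
      isBasis i = proj₂ (proj₂ (proj₂ (dim≤ i)))
      b : Family m
      b i = pad (proj₁ (proj₂ (dim≤ i))) (basis i)
      ⊑⇒incident : ∀ f i → W i ⊑ kernel f → ∀ j → ⟨ f , b i j ⟩ ≈ 0#
      ⊑⇒incident f i W⊑ = pad-all (proj₁ (proj₂ (dim≤ i))) (basis i) (λ v → ⟨ f , v ⟩ ≈ 0#)
        (Subspace.0-closed (kernel f)) (λ j → W⊑ (IsBasis.members (isBasis i) j))
      incident⇒⊑ : ∀ f i → (∀ j → ⟨ f , b i j ⟩ ≈ 0#) → W i ⊑ kernel f
      incident⇒⊑ f i inc v∈W with c , eq ← IsBasis.spanning (isBasis i) v∈W =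
        Subspace.resp (kernel f) eq (linComb-∈ (kernel f) c (basis i)
          (pad-all⁻ (proj₁ (proj₂ (dim≤ i))) (basis i) (λ v → ⟨ f , v ⟩ ≈ 0#) inc))
      ⊑⇔incident : ∀ f i → (W i ⊑ kernel f) ⇔ (∀ j → ⟨ f , b i j ⟩ ≈ 0#)
      ⊑⇔incident f i = mk⇔ (⊑⇒incident f i) (incident⇒⊑ f i)
      bound : ∀ f → Nonzero f → degree b f ≤ s
      bound f f≉0 with k , k≤s , exactly ← atMost (kernel f) (kernel-isHyperplane f f≉0) =
        subst (_≤ s) (≡.sym (ContainsExactly-unique {H = kernel f} {W} (incident? b f) (⊑⇔incident f) exactly)) k≤s
      H = proj₁ attained
      H⊑ = hyperplane-⊑-kernel H (proj₁ (proj₂ attained))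
      f₀ = proj₁ H⊑
      f₀≉0 = proj₁ (proj₂ H⊑)
      -- The `s` members inside the attaining hyperplane lie in the kernel of `f₀`, and the bound on
      -- kernels turns this into an equality.
      s≤degree : s ≤ degree b f₀
      s≤degree with I , I⇔ , ∣I∣≡s ← proj₂ (proj₂ attained) =
        subst (_≤ degree b f₀) ∣I∣≡s (Subₚ.p⊆q⇒∣p∣≤∣q∣ λ {i} i∈ →
          Equivalence.from (∈⟦⟧ (incident? b f₀) i)
            (Equivalence.to (⊑⇔incident f₀ i) (λ v∈W → proj₂ (proj₂ H⊑) (Equivalence.to (I⇔ i) i∈ v∈W))))

    toProjectiveSystem : ∀ {m} (b : Family m) → IsSystem b → ProjectiveSystem F h m r s
    toProjectiveSystem {m} b (bound , f₀ , f₀≉0 , deg≡s) = W , record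
      { dim≤     = λ i → span-basis (b i)
      ; atMost   = atMost
      ; attained = kernel f₀ , kernel-isHyperplane f₀ f₀≉0 , ⟦ incident? b f₀ ⟧ ,
          ∈⟦⟧⇔⊑ (kernel f₀) (incident? b f₀) , deg≡s
      }
      where
      W : Vector Subspace m
      W i = span (b i)
      ∈⟦⟧⇔⊑ : ∀ H (P? : U.Decidable (λ i → ∀ j → b i j U.∈ Member H)) i → (i Sub.∈ ⟦ P? ⟧) ⇔ (W i ⊑ H)
      ∈⟦⟧⇔⊑ H P? i = mk⇔ to from
        where
        to : i Sub.∈ ⟦ P? ⟧ → W i ⊑ H
        to i∈ = span-⊑ (b i) H (Equivalence.to (∈⟦⟧ P? i) i∈)
        from : W i ⊑ H → i Sub.∈ ⟦ P? ⟧
        from W⊑ = Equivalence.from (∈⟦⟧ P? i) (λ j → W⊑ (generators-∈-span (b i) j))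
      atMost : ∀ H → IsHyperplane H → ∃[ k ] k ≤ s × ContainsExactly H W k
      atMost H hyp@(d , _ , dimH) with f , f≉0 , H⊑ ← hyperplane-⊑-kernel H hyp =
        ∣ ⟦ W⊑H? ⟧ ∣ ,
        ℕₚ.≤-trans (∣∣-mono W⊑H? (incident? b f) (λ i b∈H j → H⊑ (b∈H j))) (bound f f≉0) ,
        ⟦ W⊑H? ⟧ ,
        ∈⟦⟧⇔⊑ H W⊑H? ,
        refl
        where
        W⊑H? : U.Decidable (λ i → ∀ j → b i j U.∈ Member H)
        W⊑H? i = Finₚ.all? (λ j → ∈-hasDim? {H} dimH (b i j))

    isSystem? : ∀ {m} → U.Decidable (IsSystem {m})
    -- The search is existential, so the universal bound is decided as the absence of a functional
    -- of degree above `s`.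
    isSystem? b = map′ (λ ∄ f f≉0 → ℕₚ.≮⇒≥ (λ s<deg → ∄ (f , f≉0 , s<deg)))
        (λ bound (f , f≉0 , s<deg) → ℕₚ.<⇒≱ s<deg (bound f f≉0))
        (¬? (searchV (λ f≋g (f≉0 , lt) → Nonzero-resp f≋g f≉0 , subst (s <_) (degree-cong b b (λ _ _ _ → ≈-refl) f≋g) lt)
          (λ f → nonzero? f ×-dec (s ℕₚ.<? degree b f))))
      ×-dec searchV (λ f≋g (f≉0 , eq) → Nonzero-resp f≋g f≉0 , ≡.trans (≡.sym (degree-cong b b (λ _ _ _ → ≈-refl) f≋g)) eq)
          (λ f → nonzero? f ×-dec (degree b f ℕₚ.≟ s))
      where
      searchV : Searchable {V} _≋_
      searchV = search-vector ≈-refl search r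

    IsSystem-resp : ∀ {m} {b b′ : Family m} → (∀ i j k → b i j k ≈ b′ i j k) → IsSystem b → IsSystem b′
    IsSystem-resp {b = b} {b′} b≋b′ (bound , f , f≉0 , deg≡s) =
      (λ f f≉0 → subst (_≤ s) (degree-cong b b′ b≋b′ (λ _ → ≈-refl)) (bound f f≉0)) ,
      f , f≉0 , ≡.trans (≡.sym (degree-cong b b′ b≋b′ (λ _ → ≈-refl))) deg≡s

    projectiveSystem? : ∀ m → Dec (ProjectiveSystem F h m r s)
    projectiveSystem? m = map′ (λ (b , sys) → toProjectiveSystem b sys) fromProjectiveSystem
      (search-vector (λ _ _ → ≈-refl) (search-vector (λ _ → ≈-refl) (search-vector ≈-refl search r) h) m
        IsSystem-resp isSystem?)

    module _ (h<r : h < r) where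

      -- As `h < r`, each member lies in the kernel of a nonzero functional. There are at most
      -- `q ^ r` functionals, each accounting for at most `s` members.
      projectiveSystem-bounded : ∀ m → ProjectiveSystem F h m r s → m ≤ q ^ r * s
      projectiveSystem-bounded m PS with b , bound , _ ← fromProjectiveSystem PS = fibres-bound g fibre≤s
        where
        f : Fin m → V
        f i = proj₁ (annihilator h<r (b i))
        g : Fin m → Fin (q ^ r)
        g i = funToFin (E.to ∘ f i)
        decode : Fin (q ^ r) → V
        decode c = E.from ∘ finToFun c
        decode-g : ∀ i → decode (g i) ≋ f i
        decode-g i k = ≈-trans (E.from-cong (Finₚ.finToFun-funToFin (E.to ∘ f i) k)) (E.strictlyInverseʳ _)
        fibre≤s : ∀ c → ∣ ⟦ (λ i → g i Finₚ.≟ c) ⟧ ∣ ≤ s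
        fibre≤s c with nonzero? (decode c)
        ... | yes dc≉0 = ℕₚ.≤-trans
          (∣∣-mono (λ i → g i Finₚ.≟ c) (incident? b (decode c)) (λ { i refl j →
            ≈-trans (⟨,⟩-cong (decode-g i) (λ _ → ≈-refl)) (proj₂ (proj₂ (annihilator h<r (b i))) j) }))
          (bound (decode c) dc≉0)
        -- The fibre over a code of the zero functional is empty, since annihilators are nonzero.
        ... | no dc≈0 = ℕₚ.≤-trans (∣∣-mono (λ i → g i Finₚ.≟ c) (λ _ → no (λ ()))
            (λ { i refl → dc≈0 (Nonzero-resp (λ k → ≈-sym (decode-g i k)) (proj₁ (proj₂ (annihilator h<r (b i))))) }))
          (ℕₚ.≤-trans (ℕₚ.≤-reflexive (∣∅∣ m)) z≤n)
          where
          open import Data.Empty using (⊥)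
          ∣∅∣ : ∀ m → ∣ ⟦_⟧ {m} {λ _ → ⊥} (λ _ → no (λ ())) ∣ ≡ 0
          ∣∅∣ zero    = refl
          ∣∅∣ (suc m) = ∣∅∣ m

      IsN-exists : ∀ {a} → ProjectiveSystem F h a r s → ∃[ N ] (IsN F r h s N × N ℕ.≥ a)
      IsN-exists PS = maximum (q ^ r * s) projectiveSystem? PS projectiveSystem-bounded

-- Explicit systems of planes over 𝔽₂.

module BinarySystems where

  open FiniteVectorSpaces
  open SpanSystems
  open import Data.Bool using (Bool; true; false; T; _∧_; _∨_; _xor_; not; if_then_else_)
  import Data.Bool.Properties as Boolₚ
  open import Data.Fin using (zero; suc)
  import Data.Fin.Properties as Finₚ
  open import Data.List as List using (List; []; _∷_)
  open import Data.Nat using (ℕ; zero; suc; _≤_; _≤ᵇ_; _≥_; ⌊_/2⌋)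
  import Data.Nat.Properties as ℕₚ
  open import Data.Product using (∃-syntax; _×_; _,_; proj₂)
  open import Data.Vec as Vec using (Vec; []; _∷_; lookup; tabulate)
  import Data.Vec.Properties as Vecₚ
  open import Function using (_∘_)
  open import Relation.Binary.PropositionalEquality using (_≡_; refl; cong; sym; trans; subst)
  open import Relation.Nullary using (Dec; does; yes; no; contradiction)
  open import Relation.Nullary.Decidable using (does-⇔; dec-true)

  open FieldTheory 𝔽₂ using (⟨_,_⟩; ⟨,⟩-cong; Nonzero; Nonzero-resp)

  module Binary (r h s : ℕ) where

    open Systems 𝔽₂ h r s

    Space : Set
    Space = Vec (Vec Bool r) h

    dot : ∀ {n} → Vec Bool n → Vec Bool n → Bool
    dot []      []      = false
    dot (x ∷ v) (y ∷ w) = (x ∧ y) xor dot v w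

    dot-correct : ∀ {n} (v w : Vec Bool n) → ⟨ lookup v , lookup w ⟩ ≡ dot v w
    dot-correct []      []      = refl
    dot-correct (x ∷ v) (y ∷ w) = cong ((x ∧ y) xor_) (dot-correct v w)

    vanishes : ∀ {k} → Vec Bool r → Vec (Vec Bool r) k → Bool
    vanishes f []      = true
    vanishes f (v ∷ w) = if dot f v then false else vanishes f w

    vanishes-correct : ∀ {k} f (w : Vec (Vec Bool r) k) (P? : Dec (∀ j → ⟨ lookup f , lookup (lookup w j) ⟩ ≡ false)) →
      does P? ≡ vanishes f w
    vanishes-correct f [] P? = dec-true P? (λ ())
    vanishes-correct f (v ∷ w) P? with dot f v in eq
    ... | true with P?
    ...   | yes p = contradiction (trans (sym eq) (trans (sym (dot-correct f v)) (p zero))) (λ ())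
    ...   | no _  = refl
    vanishes-correct f (v ∷ w) P? | false = trans
      (does-⇔ (record
        { to = λ p → p ∘ suc
        ; from = λ { p zero → trans (dot-correct f v) eq ; p (suc j) → p j }
        ; to-cong = λ { refl → refl } ; from-cong = λ { refl → refl } }) P? tail?)
      (vanishes-correct f w tail?)
      where
      tail? = Finₚ.all? (λ j → ⟨ lookup f , lookup (lookup w j) ⟩ Boolₚ.≟ false)

    family : (ws : List Space) → Family (List.length ws)
    family ws i j = lookup (lookup (List.lookup ws i) j)

    -- A purely Boolean counterpart of `degree` on bit vectors, light enough for the bound over all
    -- 512 functionals to be checked by evaluation.
    size : Vec Bool r → List Space → ℕ
    size f []       = 0
    size f (w ∷ ws) = if vanishes f w then suc (size f ws) else size f ws

    size-correct : ∀ f ws → degree (family ws) (lookup f) ≡ size f ws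
    size-correct f [] = refl
    size-correct f (w ∷ ws) with does (incident? (family (w ∷ ws)) (lookup f) zero)
                               | vanishes-correct f w (incident? (family (w ∷ ws)) (lookup f) zero)
    ... | true  | eq rewrite sym eq = cong suc (size-correct f ws)
    ... | false | eq rewrite sym eq = size-correct f ws

    all : ∀ {n} → (Vec Bool n → Bool) → Bool
    all {zero}  p = p []
    all {suc n} p = all (p ∘ (true ∷_)) ∧ all (p ∘ (false ∷_))

    all-sound : ∀ {n} (p : Vec Bool n → Bool) → all p ≡ true → ∀ v → p v ≡ true
    all-sound p eq [] = eq
    all-sound p eq (b ∷ v) with all (p ∘ (true ∷_)) in eq₁ | all (p ∘ (false ∷_)) in eq₂
    all-sound p eq (true ∷ v) | true | true = all-sound (p ∘ (true ∷_)) eq₁ v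
    all-sound p eq (false ∷ v) | true | true = all-sound (p ∘ (false ∷_)) eq₂ v

    isZero : ∀ {n} → Vec Bool n → Bool
    isZero []      = true
    isZero (b ∷ v) = not b ∧ isZero v

    isZero-sound : ∀ {n} (v : Vec Bool n) → isZero v ≡ true → ∀ i → lookup v i ≡ false
    isZero-sound (false ∷ v) eq zero    = refl
    isZero-sound (false ∷ v) eq (suc i) = isZero-sound v eq i

    bounded : List Space → Bool
    bounded ws = all (λ f → isZero f ∨ (size f ws ≤ᵇ s))

    isSystem : ∀ ws → bounded ws ≡ true → ∀ f → isZero f ≡ false → size f ws ≡ s → IsSystem (family ws)
    isSystem ws ok f₀ f₀≢0 size≡s = bound , lookup f₀ , nonzero f₀ f₀≢0 , trans (size-correct f₀ ws) size≡s
      where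
      nonzero : ∀ {n} (v : Vec Bool n) → isZero v ≡ false → Nonzero (lookup v)
      nonzero (true  ∷ v) eq = zero , λ ()
      nonzero (false ∷ v) eq = let i , p = nonzero v eq in suc i , p
      bound : ∀ f → Nonzero f → degree (family ws) f ≤ s
      bound f f≢0 with v ← tabulate f in eq =
        subst (_≤ s) (trans (sym (size-correct v ws)) (degree-cong (family ws) (family ws) (λ _ _ _ → refl) v≗f)) size≤s
        where
        v≗f : ∀ i → lookup v i ≡ f i
        v≗f i = trans (cong (λ v → lookup v i) (sym eq)) (Vecₚ.lookup∘tabulate f i)
        size≤s : size v ws ≤ s
        size≤s with isZero v in z | size v ws ≤ᵇ s in le | all-sound _ ok v
        ... | true  | _ | _ = contradiction (trans (sym (v≗f _)) (isZero-sound v z _)) (proj₂ f≢0)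
        ... | false | true | _ = ℕₚ.≤ᵇ⇒≤ _ _ (subst T (sym le) _)
        ... | false | false | ()

  open Binary 9 3 using (isSystem)

  odd : ℕ → Bool
  odd 0 = false
  odd (suc n) = not (odd n)

  bits : ∀ r → ℕ → Vec Bool r
  bits zero    _ = []
  bits (suc r) k = odd k ∷ bits r ⌊ k /2⌋

  -- With bits c₀ … c₈ read as c₀ + c₁x + … + c₈x⁸, multiplication by x modulo x⁹ + p.
  times-x : Vec Bool 9 → Vec Bool 9 → Vec Bool 9
  times-x p v = if Vec.last v then Vec.zipWith _xor_ p shifted else shifted
    where shifted = false ∷ Vec.init v

  orbit : Vec Bool 9 → ℕ → (a b c : ℕ) → List (Vec (Vec Bool 9) 3)
  orbit p n a b c = List.iterate (Vec.map (times-x p)) (Vec.map (bits 9) (a ∷ b ∷ c ∷ [])) n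

  -- Modulo x⁹ + 1; every hyperplane contains 3 or 7 of these planes.
  planes₅₁ : List (Vec (Vec Bool 9) 3)
  planes₅₁ = List.concat
    ( orbit 1′ 3  9  65 147
    ∷ orbit 1′ 3  7  56 448
    ∷ orbit 1′ 9 37 209 270
    ∷ orbit 1′ 9 21  41 202
    ∷ orbit 1′ 9 10  54  81
    ∷ orbit 1′ 9 23  38  78
    ∷ orbit 1′ 9 62  67 151
    ∷ [])
    where 1′ = bits 9 1

  -- Modulo a divisor of x²¹ + 1 of degree 9; the planes cover the 21 points of one orbit of x, a [21,9,8]
  -- code, twice and all other points once, so that a hyperplane contains 8, 9 or 10 of them.
  planes₇₆ : List (Vec (Vec Bool 9) 3)
  planes₇₆ = List.concat
    ( orbit p  7  1 116 128
    ∷ orbit p 21 54  65 154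
    ∷ orbit p  3 39  69 287
    ∷ orbit p 21  5   9  99
    ∷ orbit p 21 46  67 139
    ∷ orbit p  3 22 105 166
    ∷ [])
    where p = bits 9 311

  n₂-9-3-7 : ∃[ N ] (IsN 𝔽₂ 9 3 7 N × N ≥ 51)
  -- `4 ≤ 4 + 5` is the condition 3 < 9. The functional `bits 9 1` reads the constant coefficient;
  -- its kernel contains exactly 7 of the planes.
  n₂-9-3-7 = IsN-exists (ℕₚ.m≤m+n 4 5)
    (toProjectiveSystem (Binary.family 9 3 7 planes₅₁) (isSystem 7 planes₅₁ refl (bits 9 1) refl refl))
    where open Systems 𝔽₂ 3 9 7

  n₂-9-3-10 : ∃[ N ] (IsN 𝔽₂ 9 3 10 N × N ≥ 76)
  n₂-9-3-10 = IsN-exists (ℕₚ.m≤m+n 4 5)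
    (toProjectiveSystem (Binary.family 9 3 10 planes₇₆) (isSystem 10 planes₇₆ refl (bits 9 1) refl refl))
    where open Systems 𝔽₂ 3 9 10

open import Algebra.Bundles using (CommutativeRing)
import Algebra.Properties.Semiring.Sum as SemiringSum
import Algebra.Solver.Ring.NaturalCoefficients.Default as RingSolver
open import Data.Bool using (Bool; true; false; if_then_else_; _∧_; not; T; _xor_)
import Data.Bool.Properties as Boolₚ
open import Data.Empty using (⊥)
open import Data.Fin using (Fin; zero; suc; inject≤)
open import Data.List as List using (List; []; _∷_; length; _++_)
import Data.List.Properties as Listₚ
open import Data.List.Relation.Unary.All as All using (All; []; _∷_)
import Data.List.Relation.Unary.All.Properties as Allₚ
open import Data.List.Relation.Unary.Any as Any using (Any; here; there)
open import Data.Maybe using (Maybe; just; nothing)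
open import Data.Nat as ℕ using (ℕ; zero; suc; _+_; _*_; _≤_; z≤n; _<_; s≤s; _≡ᵇ_; _∸_; _<ᵇ_; ⌊_/2⌋; _>_; _≥_; s≤s⁻¹)
open import Data.Nat.DivMod using (_/_)
import Data.Nat.Properties as ℕₚ
open import Data.Nat.Solver using (module +-*-Solver)
open import Data.Product using (proj₁; proj₂; Σ-syntax)
open import Data.Unit using (⊤; tt)
import Data.Vec as Vec
open import Function using (_∘_)
open import Level using (0ℓ)
open import Relation.Binary.PropositionalEquality hiding ([_])
open import Relation.Nullary using (Dec; contradiction; yes; no; ¬_)
open import Relation.Nullary.Decidable using (map′; _×-dec_; _→-dec_; ¬?; from-yes)

-- The field 𝔽₈, sums over it, and triples.

module Octal where

  open GF8 public renaming (Carrier to F₈)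

  F₈-commutativeRing : CommutativeRing 0ℓ 0ℓ
  F₈-commutativeRing = record { isCommutativeRing = isCommutativeRing }

  open CommutativeRing F₈-commutativeRing public using ()
    renaming ( +-assoc to ⊕-assoc; +-comm to ⊕-comm; +-identityˡ to ⊕-identityˡ; +-identityʳ to ⊕-identityʳ
             ; -‿inverseʳ to ⊕-self; *-assoc to ⊗-assoc; *-comm to ⊗-comm; *-identityˡ to ⊗-identityˡ
             ; *-identityʳ to ⊗-identityʳ; distribˡ to ⊗-distribˡ; distribʳ to ⊗-distribʳ; zeroˡ to ⊗-zeroˡ; zeroʳ to ⊗-zeroʳ)

  ∀𝔹? : {P : Bool → Set} → (∀ b → Dec (P b)) → Dec (∀ b → P b)
  ∀𝔹? P? = map′ (λ { (t , f) true → t ; (t , f) false → f }) (λ p → p true , p false) (P? true ×-dec P? false)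

  ∀₈? : {P : F₈ → Set} → (∀ x → Dec (P x)) → Dec (∀ x → P x)
  ∀₈? P? = map′ (λ p (a , b , c) → p a b c) (λ p a b c → p (a , b , c))
    (∀𝔹? λ a → ∀𝔹? λ b → ∀𝔹? λ c → P? (a , b , c))

  zero? : F₈ → Bool
  zero? (false , false , false) = true
  zero? _                       = false

  zero?-𝟘 : ∀ {x} → x ≡ 𝟘 → zero? x ≡ true
  zero?-𝟘 refl = refl

  zero?-sound : ∀ x → zero? x ≡ true → x ≡ 𝟘
  zero?-sound (false , false , false) refl = refl

  zero?-≢ : ∀ {x} → x ≢ 𝟘 → zero? x ≡ false
  zero?-≢ {x} x≢𝟘 with zero? x in eq
  ... | true  = contradiction (zero?-sound x eq) x≢𝟘
  ... | false = refl

  x⊕y≡𝟘⇒x≡y : ∀ x y → x ⊕ y ≡ 𝟘 → x ≡ y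
  x⊕y≡𝟘⇒x≡y x y eq = begin
    x            ≡⟨ ⊕-identityʳ x ⟨
    x ⊕ 𝟘        ≡⟨ cong (x ⊕_) (⊕-self y) ⟨
    x ⊕ (y ⊕ y)  ≡⟨ ⊕-assoc x y y ⟨
    x ⊕ y ⊕ y    ≡⟨ cong (_⊕ y) eq ⟩
    𝟘 ⊕ y        ≡⟨ ⊕-identityˡ y ⟩
    y            ∎
    where open ≡-Reasoning

  ⊗-nonzero : ∀ x y → x ≢ 𝟘 → x ⊗ y ≡ 𝟘 → y ≡ 𝟘
  ⊗-nonzero = from-yes (∀₈? λ x → ∀₈? λ y → ¬? (x ≟ 𝟘) →-dec ((x ⊗ y) ≟ 𝟘) →-dec (y ≟ 𝟘))

  module ℕΣ = SemiringSum ℕₚ.+-*-semiring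
  module F₈Σ = SemiringSum (CommutativeRing.semiring F₈-commutativeRing)
  open ℕΣ public using (sum; sum-cong-≗; ∑-comm; ∑-distrib-+; *-distribˡ-sum; *-distribʳ-sum)

  [_] : Bool → ℕ
  [ b ] = if b then 1 else 0

  sum-mono : ∀ {n} {s t : Fin n → ℕ} → (∀ i → s i ≤ t i) → sum s ≤ sum t
  sum-mono {zero}  s≤t = z≤n
  sum-mono {suc n} s≤t = ℕₚ.+-mono-≤ (s≤t zero) (sum-mono (s≤t ∘ suc))

  sum-const : ∀ n c → sum {n} (λ _ → c) ≡ n * c
  sum-const zero    c = refl
  sum-const (suc n) c = cong (c +_) (sum-const n c)

  term≤sum : ∀ {n} (t : Fin n → ℕ) i → t i ≤ sum t
  term≤sum t zero    = ℕₚ.m≤m+n _ _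
  term≤sum t (suc i) = ℕₚ.m≤n⇒m≤o+n (t zero) (term≤sum (t ∘ suc) i)

  sum≢0⇒∃ : ∀ {n} (t : Fin n → Bool) → 1 ≤ sum (λ i → [ t i ]) → ∃[ i ] t i ≡ true
  sum≢0⇒∃ {suc n} t le with t zero in eq
  ... | true  = zero , eq
  ... | false = let i , p = sum≢0⇒∃ (t ∘ suc) le in suc i , p

  element : Fin 8 → F₈
  element = Vec.lookup
    ( (false , false , false) Vec.∷ (true , false , false) Vec.∷ (false , true , false) Vec.∷ (true , true , false)
    Vec.∷ (false , false , true) Vec.∷ (true , false , true) Vec.∷ (false , true , true) Vec.∷
        (true , true , true) Vec.∷ Vec.[])

  index : ∀ x → ∃[ i ] element i ≡ x
  index (false , false , false) = zero , refl
  index (true  , false , false) = suc zero , refl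
  index (false , true  , false) = suc (suc zero) , refl
  index (true  , true  , false) = suc (suc (suc zero)) , refl
  index (false , false , true ) = suc (suc (suc (suc zero))) , refl
  index (true  , false , true ) = suc (suc (suc (suc (suc zero)))) , refl
  index (false , true  , true ) = suc (suc (suc (suc (suc (suc zero))))) , refl
  index (true  , true  , true ) = suc (suc (suc (suc (suc (suc (suc zero)))))) , refl

  opaque

    -- Opaque, so that sums stay folded in statements; lemmas checked by running through all field
    -- elements unfold it.
    ∑₈ : (F₈ → ℕ) → ℕ
    ∑₈ G = sum (G ∘ element)

    ∑₈-cong : ∀ {G H} → (∀ x → G x ≡ H x) → ∑₈ G ≡ ∑₈ H
    ∑₈-cong G≗H = sum-cong-≗ (G≗H ∘ element)

    ∑₈-mono : ∀ {G H} → (∀ x → G x ≤ H x) → ∑₈ G ≤ ∑₈ H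
    ∑₈-mono G≤H = sum-mono (G≤H ∘ element)

    ∑₈-+ : ∀ G H → ∑₈ (λ x → G x + H x) ≡ ∑₈ G + ∑₈ H
    ∑₈-+ G H = ∑-distrib-+ (G ∘ element) (H ∘ element)

    ∑₈-* : ∀ c G → ∑₈ (λ x → c * G x) ≡ c * ∑₈ G
    ∑₈-* c G = sym (*-distribˡ-sum c (G ∘ element))

    ∑₈-swap : ∀ (G : F₈ → F₈ → ℕ) → ∑₈ (λ x → ∑₈ (G x)) ≡ ∑₈ (λ y → ∑₈ (λ x → G x y))
    ∑₈-swap G = ∑-comm (λ i j → G (element i) (element j))

    term≤∑₈ : ∀ G x → G x ≤ ∑₈ G
    term≤∑₈ G x = subst (λ y → G y ≤ ∑₈ G) (proj₂ (index x)) (term≤sum (G ∘ element) (proj₁ (index x)))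

    ∑₈-*ʳ : ∀ c G → ∑₈ G * c ≡ ∑₈ (λ x → G x * c)
    ∑₈-*ʳ c G = *-distribʳ-sum c (G ∘ element)

    ∑₈-const : ∀ c → ∑₈ (λ _ → c) ≡ 8 * c
    ∑₈-const c = sum-const 8 c

    ∑₈-∑ : ∀ {n} (G : F₈ → Fin n → ℕ) → ∑₈ (λ x → sum (G x)) ≡ sum (λ i → ∑₈ (λ x → G x i))
    ∑₈-∑ G = ∑-comm (λ i j → G (element i) j)

    ∑₈≢0⇒∃ : ∀ (p : F₈ → Bool) → 1 ≤ ∑₈ (λ x → [ p x ]) → ∃[ x ] p x ≡ true
    ∑₈≢0⇒∃ p le = let i , eq = sum≢0⇒∃ (p ∘ element) le in element i , eq

    ∑₈-unique : ∀ d → ∑₈ (λ c → [ zero? (c ⊕ d) ]) ≡ 1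
    ∑₈-unique = from-yes (∀₈? λ d → ∑₈ (λ c → [ zero? (c ⊕ d) ]) ℕ.≟ 1)

  ∑₈-δ : ∀ d (G : F₈ → ℕ) → ∑₈ (λ c → [ zero? (c ⊕ d) ] * G c) ≡ G d
  ∑₈-δ d G = begin
    ∑₈ (λ c → [ zero? (c ⊕ d) ] * G c)  ≡⟨ ∑₈-cong pointwise ⟩
    ∑₈ (λ c → [ zero? (c ⊕ d) ] * G d)  ≡⟨ ∑₈-*ʳ (G d) (λ c → [ zero? (c ⊕ d) ]) ⟨
    ∑₈ (λ c → [ zero? (c ⊕ d) ]) * G d  ≡⟨ cong (_* G d) (∑₈-unique d) ⟩
    1 * G d                             ≡⟨ ℕₚ.*-identityˡ (G d) ⟩
    G d                                 ∎
    where
    open ≡-Reasoning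
    pointwise : ∀ c → [ zero? (c ⊕ d) ] * G c ≡ [ zero? (c ⊕ d) ] * G d
    pointwise c with zero? (c ⊕ d) in eq
    ... | true  = cong (λ x → 1 * G x) (x⊕y≡𝟘⇒x≡y c d (zero?-sound _ eq))
    ... | false = refl

  -- Bijectivity is stated as every fibre having one element: this is decidable by evaluation, and
  -- it is the form that appears once the sums are exchanged.
  ∑₈-reindex : ∀ (π : F₈ → F₈) → (∀ d → ∑₈ (λ c → [ zero? (d ⊕ π c) ]) ≡ 1) → ∀ G → ∑₈ (G ∘ π) ≡ ∑₈ G
  ∑₈-reindex π bij G = begin
    ∑₈ (λ c → G (π c))                                         ≡⟨ ∑₈-cong (λ c → ∑₈-δ (π c) G) ⟨
    ∑₈ (λ c → ∑₈ (λ d → [ zero? (d ⊕ π c) ] * G d))            ≡⟨ ∑₈-swap _ ⟩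
    ∑₈ (λ d → ∑₈ (λ c → [ zero? (d ⊕ π c) ] * G d))            ≡⟨ ∑₈-cong (λ d → ∑₈-*ʳ (G d) (λ c → [ zero? (d ⊕ π c) ])) ⟨
    ∑₈ (λ d → ∑₈ (λ c → [ zero? (d ⊕ π c) ]) * G d)            ≡⟨ ∑₈-cong
        (λ d → trans (cong (_* G d) (bij d)) (ℕₚ.*-identityˡ (G d))) ⟩
    ∑₈ G                                                       ∎
    where open ≡-Reasoning

  -- Functionals on F₈³ and points of F₈³ are both given by coordinates.
  Triple : Set
  Triple = F₈ × F₈ × F₈

  𝟎 : Triple
  𝟎 = 𝟘 , 𝟘 , 𝟘

  infix 8 _∙_

  opaque

    _∙_ : Triple → Triple → F₈
    (a , b , c) ∙ (x , y , z) = a ⊗ x ⊕ b ⊗ y ⊕ c ⊗ z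

  infixl 6 _⊞_
  _⊞_ : Triple → Triple → Triple
  (a , b , c) ⊞ (x , y , z) = a ⊕ x , b ⊕ y , c ⊕ z

  infixl 7 _⊠_
  _⊠_ : F₈ → Triple → Triple
  t ⊠ (x , y , z) = t ⊗ x , t ⊗ y , t ⊗ z

  module S = RingSolver (CommutativeRing.commutativeSemiring F₈-commutativeRing)

  opaque
    unfolding _∙_

    ⊞-∙ : ∀ f g x → (f ⊞ g) ∙ x ≡ f ∙ x ⊕ g ∙ x
    ⊞-∙ (a , b , c) (a′ , b′ , c′) (x , y , z) = S.solve 9 (λ a b c a′ b′ c′ x y z →
      (a S.:+ a′) S.:* x S.:+ (b S.:+ b′) S.:* y S.:+ (c S.:+ c′) S.:* z
      S.:= a S.:* x S.:+ b S.:* y S.:+ c S.:* z S.:+ (a′ S.:* x S.:+ b′ S.:* y S.:+ c′ S.:* z)) refl a b c a′ b′ c′ x y z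

    ⊠-∙ : ∀ t f x → (t ⊠ f) ∙ x ≡ t ⊗ f ∙ x
    ⊠-∙ t (a , b , c) (x , y , z) = S.solve 7 (λ t a b c x y z →
      (t S.:* a) S.:* x S.:+ (t S.:* b) S.:* y S.:+ (t S.:* c) S.:* z
      S.:= t S.:* (a S.:* x S.:+ b S.:* y S.:+ c S.:* z)) refl t a b c x y z

    ∙-comm : ∀ f x → f ∙ x ≡ x ∙ f
    ∙-comm (a , b , c) (x , y , z) = cong₂ _⊕_ (cong₂ _⊕_ (⊗-comm a x) (⊗-comm b y)) (⊗-comm c z)

    𝟎-∙ : ∀ x → 𝟎 ∙ x ≡ 𝟘
    𝟎-∙ (x , y , z) = cong₂ _⊕_ (cong₂ _⊕_ (⊗-zeroˡ x) (⊗-zeroˡ y)) (⊗-zeroˡ z)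

  _≟₃_ : (x y : Triple) → Dec (x ≡ y)
  (a , b , c) ≟₃ (x , y , z) = map′ (λ { (refl , refl , refl) → refl }) (λ { refl → refl , refl , refl })
      ((a ≟ x) ×-dec (b ≟ y) ×-dec (c ≟ z))

-- Pencils of lines and moments of point families in PG(2,8).

module Arcs where

  open Octal

  opaque

    -- One functional for each of the 73 lines of PG(2,8).
    ∑ₗ : (Triple → ℕ) → ℕ
    ∑ₗ F = ∑₈ (λ a → ∑₈ (λ b → F (𝟙 , a , b))) + ∑₈ (λ a → F (𝟘 , 𝟙 , a)) + F (𝟘 , 𝟘 , 𝟙)

    ∑ₗ-cong : ∀ {F G} → (∀ f → F f ≡ G f) → ∑ₗ F ≡ ∑ₗ G
    ∑ₗ-cong F≗G = cong₂ _+_ (cong₂ _+_ (∑₈-cong λ a → ∑₈-cong λ b → F≗G _) (∑₈-cong λ a → F≗G _)) (F≗G _)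

    ∑ₗ-mono : ∀ {F G} → (∀ f → f ≢ 𝟎 → F f ≤ G f) → ∑ₗ F ≤ ∑ₗ G
    ∑ₗ-mono F≤G = ℕₚ.+-mono-≤ (ℕₚ.+-mono-≤ (∑₈-mono λ a → ∑₈-mono λ b → F≤G _ (λ ())) (∑₈-mono λ a → F≤G _ (λ ())))
        (F≤G _ (λ ()))

    ∑ₗ-+ : ∀ F G → ∑ₗ (λ f → F f + G f) ≡ ∑ₗ F + ∑ₗ G
    ∑ₗ-+ F G rewrite ∑₈-cong (λ a → ∑₈-+ (λ b → F (𝟙 , a , b)) (λ b → G (𝟙 , a , b)))
      | ∑₈-+ (λ a → ∑₈ (λ b → F (𝟙 , a , b))) (λ a → ∑₈ (λ b → G (𝟙 , a , b)))
      | ∑₈-+ (λ a → F (𝟘 , 𝟙 , a)) (λ a → G (𝟘 , 𝟙 , a)) =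
      solve 6 (λ a b c d e f → a :+ b :+ (c :+ d) :+ (e :+ f) := a :+ c :+ e :+ (b :+ d :+ f)) refl
        (∑₈ (λ a → ∑₈ (λ b → F (𝟙 , a , b)))) (∑₈ (λ a → ∑₈ (λ b → G (𝟙 , a , b))))
        (∑₈ (λ a → F (𝟘 , 𝟙 , a))) (∑₈ (λ a → G (𝟘 , 𝟙 , a))) (F (𝟘 , 𝟘 , 𝟙)) (G (𝟘 , 𝟘 , 𝟙))
      where open +-*-Solver

    ∑ₗ-* : ∀ c F → ∑ₗ (λ f → c * F f) ≡ c * ∑ₗ F
    ∑ₗ-* c F rewrite ∑₈-cong (λ a → ∑₈-* c (λ b → F (𝟙 , a , b))) | ∑₈-* c (λ a → ∑₈ (λ b → F (𝟙 , a , b)))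
      | ∑₈-* c (λ a → F (𝟘 , 𝟙 , a)) = sym
          (trans (ℕₚ.*-distribˡ-+ c _ (F (𝟘 , 𝟘 , 𝟙))) (cong (_+ c * F (𝟘 , 𝟘 , 𝟙)) (ℕₚ.*-distribˡ-+ c _ _)))

    ∑ₗ-const : ∀ c → ∑ₗ (λ _ → c) ≡ 73 * c
    ∑ₗ-const c rewrite ∑₈-cong (λ _ → ∑₈-const c) | ∑₈-const (8 * c) | ∑₈-const c =
      solve 1 (λ c → con 8 :* (con 8 :* c) :+ con 8 :* c :+ c := con 73 :* c) refl c
      where open +-*-Solver

    ∑ₗ-sum : ∀ {n} (F : Triple → Fin n → ℕ) → ∑ₗ (λ f → sum (F f)) ≡ sum (λ i → ∑ₗ (λ f → F f i))
    ∑ₗ-sum {n} F rewrite ∑₈-cong (λ a → ∑₈-∑ (λ b → F (𝟙 , a , b))) | ∑₈-∑ (λ a i → ∑₈ (λ b → F (𝟙 , a , b) i))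
      | ∑₈-∑ (λ a → F (𝟘 , 𝟙 , a)) = sym (trans (∑-distrib-+ {n} _ _) (cong (_+ sum (F (𝟘 , 𝟘 , 𝟙))) (∑-distrib-+ {n} _ _)))

  -- The nine lines through `x` are the eight `g ⊞ a ⊠ h` together with `h`. As `F` in `through` is
  -- an arbitrary function of triples, these must be the very representatives summed by `∑ₗ`, not
  -- multiples of them.
  record Pencil (x : Triple) : Set where
    field
      g h     : Triple
      h≢𝟎     : h ≢ 𝟎
      g+ah≢𝟎  : ∀ a → g ⊞ a ⊠ h ≢ 𝟎
      g∙x     : g ∙ x ≡ 𝟘
      h∙x     : h ∙ x ≡ 𝟘
      through : ∀ (F : Triple → ℕ) → ∑ₗ (λ f → [ zero? (f ∙ x) ] * F f) ≡ ∑₈ (λ a → F (g ⊞ a ⊠ h)) + F h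

    member : F₈ → Triple
    member a = g ⊞ a ⊠ h

  private
    ∑₈-0 : ∑₈ (λ _ → 0) ≡ 0
    ∑₈-0 = ∑₈-const 0

    𝟙⊕a⊗𝟘 : ∀ a → 𝟙 ⊕ a ⊗ 𝟘 ≡ 𝟙
    𝟙⊕a⊗𝟘 a = cong (𝟙 ⊕_) (⊗-zeroʳ a)

  opaque
    unfolding ∑ₗ _∙_

    -- Solves `f ∙ x ≡ 𝟘` for the coefficient of `f` at the last nonzero coordinate of `x`; the
    -- other two coefficients run over normalised pairs.
    pencil : ∀ x → x ≢ 𝟎 → Pencil x
    pencil (x , y , z) x≢𝟎 with z ≟ 𝟘 | y ≟ 𝟘
    ... | no z≢𝟘 | _ = record
      { g = 𝟙 , 𝟘 , x ⊗ inv z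
      ; h = 𝟘 , 𝟙 , y ⊗ inv z
      ; h≢𝟎 = λ ()
      ; g+ah≢𝟎 = λ a eq → contradiction (trans (sym (𝟙⊕a⊗𝟘 a)) (cong proj₁ eq)) (λ ())
      ; g∙x = g∙x x y z z≢𝟘
      ; h∙x = h∙x x y z z≢𝟘
      ; through = λ F → trans (cong₂ _+_ (cong₂ _+_
          (∑₈-cong λ a → trans (∑₈-cong λ b → cong (λ t → [ t ] * F (𝟙 , a , b)) (isolate (𝟙 ⊗ x ⊕ a ⊗ y) b z z≢𝟘))
            (trans (∑₈-δ ((𝟙 ⊗ x ⊕ a ⊗ y) ⊗ inv z) (λ b → F (𝟙 , a , b)))
              (cong F (cong₂ _,_ (sym (𝟙⊕a⊗𝟘 a)) (cong₂ _,_ (sym (𝟘⊕a⊗𝟙 a)) (coordinate x y a (inv z)))))))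
          (trans (∑₈-cong λ a → cong (λ t → [ t ] * F (𝟘 , 𝟙 , a)) (isolate (𝟘 ⊗ x ⊕ 𝟙 ⊗ y) a z z≢𝟘))
            (trans (∑₈-δ ((𝟘 ⊗ x ⊕ 𝟙 ⊗ y) ⊗ inv z) (λ a → F (𝟘 , 𝟙 , a))) (cong (λ t → F (𝟘 , 𝟙 , t ⊗ inv z)) (first x y)))))
          (cong (λ t → [ t ] * F (𝟘 , 𝟘 , 𝟙)) (zero?-≢ (λ eq → z≢𝟘 (trans (sym (third x y z)) eq)))))
          (ℕₚ.+-identityʳ _)
      }
      where
      𝟘⊕a⊗𝟙 : ∀ a → 𝟘 ⊕ a ⊗ 𝟙 ≡ a
      𝟘⊕a⊗𝟙 a = ⊗-identityʳ a
      isolate : ∀ u b z → z ≢ 𝟘 → zero? (u ⊕ b ⊗ z) ≡ zero? (b ⊕ u ⊗ inv z)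
      isolate = from-yes (∀₈? λ u → ∀₈? λ b → ∀₈? λ z → ¬? (z ≟ 𝟘) →-dec (zero? (u ⊕ b ⊗ z) Boolₚ.≟ zero? (b ⊕ u ⊗ inv z)))
      coordinate : ∀ x y a i → (𝟙 ⊗ x ⊕ a ⊗ y) ⊗ i ≡ x ⊗ i ⊕ a ⊗ (y ⊗ i)
      coordinate x y a i = trans (⊗-distribʳ i (𝟙 ⊗ x) (a ⊗ y)) (cong₂ _⊕_ (cong (_⊗ i) (⊗-identityˡ x)) (⊗-assoc a y i))
      first : ∀ x y → 𝟘 ⊗ x ⊕ 𝟙 ⊗ y ≡ y
      first = from-yes (∀₈? λ x → ∀₈? λ y → (𝟘 ⊗ x ⊕ 𝟙 ⊗ y) ≟ y)
      third : ∀ x y z → 𝟘 ⊗ x ⊕ 𝟘 ⊗ y ⊕ 𝟙 ⊗ z ≡ z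
      third = from-yes (∀₈? λ x → ∀₈? λ y → ∀₈? λ z → (𝟘 ⊗ x ⊕ 𝟘 ⊗ y ⊕ 𝟙 ⊗ z) ≟ z)
      g∙x : ∀ x y z → z ≢ 𝟘 → 𝟙 ⊗ x ⊕ 𝟘 ⊗ y ⊕ x ⊗ inv z ⊗ z ≡ 𝟘
      g∙x = from-yes (∀₈? λ x → ∀₈? λ y → ∀₈? λ z → ¬? (z ≟ 𝟘) →-dec (𝟙 ⊗ x ⊕ 𝟘 ⊗ y ⊕ x ⊗ inv z ⊗ z) ≟ 𝟘)
      h∙x : ∀ x y z → z ≢ 𝟘 → 𝟘 ⊗ x ⊕ 𝟙 ⊗ y ⊕ y ⊗ inv z ⊗ z ≡ 𝟘
      h∙x = from-yes (∀₈? λ x → ∀₈? λ y → ∀₈? λ z → ¬? (z ≟ 𝟘) →-dec (𝟘 ⊗ x ⊕ 𝟙 ⊗ y ⊕ y ⊗ inv z ⊗ z) ≟ 𝟘)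
    ... | yes refl | no y≢𝟘 = record
      { g = 𝟙 , x ⊗ inv y , 𝟘
      ; h = 𝟘 , 𝟘 , 𝟙
      ; h≢𝟎 = λ ()
      ; g+ah≢𝟎 = λ a eq → contradiction (trans (sym (𝟙⊕a⊗𝟘 a)) (cong proj₁ eq)) (λ ())
      ; g∙x = g∙x x y y≢𝟘
      ; h∙x = h∙x x y
      ; through = λ F → cong₂ _+_ (trans (cong₂ _+_
          (trans (∑₈-swap _) (∑₈-cong λ b → trans (∑₈-cong λ a → cong (λ t → [ t ] * F (𝟙 , a , b)) (isolate x a b y y≢𝟘))
            (trans (∑₈-δ (x ⊗ inv y) (λ a → F (𝟙 , a , b)))
              (cong F (cong₂ _,_ (sym (𝟙⊕a⊗𝟘 b)) (cong₂ _,_ (sym (t⊕a⊗𝟘 (x ⊗ inv y) b)) (sym (⊗-identityʳ b))))))))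
          (trans (∑₈-cong λ a → cong (λ t → [ t ] * F (𝟘 , 𝟙 , a))
              (zero?-≢ (λ eq → y≢𝟘 (trans (sym (second x y a)) eq)))) ∑₈-0))
          (ℕₚ.+-identityʳ _))
          (trans (cong (λ t → [ t ] * F (𝟘 , 𝟘 , 𝟙)) (zero?-𝟘 (h∙x x y))) (ℕₚ.*-identityˡ _))
      }
      where
      t⊕a⊗𝟘 : ∀ t a → t ⊕ a ⊗ 𝟘 ≡ t
      t⊕a⊗𝟘 t a = trans (cong (t ⊕_) (⊗-zeroʳ a)) (⊕-identityʳ t)
      isolate : ∀ x a b y → y ≢ 𝟘 → zero? (𝟙 ⊗ x ⊕ a ⊗ y ⊕ b ⊗ 𝟘) ≡ zero? (a ⊕ x ⊗ inv y)
      isolate x a b y y≢𝟘 = trans (cong zero? (t⊕a⊗𝟘 (𝟙 ⊗ x ⊕ a ⊗ y) b)) (isolate′ x a y y≢𝟘)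
        where
        isolate′ : ∀ x a y → y ≢ 𝟘 → zero? (𝟙 ⊗ x ⊕ a ⊗ y) ≡ zero? (a ⊕ x ⊗ inv y)
        isolate′ = from-yes (∀₈? λ x → ∀₈? λ a → ∀₈? λ y → ¬? (y ≟ 𝟘) →-dec
            (zero? (𝟙 ⊗ x ⊕ a ⊗ y) Boolₚ.≟ zero? (a ⊕ x ⊗ inv y)))
      second : ∀ x y a → 𝟘 ⊗ x ⊕ 𝟙 ⊗ y ⊕ a ⊗ 𝟘 ≡ y
      second = from-yes (∀₈? λ x → ∀₈? λ y → ∀₈? λ a → (𝟘 ⊗ x ⊕ 𝟙 ⊗ y ⊕ a ⊗ 𝟘) ≟ y)
      g∙x : ∀ x y → y ≢ 𝟘 → 𝟙 ⊗ x ⊕ x ⊗ inv y ⊗ y ⊕ 𝟘 ≡ 𝟘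
      g∙x = from-yes (∀₈? λ x → ∀₈? λ y → ¬? (y ≟ 𝟘) →-dec (𝟙 ⊗ x ⊕ x ⊗ inv y ⊗ y ⊕ 𝟘) ≟ 𝟘)
      h∙x : ∀ x y → 𝟘 ⊗ x ⊕ 𝟘 ⊗ y ⊕ 𝟙 ⊗ 𝟘 ≡ 𝟘
      h∙x = from-yes (∀₈? λ x → ∀₈? λ y → (𝟘 ⊗ x ⊕ 𝟘 ⊗ y ⊕ 𝟙 ⊗ 𝟘) ≟ 𝟘)
    ... | yes refl | yes refl = record
      { g = 𝟘 , 𝟙 , 𝟘
      ; h = 𝟘 , 𝟘 , 𝟙
      ; h≢𝟎 = λ ()
      ; g+ah≢𝟎 = λ a eq → contradiction (trans (sym (𝟙⊕a⊗𝟘 a)) (cong (proj₁ ∘ proj₂) eq)) (λ ())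
      ; g∙x = 𝟘⊗ x
      ; h∙x = 𝟘⊗ x
      ; through = λ F → cong₂ _+_ (cong₂ _+_
          (trans (∑₈-cong λ a → trans (∑₈-cong λ b → cong (λ t → [ t ] * F (𝟙 , a , b))
              (zero?-≢ (λ eq → x≢𝟘 (trans (sym (first x a b)) eq)))) ∑₈-0) ∑₈-0)
          (∑₈-cong λ a → trans (cong (λ t → [ t ] * F (𝟘 , 𝟙 , a)) (zero?-𝟘 (second x a)))
            (trans (ℕₚ.*-identityˡ _) (cong F
                (cong₂ _,_ (sym (⊗-zeroʳ a)) (cong₂ _,_ (sym (𝟙⊕a⊗𝟘 a)) (sym (⊗-identityʳ a))))))))
          (trans (cong (λ t → [ t ] * F (𝟘 , 𝟘 , 𝟙)) (zero?-𝟘 (𝟘⊗ x))) (ℕₚ.*-identityˡ _))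
      }
      where
      x≢𝟘 : x ≢ 𝟘
      x≢𝟘 refl = x≢𝟎 refl
      𝟘⊗ : ∀ x → 𝟘 ⊗ x ⊕ 𝟘 ⊕ 𝟘 ≡ 𝟘
      𝟘⊗ = from-yes (∀₈? λ x → (𝟘 ⊗ x ⊕ 𝟘 ⊕ 𝟘) ≟ 𝟘)
      first : ∀ x a b → 𝟙 ⊗ x ⊕ a ⊗ 𝟘 ⊕ b ⊗ 𝟘 ≡ x
      first = from-yes (∀₈? λ x → ∀₈? λ a → ∀₈? λ b → (𝟙 ⊗ x ⊕ a ⊗ 𝟘 ⊕ b ⊗ 𝟘) ≟ x)
      second : ∀ x a → 𝟘 ⊗ x ⊕ 𝟙 ⊗ 𝟘 ⊕ a ⊗ 𝟘 ≡ 𝟘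
      second = from-yes (∀₈? λ x → ∀₈? λ a → (𝟘 ⊗ x ⊕ 𝟙 ⊗ 𝟘 ⊕ a ⊗ 𝟘) ≟ 𝟘)

  opaque
    unfolding ∑₈

    -- The contribution of one point to a pencil, with `x` and `y` the values of `g` and `h` there:
    -- nine if both vanish, otherwise one.
    local-pencil : ∀ x y → ∑₈ (λ a → [ zero? (x ⊕ a ⊗ y) ]) + [ zero? y ] ≡ 1 + 8 * [ zero? x ∧ zero? y ]
    local-pencil = from-yes (∀₈? λ x → ∀₈? λ y → (∑₈ (λ a → [ zero? (x ⊕ a ⊗ y) ]) + [ zero? y ]) ℕ.≟
        (1 + 8 * [ zero? x ∧ zero? y ]))

  module Points {n} (p : Fin n → Triple) where

    opaque

      -- The numbers of the given points on one line and on two lines.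
      k : Triple → ℕ
      k f = sum (λ i → [ zero? (f ∙ p i) ])

      meet : Triple → Triple → ℕ
      meet g h = sum (λ i → [ zero? (g ∙ p i) ∧ zero? (h ∙ p i) ])

      -- The lines of a pencil cover the plane and share only the common point, which is counted
      -- eight extra times.
      pencil-sum : ∀ g h → ∑₈ (λ a → k (g ⊞ a ⊠ h)) + k h ≡ n + 8 * meet g h
      pencil-sum g h = begin
        ∑₈ (λ a → k (g ⊞ a ⊠ h)) + k h
          ≡⟨ cong (_+ k h) (∑₈-∑ (λ a i → [ zero? ((g ⊞ a ⊠ h) ∙ p i) ])) ⟩
        sum (λ i → ∑₈ (λ a → [ zero? ((g ⊞ a ⊠ h) ∙ p i) ])) + k h
          ≡⟨ ∑-distrib-+ {n} _ _ ⟨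
        sum (λ i → ∑₈ (λ a → [ zero? ((g ⊞ a ⊠ h) ∙ p i) ]) + [ zero? (h ∙ p i) ])
          ≡⟨ sum-cong-≗ {n} (λ i → trans
               (cong (_+ [ zero? (h ∙ p i) ]) (∑₈-cong λ a → cong (λ t → [ zero? t ])
                  (trans (⊞-∙ g (a ⊠ h) (p i)) (cong (g ∙ p i ⊕_) (⊠-∙ a h (p i))))))
               (local-pencil (g ∙ p i) (h ∙ p i))) ⟩
        sum (λ i → 1 + 8 * [ zero? (g ∙ p i) ∧ zero? (h ∙ p i) ])
          ≡⟨ ∑-distrib-+ {n} _ _ ⟩
        sum {n} (λ i → 1) + sum (λ i → 8 * [ zero? (g ∙ p i) ∧ zero? (h ∙ p i) ])
          ≡⟨ cong₂ _+_ (trans (sum-const n 1) (ℕₚ.*-identityʳ n)) (sym (*-distribˡ-sum {n} 8 _)) ⟩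
        n + 8 * meet g h ∎
        where
        open ≡-Reasoning

      -- Double counting of incident pairs of a point and a line; the weights 1 and `k` produce the
      -- first two moments.
      weighted : ∀ (F : Triple → ℕ) → sum (λ i → ∑ₗ (λ f → [ zero? (f ∙ p i) ] * F f)) ≡ ∑ₗ (λ f → k f * F f)
      weighted F = trans (sym (∑ₗ-sum (λ f i → [ zero? (f ∙ p i) ] * F f)))
        (∑ₗ-cong (λ f → sym (*-distribʳ-sum {n} (F f) (λ i → [ zero? (f ∙ p i) ]))))

      1≤meet : ∀ g h i → g ∙ p i ≡ 𝟘 → h ∙ p i ≡ 𝟘 → 1 ≤ meet g h
      1≤meet g h i gp≡𝟘 hp≡𝟘 = subst (_≤ meet g h) (cong₂ (λ a b → [ a ∧ b ]) (zero?-𝟘 gp≡𝟘) (zero?-𝟘 hp≡𝟘))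
        (term≤sum (λ i → [ zero? (g ∙ p i) ∧ zero? (h ∙ p i) ]) i)

      meet-cong : ∀ g g′ h → (∀ y → zero? (g ∙ y) ≡ zero? (g′ ∙ y)) → meet g h ≡ meet g′ h
      meet-cong g g′ h eq = sum-cong-≗ {n} (λ i → cong (λ s → [ s ∧ zero? (h ∙ p i) ]) (eq (p i)))

    module Bounded (s : ℕ) (k≤s : ∀ f → f ≢ 𝟎 → k f ≤ s) where

      pencil≤ : ∀ g h → h ≢ 𝟎 → (∀ a → g ⊞ a ⊠ h ≢ 𝟎) → n + 8 * meet g h ≤ 9 * s
      pencil≤ g h h≢𝟎 g+ah≢𝟎 = subst₂ _≤_ (pencil-sum g h) (trans (cong (_+ s) (∑₈-const s)) (ℕₚ.+-comm (8 * s) s))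
        (ℕₚ.+-mono-≤ (∑₈-mono λ a → k≤s _ (g+ah≢𝟎 a)) (k≤s h h≢𝟎))

      -- The zero vector lies on all 73 lines instead of 9, an excess of 64 for which the total
      -- `73 * s` leaves no room.
      nonzero : 73 * s < n * 9 + 64 → ∀ i → p i ≢ 𝟎
      nonzero 73s<9n+64 i pi≡𝟎 = ℕₚ.<⇒≱ 73s<9n+64 (begin
        n * 9 + 64               ≤⟨ ℕₚ.+-monoʳ-≤ (n * 9) (subst (λ x → 64 ≤ extra x) (sym pi≡𝟎) ℕₚ.≤-refl) ⟩
        n * 9 + extra (p i)      ≤⟨ ℕₚ.+-mono-≤ (ℕₚ.≤-reflexive (sym (sum-const n 9))) (term≤sum (extra ∘ p) i) ⟩
        sum {n} (λ _ → 9) + sum (extra ∘ p)  ≡⟨ ∑-distrib-+ {n} _ _ ⟨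
        sum (λ i → 9 + extra (p i))          ≡⟨ sum-cong-≗ {n} (λ i → weight (p i) (p i ≟₃ 𝟎)) ⟨
        sum (λ i → ∑ₗ (λ f → [ zero? (f ∙ p i) ] * 1)) ≡⟨ weighted (λ _ → 1) ⟩
        ∑ₗ (λ f → k f * 1)       ≤⟨ ∑ₗ-mono (λ f f≢𝟎 → subst (_≤ s) (sym (ℕₚ.*-identityʳ (k f))) (k≤s f f≢𝟎)) ⟩
        ∑ₗ (λ _ → s)             ≡⟨ ∑ₗ-const s ⟩
        73 * s                   ∎)
        where
        open ℕₚ.≤-Reasoning
        extraDec : ∀ {x} → Dec (x ≡ 𝟎) → ℕ
        extraDec (yes _) = 64
        extraDec (no  _) = 0
        extra : Triple → ℕ
        extra x = extraDec (x ≟₃ 𝟎)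
        weight : ∀ x (d : Dec (x ≡ 𝟎)) → ∑ₗ (λ f → [ zero? (f ∙ x) ] * 1) ≡ 9 + extraDec d
        weight x (no x≢𝟎)   = trans (Pencil.through (pencil x x≢𝟎) (λ _ → 1)) (cong (_+ 1) (∑₈-const 1))
        weight x (yes refl) = trans (∑ₗ-cong (λ f → cong (λ t → [ t ] * 1) (zero?-𝟘 (trans (∙-comm f 𝟎) (𝟎-∙ f))))) (∑ₗ-const 1)

    module Simple (p≢𝟎 : ∀ i → p i ≢ 𝟎)
                  (meet≤1 : ∀ g h → h ≢ 𝟎 → (∀ a → g ⊞ a ⊠ h ≢ 𝟎) → meet g h ≤ 1) where

      pencilAt : ∀ i → Pencil (p i)
      pencilAt i = pencil (p i) (p≢𝟎 i)

      pencilAt-sum : ∀ i → ∑₈ (λ a → k (Pencil.member (pencilAt i) a)) + k (Pencil.h (pencilAt i)) ≡ n + 8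
      pencilAt-sum i = trans (pencil-sum g h) (cong (λ t → n + 8 * t) (ℕₚ.≤-antisym (meet≤1 g h h≢𝟎 g+ah≢𝟎)
        (1≤meet g h i g∙x h∙x)))
        where open Pencil (pencilAt i)

      ∑ₗ-k : ∑ₗ k ≡ n * 9
      ∑ₗ-k = begin
        ∑ₗ k                                               ≡⟨ ∑ₗ-cong (λ f → ℕₚ.*-identityʳ (k f)) ⟨
        ∑ₗ (λ f → k f * 1)                                 ≡⟨ weighted (λ _ → 1) ⟨
        sum (λ i → ∑ₗ (λ f → [ zero? (f ∙ p i) ] * 1))     ≡⟨ sum-cong-≗ {n}
            (λ i → trans (Pencil.through (pencilAt i) (λ _ → 1)) (cong (_+ 1) (∑₈-const 1))) ⟩
        sum {n} (λ _ → 9)                                  ≡⟨ sum-const n 9 ⟩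
        n * 9                                              ∎
        where open ≡-Reasoning

      -- The sizes of the lines through a point add up to `n + 8`: the point itself nine times and
      -- every other point once.
      ∑ₗ-k² : ∑ₗ (λ f → k f * k f) ≡ n * (n + 8)
      ∑ₗ-k² = begin
        ∑ₗ (λ f → k f * k f)                                ≡⟨ weighted k ⟨
        sum (λ i → ∑ₗ (λ f → [ zero? (f ∙ p i) ] * k f))    ≡⟨ sum-cong-≗ {n}
            (λ i → trans (Pencil.through (pencilAt i) k) (pencilAt-sum i)) ⟩
        sum {n} (λ _ → n + 8)                               ≡⟨ sum-const n (n + 8) ⟩
        n * (n + 8)                                         ∎
        where open ≡-Reasoning

  -- Here `a` is the number of points and `b` is `9 * s`: multiplicity 2 at one place would push the
  -- pencil sum to `a + 16`.
  m≤1 : ∀ {n m} a b → n ≡ a → b < a + 16 → n + 8 * m ≤ b → m ≤ 1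
  m≤1 {m = m} a b refl b<a+16 le = ℕₚ.≮⇒≥ λ 1<m → ℕₚ.<⇒≱ (ℕₚ.<-≤-trans b<a+16 (ℕₚ.+-monoʳ-≤ a (ℕₚ.*-monoʳ-≤ 8 1<m))) le

  -- (9 - k)(10 - k) ≥ 0 for every integer k.
  no-75-points : ∀ {n} (p : Fin n → Triple) → n ≡ 75 → ¬ (∀ f → f ≢ 𝟎 → Points.k p f ≤ 10)
  no-75-points {n} p n≡75 k≤10 = numeric n≡75 (begin
    19 * (n * 9)                              ≡⟨ cong (19 *_) ∑ₗ-k ⟨
    19 * ∑ₗ k                                 ≡⟨ ∑ₗ-* 19 k ⟨
    ∑ₗ (λ f → 19 * k f)                       ≤⟨ ∑ₗ-mono (λ f f≢𝟎 → pointwise (k f) (k≤10 f f≢𝟎)) ⟩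
    ∑ₗ (λ f → k f * k f + 90)                 ≡⟨ trans (∑ₗ-+ (λ f → k f * k f) (λ _ → 90)) (cong₂ _+_ ∑ₗ-k² (∑ₗ-const 90)) ⟩
    n * (n + 8) + 73 * 90                     ∎)
    where
    open ℕₚ.≤-Reasoning
    open Points p
    open Bounded 10 k≤10
    numeric : ∀ {n} → n ≡ 75 → ¬ 19 * (n * 9) ≤ n * (n + 8) + 73 * 90
    -- For n = 75 the left side is 19 · 675 = 12825, thirty more than the right.
    numeric refl le = ℕₚ.<⇒≱ (ℕₚ.<ᵇ⇒< 12795 12825 _) le
    large : ∀ {n} → n ≡ 75 → 73 * 10 < n * 9 + 64
    large refl = ℕₚ.<ᵇ⇒< 730 739 _
    -- Repeated points are excluded with nothing to spare: 75 + 16 exceeds 9 · 10 by one.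
    open Simple (nonzero (large n≡75))
      (λ g h h≢𝟎 g+ah≢𝟎 → m≤1 75 90 n≡75 ℕₚ.≤-refl (pencil≤ g h h≢𝟎 g+ah≢𝟎))
    pointwise : ∀ k → k ≤ 10 → 19 * k ≤ k * k + 90
    pointwise k k≤10 = from-yes (ℕₚ.allUpTo? (λ k → 19 * k ℕₚ.≤? k * k + 90) 11) {k} (s≤s k≤10)

-- Affine coordinates off a line.

module Frames where

  open Octal
  open Arcs

  -- A set χ of points of AG(2,8); the lines are y = m x + c and x = a.
  Grid : Set
  Grid = F₈ → F₈ → Bool

  on : Grid → F₈ → F₈ → ℕ
  on χ m c = ∑₈ (λ a → [ χ a (m ⊗ a ⊕ c) ])

  on∞ : Grid → F₈ → ℕ
  on∞ χ a = ∑₈ (λ b → [ χ a b ])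

  total : Grid → ℕ
  total χ = ∑₈ (on∞ χ)

  ∑-on : ∀ χ m → ∑₈ (on χ m) ≡ total χ
  ∑-on χ m = trans (∑₈-swap _) (∑₈-cong λ a → ∑₈-reindex (λ c → m ⊗ a ⊕ c) (bij (m ⊗ a)) (λ b → [ χ a b ]))
    where
    opaque
      unfolding ∑₈
      bij : ∀ t d → ∑₈ (λ c → [ zero? (d ⊕ (t ⊕ c)) ]) ≡ 1
      bij = from-yes (∀₈? λ t → ∀₈? λ d → ∑₈ (λ c → [ zero? (d ⊕ (t ⊕ c)) ]) ℕ.≟ 1)

  ∑₈≥1⇒∃ : ∀ G → 1 ≤ ∑₈ G → ∃[ x ] 1 ≤ G x
  ∑₈≥1⇒∃ G le = proj₁ found , pos (G (proj₁ found)) (proj₂ found)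
    where
    positive : F₈ → Bool
    positive x = not (G x ≡ᵇ 0)
    small : ∀ x → [ not (G x ≡ᵇ 0) ] ≡ 0 → G x ≤ 0
    small x eq with G x
    ... | zero = z≤n
    pos : ∀ n → not (n ≡ᵇ 0) ≡ true → 1 ≤ n
    pos (suc n) _ = s≤s z≤n
    found : ∃[ x ] positive x ≡ true
    found = ∑₈≢0⇒∃ positive (ℕₚ.≮⇒≥ λ lt → ℕₚ.<⇒≱ le (subst (∑₈ G ≤_) (∑₈-const 0)
      (∑₈-mono λ x → small x (ℕₚ.n<1⇒n≡0 (ℕₚ.≤-<-trans (term≤∑₈ (λ x → [ positive x ]) x) lt)))))

  ∑₈-split : ∀ (G : F₈ → ℕ) x → ∑₈ G ≡ G x + ∑₈ (λ y → [ not (zero? (y ⊕ x)) ] * G y)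
  ∑₈-split G x = trans (∑₈-cong λ y → sym (halves (zero? (y ⊕ x)) (G y)))
    (trans (∑₈-+ (λ y → [ zero? (y ⊕ x) ] * G y) rest) (cong (_+ ∑₈ rest) (∑₈-δ x G)))
    where
    rest : F₈ → ℕ
    rest y = [ not (zero? (y ⊕ x)) ] * G y
    halves : ∀ b n → [ b ] * n + [ not b ] * n ≡ n
    halves true  n = trans (ℕₚ.+-identityʳ _) (ℕₚ.+-identityʳ n)
    halves false n = ℕₚ.+-identityʳ n

  ∑₈≥2⇒∃ : ∀ G x → G x ≤ 1 → 2 ≤ ∑₈ G → ∃[ y ] (y ⊕ x ≢ 𝟘) × 1 ≤ G y
  ∑₈≥2⇒∃ G x Gx≤1 le = let y , le′ = ∑₈≥1⇒∃ rest rest≥1 in y , ≢𝟘 y le′ , pos y le′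
    where
    rest : F₈ → ℕ
    rest y = [ not (zero? (y ⊕ x)) ] * G y
    rest≥1 : 1 ≤ ∑₈ rest
    rest≥1 = ℕₚ.+-cancelˡ-≤ 1 _ _ (ℕₚ.≤-trans le (ℕₚ.≤-trans (ℕₚ.≤-reflexive (∑₈-split G x)) (ℕₚ.+-monoˡ-≤ _ Gx≤1)))
    ≢𝟘 : ∀ y → 1 ≤ rest y → y ⊕ x ≢ 𝟘
    ≢𝟘 y le eq with zero? (y ⊕ x) | zero?-𝟘 eq
    ≢𝟘 y () eq | true | _
    pos : ∀ y → 1 ≤ rest y → 1 ≤ G y
    pos y le with zero? (y ⊕ x)
    ... | false = subst (1 ≤_) (ℕₚ.+-identityʳ _) le

  -- Affine coordinates for the complement of the line f: u = a f and v = b f at the point (a , b). The points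
  -- eu and ev of f witness that u, v, f are independent.
  record Frame (f : Triple) : Set where
    field
      u v eu ev : Triple
      f≢𝟎  : f ≢ 𝟎
      u∙eu : u ∙ eu ≢ 𝟘
      v∙eu : v ∙ eu ≡ 𝟘
      f∙eu : f ∙ eu ≡ 𝟘
      u∙ev : u ∙ ev ≡ 𝟘
      v∙ev : v ∙ ev ≢ 𝟘
      f∙ev : f ∙ ev ≡ 𝟘
      kill : ∀ y → u ∙ y ≡ 𝟘 → v ∙ y ≡ 𝟘 → f ∙ y ≡ 𝟘 → y ≡ 𝟎

    ⊞⊠-∙ : ∀ g t h y → (g ⊞ t ⊠ h) ∙ y ≡ g ∙ y ⊕ t ⊗ h ∙ y
    ⊞⊠-∙ g t h y = trans (⊞-∙ g (t ⊠ h) y) (cong (g ∙ y ⊕_) (⊠-∙ t h y))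

    private
      vanish : ∀ x t {y} → y ≡ 𝟘 → x ⊕ t ⊗ y ≡ x
      vanish x t refl = trans (cong (x ⊕_) (⊗-zeroʳ t)) (⊕-identityʳ x)

      nonzero-at : ∀ {g} y → g ∙ y ≢ 𝟘 → g ≢ 𝟎
      nonzero-at y g∙y≢𝟘 refl = g∙y≢𝟘 (𝟎-∙ y)

    vertical vertical′ : F₈ → Triple
    vertical  a = u ⊞ a ⊠ f
    vertical′ b = v ⊞ b ⊠ f

    slope : F₈ → Triple
    slope m = v ⊞ m ⊠ u

    line : F₈ → F₈ → Triple
    line m c = slope m ⊞ c ⊠ f

    vertical≢𝟎 : ∀ a → vertical a ≢ 𝟎
    vertical≢𝟎 a = nonzero-at eu λ eq → u∙eu (trans (sym (trans (⊞⊠-∙ u a f eu) (vanish _ a f∙eu))) eq)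

    vertical′≢𝟎 : ∀ b → vertical′ b ≢ 𝟎
    vertical′≢𝟎 b = nonzero-at ev λ eq → v∙ev (trans (sym (trans (⊞⊠-∙ v b f ev) (vanish _ b f∙ev))) eq)

    line≢𝟎 : ∀ m c → line m c ≢ 𝟎
    line≢𝟎 m c = nonzero-at ev λ eq → v∙ev (trans (sym (trans (⊞⊠-∙ (slope m) c f ev)
      (trans (vanish _ c f∙ev) (trans (⊞⊠-∙ v m u ev) (vanish _ m u∙ev))))) eq)

    cell≢𝟎 : ∀ a b t → vertical a ⊞ t ⊠ vertical′ b ≢ 𝟎
    cell≢𝟎 a b t = nonzero-at eu λ eq → u∙eu (trans (sym (trans (⊞⊠-∙ (vertical a) t (vertical′ b) eu)
      (trans (vanish _ t (trans (⊞⊠-∙ v b f eu) (trans (vanish _ b f∙eu) v∙eu)))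
          (trans (⊞⊠-∙ u a f eu) (vanish _ a f∙eu))))) eq)

  coordinate₁ : ∀ x y z → 𝟙 ⊗ x ⊕ 𝟘 ⊗ y ⊕ 𝟘 ⊗ z ≡ x
  coordinate₁ = from-yes (∀₈? λ x → ∀₈? λ y → ∀₈? λ z → (𝟙 ⊗ x ⊕ 𝟘 ⊗ y ⊕ 𝟘 ⊗ z) ≟ x)

  coordinate₂ : ∀ x y z → 𝟘 ⊗ x ⊕ 𝟙 ⊗ y ⊕ 𝟘 ⊗ z ≡ y
  coordinate₂ = from-yes (∀₈? λ x → ∀₈? λ y → ∀₈? λ z → (𝟘 ⊗ x ⊕ 𝟙 ⊗ y ⊕ 𝟘 ⊗ z) ≟ y)

  coordinate₃ : ∀ x y z → 𝟘 ⊗ x ⊕ 𝟘 ⊗ y ⊕ 𝟙 ⊗ z ≡ z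
  coordinate₃ = from-yes (∀₈? λ x → ∀₈? λ y → ∀₈? λ z → (𝟘 ⊗ x ⊕ 𝟘 ⊗ y ⊕ 𝟙 ⊗ z) ≟ z)

  opaque
    unfolding _∙_

    -- `u` and `v` are the two coordinates other than the first one at which `f` is nonzero; in `eu`
    -- and `ev` that coordinate is chosen so that `f` vanishes.
    standardFrame : ∀ f → f ≢ 𝟎 → Frame f
    standardFrame (a , b , c) f≢𝟎 with a ≟ 𝟘 | b ≟ 𝟘
    ... | no a≢𝟘 | _ = record
      { u = 𝟘 , 𝟙 , 𝟘 ; v = 𝟘 , 𝟘 , 𝟙
      ; eu = inv a ⊗ b , 𝟙 , 𝟘 ; ev = inv a ⊗ c , 𝟘 , 𝟙
      ; f≢𝟎 = f≢𝟎
      ; u∙eu = ≢₁ (inv a ⊗ b) ; v∙eu = ≡₁ (inv a ⊗ b) ; f∙eu = ≡₂ a b c a≢𝟘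
      ; u∙ev = ≡₁ (inv a ⊗ c) ; v∙ev = ≢₁ (inv a ⊗ c) ; f∙ev = ≡₃ a b c a≢𝟘
      ; kill = λ { (x , y , z) eq₁ eq₂ eq₃ → kill x y z (trans (sym (coordinate₂ x y z)) eq₁)
          (trans (sym (coordinate₃ x y z)) eq₂) eq₃ }
      }
      where
      ≢₁ : ∀ t → 𝟘 ⊗ t ⊕ 𝟙 ≢ 𝟘
      ≢₁ = from-yes (∀₈? λ t → ¬? ((𝟘 ⊗ t ⊕ 𝟙) ≟ 𝟘))
      ≡₁ : ∀ t → 𝟘 ⊗ t ⊕ 𝟘 ⊕ 𝟘 ≡ 𝟘
      ≡₁ = from-yes (∀₈? λ t → (𝟘 ⊗ t ⊕ 𝟘 ⊕ 𝟘) ≟ 𝟘)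
      ≡₂ : ∀ a b c → a ≢ 𝟘 → a ⊗ (inv a ⊗ b) ⊕ b ⊗ 𝟙 ⊕ c ⊗ 𝟘 ≡ 𝟘
      ≡₂ = from-yes (∀₈? λ a → ∀₈? λ b → ∀₈? λ c → ¬? (a ≟ 𝟘) →-dec (a ⊗ (inv a ⊗ b) ⊕ b ⊗ 𝟙 ⊕ c ⊗ 𝟘) ≟ 𝟘)
      ≡₃ : ∀ a b c → a ≢ 𝟘 → a ⊗ (inv a ⊗ c) ⊕ b ⊗ 𝟘 ⊕ c ⊗ 𝟙 ≡ 𝟘
      ≡₃ = from-yes (∀₈? λ a → ∀₈? λ b → ∀₈? λ c → ¬? (a ≟ 𝟘) →-dec (a ⊗ (inv a ⊗ c) ⊕ b ⊗ 𝟘 ⊕ c ⊗ 𝟙) ≟ 𝟘)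
      ≡₇ : ∀ t b c → t ⊕ b ⊗ 𝟘 ⊕ c ⊗ 𝟘 ≡ t
      ≡₇ t b c = trans (cong₂ _⊕_ (trans (cong (t ⊕_) (⊗-zeroʳ b)) (⊕-identityʳ t)) (⊗-zeroʳ c)) (⊕-identityʳ t)
      kill : ∀ x y z → y ≡ 𝟘 → z ≡ 𝟘 → a ⊗ x ⊕ b ⊗ y ⊕ c ⊗ z ≡ 𝟘 → (x , y , z) ≡ 𝟎
      kill x _ _ refl refl eq = cong (_, 𝟘 , 𝟘) (⊗-nonzero a x a≢𝟘 (trans (sym (≡₇ (a ⊗ x) b c)) eq))
    ... | yes refl | no b≢𝟘 = record
      { u = 𝟙 , 𝟘 , 𝟘 ; v = 𝟘 , 𝟘 , 𝟙
      ; eu = 𝟙 , 𝟘 , 𝟘 ; ev = 𝟘 , inv b ⊗ c , 𝟙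
      ; f≢𝟎 = f≢𝟎
      ; u∙eu = λ () ; v∙eu = refl ; f∙eu = cong₂ _⊕_ (⊗-zeroʳ b) (⊗-zeroʳ c)
      ; u∙ev = ≡₁ (inv b ⊗ c) ; v∙ev = ≢₁ (inv b ⊗ c) ; f∙ev = ≡₃ b c b≢𝟘
      ; kill = λ { (x , y , z) eq₁ eq₂ eq₃ → kill x y z (trans (sym (coordinate₁ x y z)) eq₁)
          (trans (sym (coordinate₃ x y z)) eq₂) eq₃ }
      }
      where
      ≢₁ : ∀ t → 𝟘 ⊗ t ⊕ 𝟙 ≢ 𝟘
      ≢₁ = from-yes (∀₈? λ t → ¬? ((𝟘 ⊗ t ⊕ 𝟙) ≟ 𝟘))
      ≡₁ : ∀ t → 𝟘 ⊗ t ⊕ 𝟘 ≡ 𝟘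
      ≡₁ = from-yes (∀₈? λ t → (𝟘 ⊗ t ⊕ 𝟘) ≟ 𝟘)
      ≡₃ : ∀ b c → b ≢ 𝟘 → b ⊗ (inv b ⊗ c) ⊕ c ⊗ 𝟙 ≡ 𝟘
      ≡₃ = from-yes (∀₈? λ b → ∀₈? λ c → ¬? (b ≟ 𝟘) →-dec (b ⊗ (inv b ⊗ c) ⊕ c ⊗ 𝟙) ≟ 𝟘)
      kill : ∀ x y z → x ≡ 𝟘 → z ≡ 𝟘 → 𝟘 ⊗ x ⊕ b ⊗ y ⊕ c ⊗ z ≡ 𝟘 → (x , y , z) ≡ 𝟎
      kill _ y _ refl refl eq = cong (λ t → 𝟘 , t , 𝟘) (⊗-nonzero b y b≢𝟘
        (trans (sym (trans (cong ((𝟘 ⊕ b ⊗ y) ⊕_) (⊗-zeroʳ c)) (trans (⊕-identityʳ _) (⊕-identityˡ _)))) eq))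
    ... | yes refl | yes refl = record
      { u = 𝟙 , 𝟘 , 𝟘 ; v = 𝟘 , 𝟙 , 𝟘
      ; eu = 𝟙 , 𝟘 , 𝟘 ; ev = 𝟘 , 𝟙 , 𝟘
      ; f≢𝟎 = f≢𝟎
      ; u∙eu = λ () ; v∙eu = refl ; f∙eu = cong (𝟘 ⊕_) (⊗-zeroʳ c)
      ; u∙ev = refl ; v∙ev = λ () ; f∙ev = cong (𝟘 ⊕_) (⊗-zeroʳ c)
      ; kill = λ { (x , y , z) eq₁ eq₂ eq₃ → kill x y z (trans (sym (coordinate₁ x y z)) eq₁)
          (trans (sym (coordinate₂ x y z)) eq₂) eq₃ }
      }
      where
      c≢𝟘 : c ≢ 𝟘
      c≢𝟘 refl = f≢𝟎 refl
      kill : ∀ x y z → x ≡ 𝟘 → y ≡ 𝟘 → 𝟘 ⊗ x ⊕ 𝟘 ⊗ y ⊕ c ⊗ z ≡ 𝟘 → (x , y , z) ≡ 𝟎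
      kill _ _ z refl refl eq = cong (λ t → 𝟘 , 𝟘 , t) (⊗-nonzero c z c≢𝟘 (trans (sym (⊕-identityˡ _)) eq))

-- Changes of frame, and point counts on affine lines.

module AffineCounts where

  open Octal
  open Arcs
  open Frames

  -- Serves to move directions at infinity to prescribed ones. The witnesses `eu′` and `ev′` come
  -- from the adjugate matrix, weighted because `u ∙ eu` and `v ∙ ev` may differ from `𝟙`; in
  -- characteristic 2 the determinant carries a plus sign.
  changeFrame : ∀ {f} (R : Frame f) α β γ δ → α ⊗ δ ⊕ γ ⊗ β ≢ 𝟘 → Σ[ R′ ∈ Frame f ]
    (∀ y → Frame.u R′ ∙ y ≡ α ⊗ Frame.u R ∙ y ⊕ β ⊗ Frame.v R ∙ y) ×
    (∀ y → Frame.v R′ ∙ y ≡ γ ⊗ Frame.u R ∙ y ⊕ δ ⊗ Frame.v R ∙ y)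
  changeFrame {f} R α β γ δ det≢𝟘 = record
    { u = u′ ; v = v′ ; eu = eu′ ; ev = ev′
    ; f≢𝟎 = f≢𝟎
    ; u∙eu = λ eq → nonzero (trans (sym (trans (u′≡ eu′) (on-eu α β))) eq)
    ; v∙eu = trans (trans (v′≡ eu′) (on-eu γ δ)) (cancel γ δ)
    ; f∙eu = on-f (δ ⊗ v ∙ ev) (γ ⊗ u ∙ eu)
    ; u∙ev = trans (trans (u′≡ ev′) (on-ev α β)) (cancel α β)
    ; v∙ev = λ eq → nonzero (trans (sym (trans (trans (v′≡ ev′) (on-ev γ δ)) (rearrange γ δ))) eq)
    ; f∙ev = on-f (β ⊗ v ∙ ev) (α ⊗ u ∙ eu)
    ; kill = λ y u′y≡𝟘 v′y≡𝟘 fy≡𝟘 → kill y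
        (⊗-nonzero (α ⊗ δ ⊕ γ ⊗ β) (u ∙ y) det≢𝟘
            (trans (sym (eliminate-u y)) (trans
            (cong₂ (λ s t → δ ⊗ s ⊕ β ⊗ t) (trans (sym (u′≡ y)) u′y≡𝟘) (trans (sym (v′≡ y)) v′y≡𝟘)) (zeros δ β))))
        (⊗-nonzero (α ⊗ δ ⊕ γ ⊗ β) (v ∙ y) det≢𝟘
            (trans (sym (eliminate-v y)) (trans
            (cong₂ (λ s t → γ ⊗ s ⊕ α ⊗ t) (trans (sym (u′≡ y)) u′y≡𝟘) (trans (sym (v′≡ y)) v′y≡𝟘)) (zeros γ α))))
        fy≡𝟘
    } , u′≡ , v′≡
    where
    open Frame R
    u′ v′ eu′ ev′ : Triple
    u′ = α ⊠ u ⊞ β ⊠ v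
    v′ = γ ⊠ u ⊞ δ ⊠ v
    eu′ = (δ ⊗ v ∙ ev) ⊠ eu ⊞ (γ ⊗ u ∙ eu) ⊠ ev
    ev′ = (β ⊗ v ∙ ev) ⊠ eu ⊞ (α ⊗ u ∙ eu) ⊠ ev
    combine : ∀ s t g h y → (s ⊠ g ⊞ t ⊠ h) ∙ y ≡ s ⊗ g ∙ y ⊕ t ⊗ h ∙ y
    combine s t g h y = trans (⊞-∙ (s ⊠ g) (t ⊠ h) y) (cong₂ _⊕_ (⊠-∙ s g y) (⊠-∙ t h y))
    combineʳ : ∀ s t g y z → g ∙ (s ⊠ y ⊞ t ⊠ z) ≡ s ⊗ g ∙ y ⊕ t ⊗ g ∙ z
    combineʳ s t g y z = trans (∙-comm g (s ⊠ y ⊞ t ⊠ z))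
        (trans (combine s t y z g) (cong₂ (λ a b → s ⊗ a ⊕ t ⊗ b) (∙-comm y g) (∙-comm z g)))
    u′≡ : ∀ y → u′ ∙ y ≡ α ⊗ u ∙ y ⊕ β ⊗ v ∙ y
    u′≡ = combine α β u v
    v′≡ : ∀ y → v′ ∙ y ≡ γ ⊗ u ∙ y ⊕ δ ⊗ v ∙ y
    v′≡ = combine γ δ u v
    U V : F₈
    U = u ∙ eu
    V = v ∙ ev
    zeros : ∀ s t → s ⊗ 𝟘 ⊕ t ⊗ 𝟘 ≡ 𝟘
    zeros s t = cong₂ _⊕_ (⊗-zeroʳ s) (⊗-zeroʳ t)
    on-f : ∀ s t → f ∙ (s ⊠ eu ⊞ t ⊠ ev) ≡ 𝟘
    on-f s t = trans (combineʳ s t f eu ev) (trans (cong₂ (λ a b → s ⊗ a ⊕ t ⊗ b) f∙eu f∙ev) (zeros s t))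
    u-on : ∀ s t → u ∙ (s ⊠ eu ⊞ t ⊠ ev) ≡ s ⊗ U
    u-on s t = trans (combineʳ s t u eu ev)
        (trans (cong (λ a → s ⊗ U ⊕ t ⊗ a) u∙ev) (trans (cong (s ⊗ U ⊕_) (⊗-zeroʳ t)) (⊕-identityʳ (s ⊗ U))))
    v-on : ∀ s t → v ∙ (s ⊠ eu ⊞ t ⊠ ev) ≡ t ⊗ V
    v-on s t = trans (combineʳ s t v eu ev)
        (trans (cong (λ a → s ⊗ a ⊕ t ⊗ V) v∙eu) (trans (cong (_⊕ t ⊗ V) (⊗-zeroʳ s)) (⊕-identityˡ (t ⊗ V))))
    on-eu : ∀ s t → s ⊗ u ∙ eu′ ⊕ t ⊗ v ∙ eu′ ≡ (s ⊗ δ ⊕ γ ⊗ t) ⊗ (U ⊗ V)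
    on-eu s t = trans (cong₂ (λ a b → s ⊗ a ⊕ t ⊗ b) (u-on (δ ⊗ V) (γ ⊗ U)) (v-on (δ ⊗ V) (γ ⊗ U)))
      (S.solve 6 (λ s t γ δ U V → s S.:* ((δ S.:* V) S.:* U) S.:+ t S.:* ((γ S.:* U) S.:* V) S.:=
          (s S.:* δ S.:+ γ S.:* t) S.:* (U S.:* V)) refl s t γ δ U V)
    on-ev : ∀ s t → s ⊗ u ∙ ev′ ⊕ t ⊗ v ∙ ev′ ≡ (s ⊗ β ⊕ α ⊗ t) ⊗ (U ⊗ V)
    on-ev s t = trans (cong₂ (λ a b → s ⊗ a ⊕ t ⊗ b) (u-on (β ⊗ V) (α ⊗ U)) (v-on (β ⊗ V) (α ⊗ U)))
      (S.solve 6 (λ s t α β U V → s S.:* ((β S.:* V) S.:* U) S.:+ t S.:* ((α S.:* U) S.:* V) S.:=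
          (s S.:* β S.:+ α S.:* t) S.:* (U S.:* V)) refl s t α β U V)
    nonzero : (α ⊗ δ ⊕ γ ⊗ β) ⊗ (U ⊗ V) ≢ 𝟘
    nonzero eq = v∙ev (⊗-nonzero U V u∙eu (⊗-nonzero (α ⊗ δ ⊕ γ ⊗ β) (U ⊗ V) det≢𝟘 eq))
    cancel : ∀ s t → (s ⊗ t ⊕ s ⊗ t) ⊗ (U ⊗ V) ≡ 𝟘
    cancel s t = trans (cong (_⊗ (U ⊗ V)) (⊕-self (s ⊗ t))) (⊗-zeroˡ (U ⊗ V))
    rearrange : ∀ s t → (s ⊗ β ⊕ α ⊗ t) ⊗ (U ⊗ V) ≡ (α ⊗ t ⊕ s ⊗ β) ⊗ (U ⊗ V)
    rearrange s t = cong (_⊗ (U ⊗ V)) (⊕-comm (s ⊗ β) (α ⊗ t))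


    -- The doubled term left by the elimination vanishes in characteristic 2.
    drop : ∀ d t x → d ⊕ (t ⊕ t) ⊗ x ≡ d
    drop d t x = trans (cong (λ s → d ⊕ s ⊗ x) (⊕-self t)) (trans (cong (d ⊕_) (⊗-zeroˡ x)) (⊕-identityʳ d))
    eliminate-u : ∀ y → δ ⊗ (α ⊗ u ∙ y ⊕ β ⊗ v ∙ y) ⊕ β ⊗ (γ ⊗ u ∙ y ⊕ δ ⊗ v ∙ y) ≡ (α ⊗ δ ⊕ γ ⊗ β) ⊗ u ∙ y
    eliminate-u y = trans (S.solve 6 (λ α β γ δ x y →
        δ S.:* (α S.:* x S.:+ β S.:* y) S.:+ β S.:* (γ S.:* x S.:+ δ S.:* y)
        S.:= (α S.:* δ S.:+ γ S.:* β) S.:* x S.:+ (β S.:* δ S.:+ β S.:* δ) S.:* y) refl α β γ δ (u ∙ y) (v ∙ y))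
      (drop ((α ⊗ δ ⊕ γ ⊗ β) ⊗ u ∙ y) (β ⊗ δ) (v ∙ y))
    eliminate-v : ∀ y → γ ⊗ (α ⊗ u ∙ y ⊕ β ⊗ v ∙ y) ⊕ α ⊗ (γ ⊗ u ∙ y ⊕ δ ⊗ v ∙ y) ≡ (α ⊗ δ ⊕ γ ⊗ β) ⊗ v ∙ y
    eliminate-v y = trans (S.solve 6 (λ α β γ δ x y →
        γ S.:* (α S.:* x S.:+ β S.:* y) S.:+ α S.:* (γ S.:* x S.:+ δ S.:* y)
        S.:= (α S.:* δ S.:+ γ S.:* β) S.:* y S.:+ (α S.:* γ S.:+ α S.:* γ) S.:* x) refl α β γ δ (u ∙ y) (v ∙ y))
      (drop ((α ⊗ δ ⊕ γ ⊗ β) ⊗ v ∙ y) (α ⊗ γ) (u ∙ y))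

  zero?-⊕⊗ : ∀ x a r → zero? x ∧ zero? r ≡ zero? (x ⊕ a ⊗ r) ∧ zero? r
  zero?-⊕⊗ = from-yes (∀₈? λ x → ∀₈? λ a → ∀₈? λ r → (zero? x ∧ zero? r) Boolₚ.≟ (zero? (x ⊕ a ⊗ r) ∧ zero? r))

  opaque
    unfolding ∑₈

    -- One point of the line at a time, with `r` its value under `f`: for `r` nonzero it occupies
    -- exactly one cell, for `r ≡ 𝟘` it can only be the point at infinity. The hypothesis excludes
    -- the zero vector. The same dichotomy gives `local-line`.
    local-vertical : ∀ x q r → zero? x ∧ zero? q ∧ zero? r ≡ false →
      ∑₈ (λ b → [ zero? x ∧ zero? (q ⊕ b ⊗ r) ]) + [ zero? x ∧ zero? r ] ≡ [ zero? x ]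
    local-vertical = from-yes (∀₈? λ x → ∀₈? λ q → ∀₈? λ r → ((zero? x ∧ zero? q ∧ zero? r) Boolₚ.≟ false) →-dec
      (∑₈ (λ b → [ zero? x ∧ zero? (q ⊕ b ⊗ r) ]) + [ zero? x ∧ zero? r ]) ℕ.≟ [ zero? x ])

    local-line : ∀ m x q r → zero? x ∧ zero? q ∧ zero? r ≡ false →
      ∑₈ (λ a → [ zero? (x ⊕ a ⊗ r) ∧ zero? (q ⊕ m ⊗ a ⊗ r) ]) + [ zero? (q ⊕ m ⊗ x) ∧ zero? r ] ≡ [ zero? (q ⊕ m ⊗ x) ]
    local-line = from-yes (∀₈? λ m → ∀₈? λ x → ∀₈? λ q → ∀₈? λ r → ((zero? x ∧ zero? q ∧ zero? r) Boolₚ.≟ false) →-dec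
      (∑₈ (λ a → [ zero? (x ⊕ a ⊗ r) ∧ zero? (q ⊕ m ⊗ a ⊗ r) ]) + [ zero? (q ⊕ m ⊗ x) ∧ zero? r ]) ℕ.≟ [ zero? (q ⊕ m ⊗ x) ])

    local-slopes : ∀ x q r → zero? x ∧ zero? q ∧ zero? r ≡ false →
      ∑₈ (λ m → [ zero? (q ⊕ m ⊗ x) ∧ zero? r ]) + [ zero? x ∧ zero? r ] ≡ [ zero? r ]
    local-slopes = from-yes (∀₈? λ x → ∀₈? λ q → ∀₈? λ r → ((zero? x ∧ zero? q ∧ zero? r) Boolₚ.≟ false) →-dec
      (∑₈ (λ m → [ zero? (q ⊕ m ⊗ x) ∧ zero? r ]) + [ zero? x ∧ zero? r ]) ℕ.≟ [ zero? r ])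

  module Affine {n} (p : Fin n → Triple) (p≢𝟎 : ∀ i → p i ≢ 𝟎)
    (meet≤1 : ∀ g h → h ≢ 𝟎 → (∀ a → g ⊞ a ⊠ h ≢ 𝟎) → Points.meet p g h ≤ 1)
    (k≤7 : ∀ f → f ≢ 𝟎 → Points.k p f ≤ 7)
    {f} (R : Frame f) where

    open Points p
    open Frame R

    at-infinity : F₈ → ℕ
    at-infinity m = meet (slope m) f

    at-infinity∞ : ℕ
    at-infinity∞ = meet u f

    points : F₈ → F₈ → ℕ
    points a b = meet (vertical a) (vertical′ b)

    private
      not-all-zero : ∀ i c → zero? (u ∙ p i) ∧ zero? (v ∙ p i ⊕ c ⊗ f ∙ p i) ∧ zero? (f ∙ p i) ≡ false
      not-all-zero i c with zero? (u ∙ p i) in eq₁ | zero? (v ∙ p i ⊕ c ⊗ f ∙ p i) in eq₂ | zero? (f ∙ p i) in eq₃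
      ... | false | _     | _     = refl
      ... | true  | false | _     = refl
      ... | true  | true  | false = refl
      ... | true  | true  | true  = contradiction (kill (p i) (zero?-sound _ eq₁) v≡𝟘 (zero?-sound _ eq₃)) (p≢𝟎 i)
        where
        v≡𝟘 : v ∙ p i ≡ 𝟘
        v≡𝟘 = trans (sym (trans (cong (λ t → v ∙ p i ⊕ c ⊗ t) (zero?-sound _ eq₃))
            (trans (cong (v ∙ p i ⊕_) (⊗-zeroʳ c)) (⊕-identityʳ _))))
                    (zero?-sound _ eq₂)

      shift-vertical : ∀ x a q r → zero? x ∧ zero? (q ⊕ 𝟘 ⊗ r) ∧ zero? r ≡ false → zero? (x ⊕ a ⊗ r) ∧ zero? q ∧ zero? r ≡ false
      shift-vertical x a q r eq with r ≟ 𝟘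
      ... | no r≢𝟘 rewrite zero?-≢ r≢𝟘 | Boolₚ.∧-zeroʳ (zero? q) = Boolₚ.∧-zeroʳ _
      ... | yes refl = trans (cong₂ (λ s t → zero? s ∧ zero? t ∧ true)
              (trans (cong (x ⊕_) (⊗-zeroʳ a)) (⊕-identityʳ x)) (sym (⊕-identityʳ q))) eq

    opaque
      unfolding k

      exchange : ∀ (G : F₈ → Fin n → Bool) g h → ∑₈ (λ a → sum (λ i → [ G a i ])) + meet g h
        ≡ sum (λ i → ∑₈ (λ a → [ G a i ]) + [ zero? (g ∙ p i) ∧ zero? (h ∙ p i) ])
      exchange G g h = trans (cong (_+ meet g h) (∑₈-∑ (λ a i → [ G a i ])))
          (sym (∑-distrib-+ {n} (λ i → ∑₈ (λ a → [ G a i ])) (λ i → [ zero? (g ∙ p i) ∧ zero? (h ∙ p i) ])))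

      vertical-count : ∀ a → ∑₈ (points a) + at-infinity∞ ≡ k (vertical a)
      vertical-count a = trans (exchange (λ b i → zero? (vertical a ∙ p i) ∧ zero? (vertical′ b ∙ p i)) u f)
        (sum-cong-≗ {n} λ i → trans (cong₂ _+_
            (∑₈-cong λ b → cong₂ (λ s t → [ zero? s ∧ zero? t ]) (⊞⊠-∙ u a f (p i)) (⊞⊠-∙ v b f (p i)))
            (cong [_] (zero?-⊕⊗ (u ∙ p i) a (f ∙ p i))))
          (trans (local-vertical (u ∙ p i ⊕ a ⊗ f ∙ p i) (v ∙ p i) (f ∙ p i)
              (shift-vertical (u ∙ p i) a (v ∙ p i) (f ∙ p i) (not-all-zero i 𝟘)))
            (cong (λ s → [ zero? s ]) (sym (⊞⊠-∙ u a f (p i))))))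

      line-count : ∀ m c → ∑₈ (λ a → points a (m ⊗ a ⊕ c)) + at-infinity m ≡ k (line m c)
      line-count m c = trans (exchange (λ a i → zero? (vertical a ∙ p i) ∧ zero? (vertical′ (m ⊗ a ⊕ c) ∙ p i)) (slope m) f)
        (sum-cong-≗ {n} λ i → let x = u ∙ p i ; y = v ∙ p i ; r = f ∙ p i in trans (cong₂ _+_
            (∑₈-cong λ a → cong₂ (λ s t → [ zero? s ∧ zero? t ]) (⊞⊠-∙ u a f (p i))
              (trans (⊞⊠-∙ v (m ⊗ a ⊕ c) f (p i)) (regroup y m a c r)))
            (cong [_] (trans (zero?-⊕⊗ (slope m ∙ p i) c r)
                (cong (λ s → zero? s ∧ zero? r) (trans (cong (_⊕ c ⊗ r) (⊞⊠-∙ v m u (p i))) (swap y (m ⊗ x) (c ⊗ r)))))))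
          (trans (local-line m x (y ⊕ c ⊗ r) r (not-all-zero i c))
            (cong (λ s → [ zero? s ]) (sym (trans (⊞⊠-∙ (slope m) c f (p i))
                (trans (cong (_⊕ c ⊗ r) (⊞⊠-∙ v m u (p i))) (swap y (m ⊗ x) (c ⊗ r))))))))
        where
        regroup : ∀ y m a c r → y ⊕ (m ⊗ a ⊕ c) ⊗ r ≡ y ⊕ c ⊗ r ⊕ m ⊗ a ⊗ r
        regroup = S.solve 5 (λ y m a c r → y S.:+ (m S.:* a S.:+ c) S.:* r S.:= y S.:+ c S.:* r S.:+ m S.:* a S.:* r) refl
        swap : ∀ a b c → a ⊕ b ⊕ c ≡ a ⊕ c ⊕ b
        swap = S.solve 3 (λ a b c → a S.:+ b S.:+ c S.:= a S.:+ c S.:+ b) refl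

      slopes-count : ∑₈ at-infinity + at-infinity∞ ≡ k f
      slopes-count = trans (exchange (λ m i → zero? (slope m ∙ p i) ∧ zero? (f ∙ p i)) u f)
        (sum-cong-≗ {n} λ i → trans (cong (_+ [ zero? (u ∙ p i) ∧ zero? (f ∙ p i) ])
            (∑₈-cong λ m → cong (λ s → [ zero? s ∧ zero? (f ∙ p i) ]) (⊞⊠-∙ v m u (p i))))
          (local-slopes (u ∙ p i) (v ∙ p i) (f ∙ p i)
            (subst (λ s → zero? (u ∙ p i) ∧ zero? s ∧ zero? (f ∙ p i) ≡ false) (⊕-identityʳ (v ∙ p i)) (not-all-zero i 𝟘))))

    χ : Grid
    χ a b = points a b ≡ᵇ 0

    private
      χ+points : ∀ a b → [ χ a b ] + points a b ≡ 1
      χ+points a b = go (points a b) (meet≤1 (vertical a) (vertical′ b) (vertical′≢𝟎 b) (cell≢𝟎 a b))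
        where
        go : ∀ m → m ≤ 1 → [ m ≡ᵇ 0 ] + m ≡ 1
        go 0 _ = refl
        go 1 _ = refl
        go (suc (suc _)) (s≤s ())

      complement : ∀ (b : F₈ → F₈) → ∑₈ (λ a → [ χ a (b a) ]) + ∑₈ (λ a → points a (b a)) ≡ 8
      complement b = trans (sym (∑₈-+ (λ a → [ χ a (b a) ]) (λ a → points a (b a))))
          (trans (∑₈-cong λ a → χ+points a (b a)) (∑₈-const 1))

      lower : ∀ {s t i j} → s + t ≡ 8 → t + i ≡ j → j ≤ 7 → 1 + i ≤ s
      lower {s} {t} {i} {j} s+t≡8 t+i≡j j≤7 = ℕₚ.+-cancelʳ-≤ 7 (1 + i) s (begin
        1 + i + 7    ≡⟨ solve 1 (λ i → con 1 :+ i :+ con 7 := con 8 :+ i) refl i ⟩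
        8 + i        ≡⟨ cong (_+ i) s+t≡8 ⟨
        s + t + i    ≡⟨ ℕₚ.+-assoc s t i ⟩
        s + (t + i)  ≡⟨ cong (s +_) t+i≡j ⟩
        s + j        ≤⟨ ℕₚ.+-monoʳ-≤ s j≤7 ⟩
        s + 7        ∎)
        where
        open ℕₚ.≤-Reasoning
        open +-*-Solver

    -- A line has eight cells and at most 7 points of the family; each of these at infinity lowers
    -- by one the number of cells that can be occupied.
    on≥ : ∀ m c → 1 + at-infinity m ≤ on χ m c
    on≥ m c = lower (complement (λ a → m ⊗ a ⊕ c)) (line-count m c) (k≤7 _ (line≢𝟎 m c))

    on∞≥ : ∀ a → 1 + at-infinity∞ ≤ on∞ χ a
    on∞≥ a = lower (trans (sym (∑₈-+ (λ b → [ χ a b ]) (points a))) (trans (∑₈-cong (χ+points a)) (∑₈-const 1)))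
        (vertical-count a) (k≤7 _ (vertical≢𝟎 a))

    -- The pencil through the infinite point of the verticals counts every point once, and those at
    -- that infinite point eight more times. Cancelling the excess leaves the occupied cells and the
    -- points on `f`.
    total-count : total χ + n ≡ 64 + k f
    total-count = ℕₚ.+-cancelʳ-≡ (8 * at-infinity∞) _ _ (begin
      total χ + n + 8 * I                                       ≡⟨ ℕₚ.+-assoc (total χ) n _ ⟩
      total χ + (n + 8 * I)                                     ≡⟨ cong (total χ +_) (pencil-sum u f) ⟨
      total χ + (∑₈ (λ a → k (vertical a)) + k f)               ≡⟨ cong (λ t → total χ + (t + k f))
          (trans (∑₈-cong λ a → sym (vertical-count a))
          (trans (∑₈-+ (λ a → ∑₈ (points a)) (λ _ → I)) (cong (all +_) (∑₈-const I)))) ⟩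
      total χ + (all + 8 * I + k f)                             ≡⟨ solve 4
          (λ a b c d → a :+ (b :+ c :+ d) := a :+ b :+ d :+ c) refl (total χ) all (8 * I) (k f) ⟩
      total χ + all + k f + 8 * I                               ≡⟨ cong (λ t → t + k f + 8 * I) all-cells ⟩
      64 + k f + 8 * I                                          ∎)
      where
      open ≡-Reasoning
      open +-*-Solver
      I all : ℕ
      I = at-infinity∞
      all = ∑₈ (λ a → ∑₈ (points a))
      all-cells : total χ + all ≡ 64
      all-cells = trans (sym (∑₈-+ (on∞ χ) (λ a → ∑₈ (points a))))
          (trans (∑₈-cong λ a → trans (sym (∑₈-+ (λ b → [ χ a b ]) (points a))) (trans (∑₈-cong (χ+points a)) (∑₈-const 1)))
          (∑₈-const 8))

-- Fifty points with at most seven on a line.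

module FiftyPoints where

  open Octal
  open Arcs
  open Frames
  open AffineCounts

  -- The cases k = 0, 2, 3 in coordinates: `14 + k` free cells, with the occupied directions moved
  -- to ∞, 0 and 1 in this order.
  GridTheorems : Set
  GridTheorems =
    (∀ χ → total χ ≡ 14 → (∀ m c → 1 ≤ on χ m c) → (∀ a → 1 ≤ on∞ χ a) → ⊥) ×
    (∀ χ → total χ ≡ 16 → (∀ m c → 1 ≤ on χ m c) → (∀ a → 2 ≤ on∞ χ a) → (∀ c → 2 ≤ on χ 𝟘 c) → ⊥) ×
    (∀ χ → total χ ≡ 17 → (∀ m c → 1 ≤ on χ m c) → (∀ a → 2 ≤ on∞ χ a) → (∀ c → 2 ≤ on χ 𝟘 c) → (∀ c → 2 ≤ on χ 𝟙 c) → ⊥)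

  module NoFifty (grids : GridTheorems) {n} (p : Fin n → Triple) (n≡50 : n ≡ 50)
    (k≤7 : ∀ f → f ≢ 𝟎 → Points.k p f ≤ 7) where

    open Points p
    open Bounded 7 k≤7

    meet≤1 : ∀ g h → h ≢ 𝟎 → (∀ a → g ⊞ a ⊠ h ≢ 𝟎) → meet g h ≤ 1
    meet≤1 g h h≢𝟎 g+ah≢𝟎 = m≤1 50 63 n≡50 (ℕₚ.m≤m+n 64 2) (pencil≤ g h h≢𝟎 g+ah≢𝟎)

    p≢𝟎 : ∀ i → p i ≢ 𝟎
    p≢𝟎 = nonzero (large n≡50)
      where
      large : ∀ {n} → n ≡ 50 → 73 * 7 < n * 9 + 64
      large refl = ℕₚ.<ᵇ⇒< 511 514 _

    open Simple p≢𝟎 meet≤1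

    -- Takes the values 0, 2, 2, 0 at 4, 5, 6, 7, the arguments to which it is applied below; there
    -- the truncated subtractions are exact.
    φ : ℕ → ℕ
    φ k = (7 ∸ k) * (k ∸ 4)

    -- With e = 7 - k this is ∑ e (3 - e) over the lines; it is small globally, but positive at every point,
    -- since there the e sum to 5, which is not divisible by 3.
    light-line : ¬ (∀ f → f ≢ 𝟎 → 4 ≤ k f)
    light-line 4≤k = numeric n≡50 n≤6∑φ ∑φ≤
      where
      small : ∀ {ℓ} {P : ℕ → Set ℓ} → P 4 → P 5 → P 6 → P 7 → ∀ k → 4 ≤ k → k ≤ 7 → P k
      small p₄ p₅ p₆ p₇ 4 _ _ = p₄
      small p₄ p₅ p₆ p₇ 5 _ _ = p₅
      small p₄ p₅ p₆ p₇ 6 _ _ = p₆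
      small p₄ p₅ p₆ p₇ 7 _ _ = p₇
      small p₄ p₅ p₆ p₇ 1 (s≤s ()) _
      small p₄ p₅ p₆ p₇ 2 (s≤s (s≤s ())) _
      small p₄ p₅ p₆ p₇ 3 (s≤s (s≤s (s≤s ()))) _
      small p₄ p₅ p₆ p₇ (suc (suc (suc (suc (suc (suc (suc (suc k)))))))) _ (s≤s (s≤s (s≤s (s≤s (s≤s (s≤s (s≤s ())))))))
      -- If `φ` vanished on all nine lines through a point, every `k` there would be 4 or 7, that is
      -- `1 + 3 * third k`, and the total 58 would be 9 plus a multiple of 3.
      third : ℕ → ℕ
      third k = if k ≡ᵇ 7 then 2 else 1
      third-correct : ∀ k → 4 ≤ k → k ≤ 7 → φ k ≤ 0 → k ≡ 1 + 3 * third k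
      third-correct = small (λ _ → refl) (λ ()) (λ ()) (λ _ → refl)
      49≢3m : ∀ m → 3 * m ≢ 49
      49≢3m m eq with m ℕₚ.≤? 16
      ... | yes m≤16 = ℕₚ.<⇒≱ (ℕₚ.n<1+n 48) (subst (_≤ 48) eq (ℕₚ.*-monoʳ-≤ 3 m≤16))
      ... | no  m≰16 = ℕₚ.<⇒≱ (ℕₚ.m≤m+n 50 1) (subst (51 ≤_) eq (ℕₚ.*-monoʳ-≤ 3 (ℕₚ.≰⇒> m≰16)))
      at-point : ∀ i → 1 ≤ ∑ₗ (λ f → [ zero? (f ∙ p i) ] * φ (k f))
      at-point i = subst (1 ≤_) (sym (through (φ ∘ k))) (ℕₚ.≮⇒≥ λ lt →
        49≢3m (∑₈ (λ a → third (k (g ⊞ a ⊠ h))) + third (k h)) (ℕₚ.+-cancelˡ-≡ 9 _ _ (sum≡ (ℕₚ.<⇒≤pred lt))))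
        where
        open Pencil (pencilAt i)
        sum≡ : ∑₈ (λ a → φ (k (g ⊞ a ⊠ h))) + φ (k h) ≤ 0 →
          9 + 3 * (∑₈ (λ a → third (k (g ⊞ a ⊠ h))) + third (k h)) ≡ 9 + 49
        sum≡ le = begin
          9 + 3 * (t + third (k h))          ≡⟨ solve 2
              (λ t s → con 9 :+ con 3 :* (t :+ s) := con 8 :+ con 3 :* t :+ (con 1 :+ con 3 :* s)) refl t (third (k h)) ⟩
          8 + 3 * t + (1 + 3 * third (k h))  ≡⟨ cong₂ _+_
              (trans (∑₈-+ (λ _ → 1) (λ a → 3 * third (k (g ⊞ a ⊠ h))))
              (cong₂ _+_ (∑₈-const 1) (∑₈-* 3 (λ a → third (k (g ⊞ a ⊠ h))))))
                                                  (third-correct (k h) (4≤k h h≢𝟎) (k≤7 h h≢𝟎)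
                                                      (ℕₚ.m+n≤o⇒n≤o (∑₈ (λ a → φ (k (g ⊞ a ⊠ h)))) le)) ⟨
          ∑₈ (λ a → 1 + 3 * third (k (g ⊞ a ⊠ h))) + k h  ≡⟨ cong (_+ k h)
              (∑₈-cong λ a → third-correct (k (g ⊞ a ⊠ h)) (4≤k (g ⊞ a ⊠ h) (g+ah≢𝟎 a)) (k≤7 (g ⊞ a ⊠ h) (g+ah≢𝟎 a))
                                                  (ℕₚ.≤-trans (term≤∑₈ (λ a → φ (k (g ⊞ a ⊠ h))) a) (ℕₚ.m+n≤o⇒m≤o _ le))) ⟨
          ∑₈ (λ a → k (g ⊞ a ⊠ h)) + k h     ≡⟨ pencilAt-sum i ⟩
          n + 8                              ≡⟨ cong (_+ 8) n≡50 ⟩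
          58                                 ∎
          where
          open ≡-Reasoning
          open +-*-Solver
          t = ∑₈ (λ a → third (k (g ⊞ a ⊠ h)))
      -- Every point lies on a line with `φ` positive, and such a line has 5 or 6 points.
      n≤6∑φ : n ≤ 6 * ∑ₗ (φ ∘ k)
      n≤6∑φ = begin
        n                                                      ≡⟨ trans (sum-const n 1) (ℕₚ.*-identityʳ n) ⟨
        sum {n} (λ _ → 1)                                      ≤⟨ sum-mono {n} at-point ⟩
        sum (λ i → ∑ₗ (λ f → [ zero? (f ∙ p i) ] * φ (k f)))   ≡⟨ weighted (φ ∘ k) ⟩
        ∑ₗ (λ f → k f * φ (k f))                               ≤⟨ ∑ₗ-mono
            (λ f f≢𝟎 → small {P = λ k → k * φ k ≤ 6 * φ k} (ℕₚ.≤-refl) (ℕₚ.<ᵇ⇒< 9 12 _) (ℕₚ.≤-refl) (ℕₚ.≤-refl) (k f)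
            (4≤k f f≢𝟎) (k≤7 f f≢𝟎)) ⟩
        ∑ₗ (λ f → 6 * φ (k f))                                 ≡⟨ ∑ₗ-* 6 (φ ∘ k) ⟩
        6 * ∑ₗ (φ ∘ k)                                         ∎
        where open ℕₚ.≤-Reasoning
      -- From 4 to 7, `φ k + k * k + 28` equals `11 * k`, so the moments bound the sum of `φ` by
      -- 4950 - 2900 - 2044 = 6.
      ∑φ≤ : ∑ₗ (φ ∘ k) + n * (n + 8) + 73 * 28 ≤ 11 * (n * 9)
      ∑φ≤ = begin
        ∑ₗ (φ ∘ k) + n * (n + 8) + 73 * 28            ≡⟨ cong₂ (λ s t → ∑ₗ (φ ∘ k) + s + t) ∑ₗ-k² (∑ₗ-const 28) ⟨
        ∑ₗ (φ ∘ k) + ∑ₗ (λ f → k f * k f) + ∑ₗ (λ _ → 28)  ≡⟨ cong (_+ ∑ₗ (λ _ → 28)) (∑ₗ-+ (φ ∘ k) (λ f → k f * k f)) ⟨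
        ∑ₗ (λ f → φ (k f) + k f * k f) + ∑ₗ (λ _ → 28)     ≡⟨ ∑ₗ-+ (λ f → φ (k f) + k f * k f) (λ _ → 28) ⟨
        ∑ₗ (λ f → φ (k f) + k f * k f + 28)           ≤⟨ ∑ₗ-mono
            (λ f f≢𝟎 → small {P = λ k → φ k + k * k + 28 ≤ 11 * k} ℕₚ.≤-refl ℕₚ.≤-refl ℕₚ.≤-refl ℕₚ.≤-refl (k f) (4≤k f f≢𝟎)
            (k≤7 f f≢𝟎)) ⟩
        ∑ₗ (λ f → 11 * k f)                           ≡⟨ trans (∑ₗ-* 11 k) (cong (11 *_) ∑ₗ-k) ⟩
        11 * (n * 9)                                  ∎
        where open ℕₚ.≤-Reasoning
      numeric : ∀ {n m} → n ≡ 50 → n ≤ 6 * m → m + n * (n + 8) + 73 * 28 ≤ 11 * (n * 9) → ⊥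
      -- The 50 points would number at most 6 · 6 = 36.
      numeric {m = m} refl le le′ = ℕₚ.<⇒≱ (ℕₚ.m≤m+n 37 13) (ℕₚ.≤-trans le (ℕₚ.*-monoʳ-≤ 6 m≤6))
        where
        m≤6 : m ≤ 6
        m≤6 = ℕₚ.+-cancelʳ-≤ 4944 m 6 (subst (_≤ 4950) (ℕₚ.+-assoc m 2900 2044) le′)

    module A {f} (R : Frame f) = Affine p p≢𝟎 meet≤1 k≤7 R

    total≡ : ∀ {f} (R : Frame f) → total (A.χ R) ≡ 14 + k f
    total≡ {f} R = ℕₚ.+-cancelʳ-≡ 50 _ _ (begin
      total (A.χ R) + 50    ≡⟨ cong (total (A.χ R) +_) n≡50 ⟨
      total (A.χ R) + n     ≡⟨ A.total-count R ⟩
      64 + k f              ≡⟨ solve 1 (λ k → con 64 :+ k := con 14 :+ k :+ con 50) refl (k f) ⟩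
      14 + k f + 50         ∎)
      where
      open ≡-Reasoning
      open +-*-Solver

    at-infinity∞≤1 : ∀ {f} (R : Frame f) → A.at-infinity∞ R ≤ 1
    at-infinity∞≤1 {f} R = meet≤1 u f f≢𝟎 vertical≢𝟎
      where open Frame R

    at-infinity≤1 : ∀ {f} (R : Frame f) m → A.at-infinity R m ≤ 1
    at-infinity≤1 {f} R m = meet≤1 (slope m) f f≢𝟎 (line≢𝟎 m)
      where open Frame R

    private
      𝟘⊗-drop : ∀ x y → x ⊕ 𝟘 ⊗ y ≡ x
      𝟘⊗-drop x y = trans (cong (x ⊕_) (⊗-zeroˡ y)) (⊕-identityʳ x)

      𝟙⊗-swap : ∀ x y → x ⊕ 𝟙 ⊗ y ≡ y ⊕ x
      𝟙⊗-swap x y = trans (cong (x ⊕_) (⊗-identityˡ y)) (⊕-comm x y)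

    slope-𝟘 : ∀ {f} (R : Frame f) y → Frame.slope R 𝟘 ∙ y ≡ Frame.v R ∙ y
    slope-𝟘 R y = trans (⊞⊠-∙ v 𝟘 u y) (𝟘⊗-drop (v ∙ y) (u ∙ y))
      where open Frame R

    TwoSlopes : Triple → Set
    TwoSlopes f = Σ[ R ∈ Frame f ] 1 ≤ A.at-infinity∞ R × 1 ≤ A.at-infinity R 𝟘

    -- If direction ∞ is occupied, a shear moves a second occupied direction to slope 0. Otherwise
    -- two finite occupied slopes are moved to ∞ and 0; their difference is the determinant.
    twoSlopes : ∀ {f} → f ≢ 𝟎 → 2 ≤ k f → TwoSlopes f
    twoSlopes {f} f≢𝟎 2≤k with 1 ℕₚ.≤? A.at-infinity∞ R
      where R = standardFrame f f≢𝟎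
    ... | yes 1≤I∞ = use (changeFrame R 𝟙 𝟘 m 𝟙 det≢𝟘)
      where
      R = standardFrame f f≢𝟎
      open Frame R
      found : ∃[ m ] 1 ≤ A.at-infinity R m
      found = ∑₈≥1⇒∃ (A.at-infinity R)
          (ℕₚ.+-cancelʳ-≤ 1 1 _ (ℕₚ.≤-trans 2≤k (ℕₚ.≤-trans (ℕₚ.≤-reflexive (sym (A.slopes-count R)))
        (ℕₚ.+-monoʳ-≤ (∑₈ (A.at-infinity R)) (at-infinity∞≤1 R)))))
      m = proj₁ found
      det≢𝟘 : 𝟙 ⊗ 𝟙 ⊕ m ⊗ 𝟘 ≢ 𝟘
      det≢𝟘 eq = contradiction (trans (sym (cong (𝟙 ⊕_) (⊗-zeroʳ m))) eq) (λ ())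
      use : Σ[ R′ ∈ Frame f ] (∀ y → Frame.u R′ ∙ y ≡ 𝟙 ⊗ u ∙ y ⊕ 𝟘 ⊗ v ∙ y) ×
          (∀ y → Frame.v R′ ∙ y ≡ m ⊗ u ∙ y ⊕ 𝟙 ⊗ v ∙ y) → TwoSlopes f
      use (R′ , u′∙ , v′∙) = R′ ,
        subst (1 ≤_) (meet-cong u (Frame.u R′) f (λ y → cong zero? (sym (trans (u′∙ y)
          (trans (𝟘⊗-drop (𝟙 ⊗ u ∙ y) (v ∙ y)) (⊗-identityˡ (u ∙ y))))))) 1≤I∞ ,
        subst (1 ≤_) (meet-cong (slope m) (Frame.slope R′ 𝟘) f (λ y → cong zero? (trans (⊞⊠-∙ v m u y)
          (sym (trans (slope-𝟘 R′ y) (trans (v′∙ y) (𝟙⊗-swap (m ⊗ u ∙ y) (v ∙ y)))))))) (proj₂ found)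
    ... | no 1≰I∞ = use (changeFrame R m₁ 𝟙 m₂ 𝟙 det≢𝟘)
      where
      R = standardFrame f f≢𝟎
      open Frame R
      2≤∑ : 2 ≤ ∑₈ (A.at-infinity R)
      2≤∑ = ℕₚ.≤-trans 2≤k (ℕₚ.≤-reflexive
          (trans (sym (A.slopes-count R))
          (trans (cong (∑₈ (A.at-infinity R) +_) (ℕₚ.n<1⇒n≡0 (ℕₚ.≰⇒> 1≰I∞))) (ℕₚ.+-identityʳ (∑₈ (A.at-infinity R))))))
      found₁ : ∃[ m ] 1 ≤ A.at-infinity R m
      found₁ = ∑₈≥1⇒∃ (A.at-infinity R) (ℕₚ.≤-trans (s≤s z≤n) 2≤∑)
      m₁ = proj₁ found₁
      found₂ : ∃[ m ] (m ⊕ m₁ ≢ 𝟘) × 1 ≤ A.at-infinity R m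
      found₂ = ∑₈≥2⇒∃ (A.at-infinity R) m₁ (at-infinity≤1 R m₁) 2≤∑
      m₂ = proj₁ found₂
      det≢𝟘 : m₁ ⊗ 𝟙 ⊕ m₂ ⊗ 𝟙 ≢ 𝟘
      det≢𝟘 eq = proj₁ (proj₂ found₂) (trans (⊕-comm m₂ m₁) (trans (sym (cong₂ _⊕_ (⊗-identityʳ m₁) (⊗-identityʳ m₂))) eq))
      use : Σ[ R′ ∈ Frame f ] (∀ y → Frame.u R′ ∙ y ≡ m₁ ⊗ u ∙ y ⊕ 𝟙 ⊗ v ∙ y) ×
          (∀ y → Frame.v R′ ∙ y ≡ m₂ ⊗ u ∙ y ⊕ 𝟙 ⊗ v ∙ y) → TwoSlopes f
      use (R′ , u′∙ , v′∙) = R′ ,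
        subst (1 ≤_) (meet-cong (slope m₁) (Frame.u R′) f (λ y → cong zero? (trans (⊞⊠-∙ v m₁ u y)
          (sym (trans (u′∙ y) (𝟙⊗-swap (m₁ ⊗ u ∙ y) (v ∙ y))))))) (proj₂ found₁) ,
        subst (1 ≤_) (meet-cong (slope m₂) (Frame.slope R′ 𝟘) f (λ y → cong zero? (trans (⊞⊠-∙ v m₂ u y)
          (sym (trans (slope-𝟘 R′ y) (trans (v′∙ y) (𝟙⊗-swap (m₂ ⊗ u ∙ y) (v ∙ y)))))))) (proj₂ (proj₂ found₂))

    ThreeSlopes : Triple → Set
    ThreeSlopes f = Σ[ R ∈ Frame f ] 1 ≤ A.at-infinity∞ R × 1 ≤ A.at-infinity R 𝟘 × 1 ≤ A.at-infinity R 𝟙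

    -- Scaling `u` by a third occupied slope `m` turns slope `m` into 1 and fixes 0 and ∞.
    threeSlopes : ∀ {f} → 3 ≤ k f → TwoSlopes f → ThreeSlopes f
    threeSlopes {f} 3≤k (R , 1≤I∞ , 1≤I𝟘) = use (changeFrame R m 𝟘 𝟘 𝟙 det≢𝟘)
      where
      open Frame R
      found : ∃[ m ] (m ⊕ 𝟘 ≢ 𝟘) × 1 ≤ A.at-infinity R m
      found = ∑₈≥2⇒∃ (A.at-infinity R) 𝟘 (at-infinity≤1 R 𝟘) (ℕₚ.+-cancelʳ-≤ 1 2 _ (ℕₚ.≤-trans 3≤k
        (ℕₚ.≤-trans (ℕₚ.≤-reflexive (sym (A.slopes-count R))) (ℕₚ.+-monoʳ-≤ (∑₈ (A.at-infinity R)) (at-infinity∞≤1 R)))))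
      m = proj₁ found
      m≢𝟘 : m ≢ 𝟘
      m≢𝟘 eq = proj₁ (proj₂ found) (trans (⊕-identityʳ m) eq)
      det≢𝟘 : m ⊗ 𝟙 ⊕ 𝟘 ⊗ 𝟘 ≢ 𝟘
      det≢𝟘 eq = m≢𝟘 (trans (sym (trans (⊕-identityʳ (m ⊗ 𝟙)) (⊗-identityʳ m))) eq)
      zero?-⊗ : ∀ m x → m ≢ 𝟘 → zero? x ≡ zero? (m ⊗ x)
      zero?-⊗ = from-yes (∀₈? λ m → ∀₈? λ x → ¬? (m ≟ 𝟘) →-dec (zero? x Boolₚ.≟ zero? (m ⊗ x)))
      use : Σ[ R′ ∈ Frame f ] (∀ y → Frame.u R′ ∙ y ≡ m ⊗ u ∙ y ⊕ 𝟘 ⊗ v ∙ y) ×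
          (∀ y → Frame.v R′ ∙ y ≡ 𝟘 ⊗ u ∙ y ⊕ 𝟙 ⊗ v ∙ y) → ThreeSlopes f
      use (R′ , u′∙ , v′∙) = R′ ,
        subst (1 ≤_) (meet-cong u (Frame.u R′) f (λ y → trans (zero?-⊗ m (u ∙ y) m≢𝟘) (cong zero? (sym (u′≡ y))))) 1≤I∞ ,
        subst (1 ≤_) (meet-cong (slope 𝟘) (Frame.slope R′ 𝟘) f
            (λ y → cong zero? (trans (slope-𝟘 R y) (sym (trans (slope-𝟘 R′ y) (v′≡ y)))))) 1≤I𝟘 ,
        subst (1 ≤_) (meet-cong (slope m) (Frame.slope R′ 𝟙) f (λ y → cong zero? (trans (⊞⊠-∙ v m u y)
          (sym (trans (Frame.⊞⊠-∙ R′ (Frame.v R′) 𝟙 (Frame.u R′) y)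
              (cong₂ _⊕_ (v′≡ y) (trans (⊗-identityˡ (Frame.u R′ ∙ y)) (u′≡ y)))))))) (proj₂ (proj₂ found))
        where
        u′≡ : ∀ y → Frame.u R′ ∙ y ≡ m ⊗ u ∙ y
        u′≡ y = trans (u′∙ y) (𝟘⊗-drop (m ⊗ u ∙ y) (v ∙ y))
        v′≡ : ∀ y → Frame.v R′ ∙ y ≡ v ∙ y
        v′≡ y = trans (v′∙ y) (trans (𝟙⊗-swap (𝟘 ⊗ u ∙ y) (v ∙ y)) (𝟘⊗-drop (v ∙ y) (u ∙ y)))

    private
      2≤ : ∀ {i s} → 1 ≤ i → 1 + i ≤ s → 2 ≤ s
      2≤ 1≤i = ℕₚ.≤-trans (s≤s 1≤i)

      1≤ : ∀ {i s} → 1 + i ≤ s → 1 ≤ s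
      1≤ = ℕₚ.≤-trans (s≤s z≤n)

      16≤ : ∀ (G : F₈ → ℕ) → (∀ x → 2 ≤ G x) → 16 ≤ ∑₈ G
      16≤ G 2≤G = subst (_≤ ∑₈ G) (∑₈-const 2) (∑₈-mono 2≤G)

      total≢15 : ∀ {f} (R : Frame f) → k f ≡ 1 → 16 ≤ total (A.χ R) → ⊥
      total≢15 R k≡1 le = ℕₚ.<⇒≱ (ℕₚ.n<1+n 15) (subst (16 ≤_) (trans (total≡ R) (cong (14 +_) k≡1)) le)

    no-line-0 : ∀ {f} → Frame f → k f ≢ 0
    no-line-0 R k≡0 = proj₁ grids (A.χ R) (trans (total≡ R) (cong (14 +_) k≡0)) (λ m c → 1≤ (A.on≥ R m c))
        (λ a → 1≤ (A.on∞≥ R a))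

    -- One direction is occupied, and its eight parallel lines need two free cells each: 16, against
    -- a total of 15.
    no-line-1 : ∀ {f} → Frame f → k f ≢ 1
    no-line-1 R k≡1 with 1 ℕₚ.≤? A.at-infinity∞ R
    ... | yes 1≤I∞ = total≢15 R k≡1 (16≤ (on∞ (A.χ R)) (λ a → 2≤ 1≤I∞ (A.on∞≥ R a)))
    ... | no  1≰I∞ = total≢15 R k≡1
        (subst (16 ≤_) (∑-on (A.χ R) (proj₁ found))
        (16≤ (on (A.χ R) (proj₁ found)) (λ c → 2≤ (proj₂ found) (A.on≥ R (proj₁ found) c))))
      where
      found : ∃[ m ] 1 ≤ A.at-infinity R m
      found = ∑₈≥1⇒∃ (A.at-infinity R) (ℕₚ.≤-reflexive (sym (begin
        ∑₈ (A.at-infinity R)                       ≡⟨ ℕₚ.+-identityʳ _ ⟨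
        ∑₈ (A.at-infinity R) + 0                   ≡⟨ cong (∑₈ (A.at-infinity R) +_) (ℕₚ.n<1⇒n≡0 (ℕₚ.≰⇒> 1≰I∞)) ⟨
        ∑₈ (A.at-infinity R) + A.at-infinity∞ R    ≡⟨ A.slopes-count R ⟩
        k _                                        ≡⟨ k≡1 ⟩
        1                                          ∎)))
        where open ≡-Reasoning

    no-line-2 : ∀ {f} → TwoSlopes f → k f ≢ 2
    no-line-2 (R , 1≤I∞ , 1≤I𝟘) k≡2 = proj₁ (proj₂ grids) (A.χ R) (trans (total≡ R) (cong (14 +_) k≡2))
      (λ m c → 1≤ (A.on≥ R m c)) (λ a → 2≤ 1≤I∞ (A.on∞≥ R a)) (λ c → 2≤ 1≤I𝟘 (A.on≥ R 𝟘 c))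

    no-line-3 : ∀ {f} → ThreeSlopes f → k f ≢ 3
    no-line-3 (R , 1≤I∞ , 1≤I𝟘 , 1≤I𝟙) k≡3 = proj₂ (proj₂ grids) (A.χ R) (trans (total≡ R) (cong (14 +_) k≡3))
      (λ m c → 1≤ (A.on≥ R m c)) (λ a → 2≤ 1≤I∞ (A.on∞≥ R a)) (λ c → 2≤ 1≤I𝟘 (A.on≥ R 𝟘 c)) (λ c → 2≤ 1≤I𝟙 (A.on≥ R 𝟙 c))

    no-light-line : ∀ f → f ≢ 𝟎 → 4 ≤ k f
    no-light-line f f≢𝟎 = ℕₚ.≮⇒≥ λ lt → go (k f) refl lt
      where
      go : ∀ j → k f ≡ j → ¬ j < 4
      go 0 eq _ = no-line-0 (standardFrame f f≢𝟎) eq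
      go 1 eq _ = no-line-1 (standardFrame f f≢𝟎) eq
      go 2 eq _ = no-line-2 (twoSlopes f≢𝟎 (ℕₚ.≤-reflexive (sym eq))) eq
      go 3 eq _ = no-line-3 (threeSlopes (ℕₚ.≤-reflexive (sym eq))
          (twoSlopes f≢𝟎 (ℕₚ.≤-trans (ℕₚ.n≤1+n 2) (ℕₚ.≤-reflexive (sym eq))))) eq
      go (suc (suc (suc (suc j)))) _ (s≤s (s≤s (s≤s (s≤s ()))))

    impossible : ⊥
    impossible = light-line no-light-line

-- Jamison's bound for blocking sets of AG(2,8).

module Jamison where

  open Octal
  open Frames

  opaque

    ⨁₈ : (F₈ → F₈) → F₈
    ⨁₈ G = F₈Σ.sum (G ∘ element)

    ⨁₈-cong : ∀ {G H} → (∀ x → G x ≡ H x) → ⨁₈ G ≡ ⨁₈ H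
    ⨁₈-cong G≗H = F₈Σ.sum-cong-≗ {8} (G≗H ∘ element)

    ⨁₈-⊕ : ∀ G H → ⨁₈ (λ x → G x ⊕ H x) ≡ ⨁₈ G ⊕ ⨁₈ H
    ⨁₈-⊕ G H = F₈Σ.∑-distrib-+ {8} (G ∘ element) (H ∘ element)

    ⨁₈-⊗ : ∀ c G → ⨁₈ (λ x → c ⊗ G x) ≡ c ⊗ ⨁₈ G
    ⨁₈-⊗ c G = sym (F₈Σ.*-distribˡ-sum {8} c (G ∘ element))

    ⨁₈-swap : ∀ (G : F₈ → F₈ → F₈) → ⨁₈ (λ x → ⨁₈ (G x)) ≡ ⨁₈ (λ y → ⨁₈ (λ x → G x y))
    ⨁₈-swap G = F₈Σ.∑-comm {8} {8} (λ i j → G (element i) (element j))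

  power : F₈ → ℕ → F₈
  power x zero    = 𝟙
  power x (suc i) = x ⊗ power x i

  opaque
    unfolding ⨁₈

    -- Scaling by a generator of the multiplicative group multiplies a power sum by a factor other
    -- than 1 unless 7 divides `i`. For `i` = 0 the sum is eight times `𝟙`, as `power 𝟘 0` is `𝟙`.
    ⨁₈-power : ∀ {i} → i < 7 → ⨁₈ (λ x → power x i) ≡ 𝟘
    ⨁₈-power = from-yes (ℕₚ.allUpTo? (λ i → ⨁₈ (λ x → power x i) ≟ 𝟘) 7)

    ⨁₈-origin : ⨁₈ (λ u → ⨁₈ (λ v → if zero? u ∧ zero? v then 𝟙 else 𝟘)) ≡ 𝟙
    ⨁₈-origin = refl

  ⨁₈-zero : ⨁₈ (λ _ → 𝟘) ≡ 𝟘
  ⨁₈-zero = trans (⨁₈-⊗ 𝟘 (λ _ → 𝟘)) (⊗-zeroˡ (⨁₈ (λ _ → 𝟘)))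

  -- For a fixed nonzero pair `u`, `v` the zeros form a line missing the origin; for fixed `a`, `b`
  -- it is a polynomial of degree at most one in the dual coordinates.
  form : F₈ → F₈ → F₈ × F₈ → F₈
  form u v (a , b) = 𝟙 ⊕ u ⊗ a ⊕ v ⊗ b

  forms : List (F₈ × F₈) → F₈ → F₈ → F₈
  forms []       u v = 𝟙
  forms (P ∷ Ps) u v = form u v P ⊗ forms Ps u v

  moment : ℕ → ℕ → List (F₈ × F₈) → F₈
  moment i j Ps = ⨁₈ (λ u → ⨁₈ (λ v → power u i ⊗ power v j ⊗ forms Ps u v))

  -- A polynomial of degree less than 14 in u, v sums to zero over F₈².
  moment-zero : ∀ Ps i j → length Ps + i + j ≤ 13 → moment i j Ps ≡ 𝟘
  -- With i + j at most 13, one exponent is at most 6 and its power sum vanishes.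
  moment-zero [] i j le with j ℕₚ.<? 7
  ... | yes j<7 = trans (⨁₈-cong λ u → trans (⨁₈-cong λ v → ⊗-identityʳ (power u i ⊗ power v j))
      (trans (⨁₈-⊗ (power u i) (λ v → power v j)) (trans (cong (power u i ⊗_) (⨁₈-power j<7)) (⊗-zeroʳ (power u i))))) ⨁₈-zero
  ... | no j≮7 = trans (⨁₈-swap (λ u v → power u i ⊗ power v j ⊗ 𝟙))
      (trans (⨁₈-cong λ v → trans (⨁₈-cong λ u → trans (⊗-identityʳ (power u i ⊗ power v j)) (⊗-comm (power u i) (power v j)))
      (trans (⨁₈-⊗ (power v j) (λ u → power u i)) (trans (cong (power v j ⊗_) (⨁₈-power i<7)) (⊗-zeroʳ (power v j))))) ⨁₈-zero)
    where
    i<7 : i < 7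
    i<7 = ℕₚ.+-cancelʳ-≤ 7 (suc i) 7 (ℕₚ.≤-trans (ℕₚ.+-monoʳ-≤ (suc i) (ℕₚ.≮⇒≥ j≮7)) (s≤s le))
  moment-zero ((a , b) ∷ Ps) i j le = begin
    moment i j ((a , b) ∷ Ps)
      ≡⟨ ⨁₈-cong (λ u → ⨁₈-cong (λ v → expand a b u v (power u i) (power v j) (forms Ps u v))) ⟩
    ⨁₈ (λ u → ⨁₈ (λ v → X u v ⊕ Y u v ⊕ Z u v))
      ≡⟨ ⨁₈-cong (λ u → trans (⨁₈-⊕ (λ v → X u v ⊕ Y u v) (Z u)) (cong (_⊕ ⨁₈ (Z u)) (⨁₈-⊕ (X u) (Y u)))) ⟩
    ⨁₈ (λ u → ⨁₈ (X u) ⊕ ⨁₈ (Y u) ⊕ ⨁₈ (Z u))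
      ≡⟨ trans (⨁₈-⊕ (λ u → ⨁₈ (X u) ⊕ ⨁₈ (Y u)) (λ u → ⨁₈ (Z u)))
          (cong (_⊕ ⨁₈ (λ u → ⨁₈ (Z u))) (⨁₈-⊕ (λ u → ⨁₈ (X u)) (λ u → ⨁₈ (Y u)))) ⟩
    moment i j Ps ⊕ ⨁₈ (λ u → ⨁₈ (Y u)) ⊕ ⨁₈ (λ u → ⨁₈ (Z u))
      ≡⟨ cong₂ _⊕_ (cong₂ _⊕_ (moment-zero Ps i j (ℕₚ.<⇒≤ le)) (scaled a (suc i) j le₁)) (scaled b i (suc j) le₂) ⟩
    𝟘 ∎
    where
    open ≡-Reasoning
    X Y Z : F₈ → F₈ → F₈
    X u v = power u i ⊗ power v j ⊗ forms Ps u v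
    Y u v = a ⊗ (power u (suc i) ⊗ power v j ⊗ forms Ps u v)
    Z u v = b ⊗ (power u i ⊗ power v (suc j) ⊗ forms Ps u v)
    le₁ : length Ps + suc i + j ≤ 13
    le₁ = subst (λ t → t + j ≤ 13) (sym (ℕₚ.+-suc (length Ps) i)) le
    le₂ : length Ps + i + suc j ≤ 13
    le₂ = subst (_≤ 13) (sym (ℕₚ.+-suc (length Ps + i) j)) le
    pull : ∀ a u p q r → u ⊗ a ⊗ (p ⊗ q ⊗ r) ≡ a ⊗ (u ⊗ p ⊗ q ⊗ r)
    pull a u p q r = trans (cong (_⊗ (p ⊗ q ⊗ r)) (⊗-comm u a)) (trans (⊗-assoc a u (p ⊗ q ⊗ r))
      (cong (a ⊗_) (trans (sym (⊗-assoc u (p ⊗ q) r)) (cong (_⊗ r) (sym (⊗-assoc u p q))))))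
    distribute : ∀ w s t r → w ⊗ ((𝟙 ⊕ s ⊕ t) ⊗ r) ≡ w ⊗ r ⊕ s ⊗ (w ⊗ r) ⊕ t ⊗ (w ⊗ r)
    distribute w s t r = S.solve 4 (λ w s t r → w S.:* ((S.con 1 S.:+ s S.:+ t) S.:* r)
      S.:= w S.:* r S.:+ s S.:* (w S.:* r) S.:+ t S.:* (w S.:* r)) refl w s t r
    expand : ∀ a b u v p q r → p ⊗ q ⊗ ((𝟙 ⊕ u ⊗ a ⊕ v ⊗ b) ⊗ r) ≡ p ⊗ q ⊗ r ⊕ a ⊗ (u ⊗ p ⊗ q ⊗ r) ⊕ b ⊗ (p ⊗ (v ⊗ q) ⊗ r)
    expand a b u v p q r = trans (distribute (p ⊗ q) (u ⊗ a) (v ⊗ b) r) (cong₂ (λ s t → p ⊗ q ⊗ r ⊕ s ⊕ t) (pull a u p q r)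
      (trans (pull b v p q r) (cong (λ s → b ⊗ (s ⊗ r)) (trans (cong (_⊗ q) (⊗-comm v p)) (⊗-assoc p v q)))))
    scaled : ∀ c i j → length Ps + i + j ≤ 13 → ⨁₈ (λ u → ⨁₈ (λ v → c ⊗ (power u i ⊗ power v j ⊗ forms Ps u v))) ≡ 𝟘
    scaled c i j le = trans (⨁₈-cong λ u → ⨁₈-⊗ c (λ v → power u i ⊗ power v j ⊗ forms Ps u v))
      (trans (⨁₈-⊗ c (λ u → ⨁₈ (λ v → power u i ⊗ power v j ⊗ forms Ps u v)))
          (trans (cong (c ⊗_) (moment-zero Ps i j le)) (⊗-zeroʳ c)))

  forms-++ : ∀ Ps Qs u v → forms (Ps ++ Qs) u v ≡ forms Ps u v ⊗ forms Qs u v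
  forms-++ []       Qs u v = sym (⊗-identityˡ (forms Qs u v))
  forms-++ (P ∷ Ps) Qs u v = trans (cong (form u v P ⊗_) (forms-++ Ps Qs u v))
      (sym (⊗-assoc (form u v P) (forms Ps u v) (forms Qs u v)))

  concat : ∀ {n} → (Fin n → List (F₈ × F₈)) → List (F₈ × F₈)
  concat {zero}  L = []
  concat {suc n} L = L zero ++ concat (L ∘ suc)

  length-concat : ∀ {n} (L : Fin n → List (F₈ × F₈)) → length (concat L) ≡ ℕΣ.sum (length ∘ L)
  length-concat {zero}  L = refl
  length-concat {suc n} L = trans (Listₚ.length-++ (L zero)) (cong (length (L zero) +_) (length-concat (L ∘ suc)))

  forms-concat : ∀ {n} (L : Fin n → List (F₈ × F₈)) i u v → forms (L i) u v ≡ 𝟘 → forms (concat L) u v ≡ 𝟘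
  forms-concat {suc n} L zero    u v eq = trans (forms-++ (L zero) (concat (L ∘ suc)) u v)
      (trans (cong (_⊗ forms (concat (L ∘ suc)) u v) eq) (⊗-zeroˡ (forms (concat (L ∘ suc)) u v)))
  forms-concat {suc n} L (suc i) u v eq = trans (forms-++ (L zero) (concat (L ∘ suc)) u v)
      (trans (cong (forms (L zero) u v ⊗_) (forms-concat (L ∘ suc) i u v eq)) (⊗-zeroʳ (forms (L zero) u v)))

  opaque
    unfolding ∑₈

    pointList : (χ : Grid) → ∃[ Ps ] length Ps ≡ total χ × (∀ a b u v → χ a b ≡ true → form u v (a , b) ≡ 𝟘 → forms Ps u v ≡ 𝟘)
    pointList χ = concat (λ i → concat (cells i)) ,
      trans (length-concat (λ i → concat (cells i))) (ℕΣ.sum-cong-≗ {8} λ i → trans (length-concat (cells i))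
        (ℕΣ.sum-cong-≗ {8} λ j → length-single (χ (element i) (element j)) (element i , element j))) ,
      λ a b u v χab eq → subst₂ (λ a b → χ a b ≡ true → form u v (a , b) ≡ 𝟘 → forms (concat (λ i → concat (cells i))) u v ≡ 𝟘)
        (proj₂ (index a)) (proj₂ (index b)) (vanish (proj₁ (index a)) (proj₁ (index b)) u v) χab eq
      where
      single : Bool → F₈ × F₈ → List (F₈ × F₈)
      single true  P = P ∷ []
      single false P = []
      length-single : ∀ b P → length (single b P) ≡ [ b ]
      length-single true  P = refl
      length-single false P = refl
      cells : Fin 8 → Fin 8 → List (F₈ × F₈)
      cells i j = single (χ (element i) (element j)) (element i , element j)
      vanish : ∀ i j u v → χ (element i) (element j) ≡ true → form u v (element i , element j) ≡ 𝟘 → forms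
          (concat (λ i → concat (cells i))) u v ≡ 𝟘
      vanish i j u v χij eq = forms-concat (λ i → concat (cells i)) i u v (forms-concat (cells i) j u v
        (trans (cong (λ b → forms (single b (element i , element j)) u v) χij)
            (trans (⊗-identityʳ (form u v (element i , element j))) eq)))

  -- Jamison's bound: with the origin moved to a point of the set, the product of the linear forms of the
  -- other points is 1 at the origin of the dual plane and 0 elsewhere, so it has degree at least 14.
  no-14-blocking : ∀ χ → total χ ≡ 14 → (∀ m c → 1 ≤ on χ m c) → (∀ a → 1 ≤ on∞ χ a) → ⊥
  no-14-blocking χ total≡14 on≥1 on∞≥1 = contradiction
    (trans (sym (moment-zero Ps 0 0 (ℕₚ.≤-reflexive (trans (ℕₚ.+-identityʳ _) (trans (ℕₚ.+-identityʳ _) length≡13)))))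
      (trans (⨁₈-cong λ u → ⨁₈-cong λ v → trans (cong (_⊗ forms Ps u v) (⊗-identityˡ 𝟙))
          (trans (⊗-identityˡ (forms Ps u v)) (value u v (zero? u ∧ zero? v) refl))) ⨁₈-origin))
    λ ()
    where
    column : ∃[ a ] 1 ≤ on∞ χ a
    column = ∑₈≥1⇒∃ (on∞ χ) (subst (1 ≤_) (sym total≡14) (s≤s z≤n))
    a₀ = proj₁ column
    origin : ∃[ b ] χ a₀ b ≡ true
    origin = ∑₈≢0⇒∃ (χ a₀) (proj₂ column)
    b₀ = proj₁ origin
    isOrigin : F₈ → F₈ → Bool
    isOrigin a b = zero? (a ⊕ a₀) ∧ zero? (b ⊕ b₀)
    χ′ shifted : Grid
    χ′ a b = χ a b ∧ not (isOrigin a b)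
    shifted a b = χ′ (a ⊕ a₀) (b ⊕ b₀)
    opaque
      unfolding ∑₈
      translation : ∀ t d → ∑₈ (λ c → [ zero? (d ⊕ (c ⊕ t)) ]) ≡ 1
      translation = from-yes (∀₈? λ t → ∀₈? λ d → ∑₈ (λ c → [ zero? (d ⊕ (c ⊕ t)) ]) ℕ.≟ 1)
    total-shifted : total shifted ≡ total χ′
    total-shifted = trans (∑₈-cong λ a → ∑₈-reindex (_⊕ b₀) (translation b₀) (λ b → [ χ′ (a ⊕ a₀) b ]))
      (∑₈-reindex (_⊕ a₀) (translation a₀) (on∞ χ′))
    total-χ : total χ ≡ 1 + total χ′
    total-χ = begin
      total χ
        ≡⟨ ∑₈-cong (λ a → ∑₈-cong (λ b → split (χ a b) (zero? (a ⊕ a₀)) (zero? (b ⊕ b₀)))) ⟩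
      ∑₈ (λ a → ∑₈ (λ b → [ zero? (a ⊕ a₀) ] * ([ zero? (b ⊕ b₀) ] * [ χ a b ]) + [ χ′ a b ]))
        ≡⟨ ∑₈-cong (λ a → trans (∑₈-+ (λ b → [ zero? (a ⊕ a₀) ] * ([ zero? (b ⊕ b₀) ] * [ χ a b ])) (λ b → [ χ′ a b ]))
             (cong (_+ on∞ χ′ a) (trans (∑₈-* [ zero? (a ⊕ a₀) ] (λ b → [ zero? (b ⊕ b₀) ] * [ χ a b ]))
                 (cong ([ zero? (a ⊕ a₀) ] *_) (∑₈-δ b₀ (λ b → [ χ a b ])))))) ⟩
      ∑₈ (λ a → [ zero? (a ⊕ a₀) ] * [ χ a b₀ ] + on∞ χ′ a)
        ≡⟨ trans (∑₈-+ (λ a → [ zero? (a ⊕ a₀) ] * [ χ a b₀ ]) (on∞ χ′))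
            (cong (_+ total χ′) (trans (∑₈-δ a₀ (λ a → [ χ a b₀ ])) (cong [_] (proj₂ origin)))) ⟩
      1 + total χ′ ∎
      where
      open ≡-Reasoning
      split : ∀ x p q → [ x ] ≡ [ p ] * ([ q ] * [ x ]) + [ x ∧ not (p ∧ q) ]
      split true  true  true  = refl
      split true  true  false = refl
      split true  false true  = refl
      split true  false false = refl
      split false true  true  = refl
      split false true  false = refl
      split false false true  = refl
      split false false false = refl
    Ps = proj₁ (pointList shifted)
    length≡13 : length Ps ≡ 13
    length≡13 = ℕₚ.suc-injective (trans (cong suc (trans (proj₁ (proj₂ (pointList shifted))) total-shifted))
        (trans (sym total-χ) total≡14))
    vanishes : ∀ u v a b → χ a b ≡ true → form u v (a ⊕ a₀ , b ⊕ b₀) ≡ 𝟘 → forms Ps u v ≡ 𝟘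
    vanishes u v a b χab eq = proj₂ (proj₂ (pointList shifted)) (a ⊕ a₀) (b ⊕ b₀) u v shifted≡true eq
      where
      involutive : ∀ x y → x ⊕ y ⊕ y ≡ x
      involutive x y = trans (⊕-assoc x y y) (trans (cong (x ⊕_) (⊕-self y)) (⊕-identityʳ x))
      form≡𝟙 : ∀ {x y} → zero? x ∧ zero? y ≡ true → form u v (x , y) ≡ 𝟙
      form≡𝟙 {x} {y} z with zero? x in zx | zero? y in zy
      ... | true | true = trans (cong₂ (λ x y → 𝟙 ⊕ u ⊗ x ⊕ v ⊗ y) (zero?-sound x zx) (zero?-sound y zy))
        (cong₂ (λ s t → 𝟙 ⊕ s ⊕ t) (⊗-zeroʳ u) (⊗-zeroʳ v))
      -- At the deleted point, the new origin, the form is `𝟙`; so a point of the set on the line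
      -- survives in `shifted`.
      not-origin : isOrigin a b ≡ false
      not-origin with isOrigin a b in o
      ... | false = refl
      ... | true  = contradiction (trans (sym (form≡𝟙 {a ⊕ a₀} {b ⊕ b₀} o)) eq) λ ()
      shifted≡true : shifted (a ⊕ a₀) (b ⊕ b₀) ≡ true
      shifted≡true = trans (cong₂ χ′ (involutive a a₀) (involutive b b₀)) (cong₂ (λ s t → s ∧ not t) χab not-origin)
    nonzero-value : ∀ u v → zero? u ∧ zero? v ≡ false → forms Ps u v ≡ 𝟘
    nonzero-value u v uv≢𝟘 with v ≟ 𝟘
    -- The zero line of the form, written in the original coordinates and solved for the second one;
    -- it has slope u / v and meets the set.
    ... | no v≢𝟘 = vanishes u v a (inv v ⊗ u ⊗ a ⊕ (inv v ⊗ (𝟙 ⊕ u ⊗ a₀) ⊕ b₀)) χab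
        (trans (cong (λ t → 𝟙 ⊕ u ⊗ (a ⊕ a₀) ⊕ v ⊗ t) (line-at u (inv v) a a₀ b₀))
        (trans (cong (𝟙 ⊕ u ⊗ (a ⊕ a₀) ⊕_) (cancel v (𝟙 ⊕ u ⊗ (a ⊕ a₀)) v≢𝟘)) (⊕-self (𝟙 ⊕ u ⊗ (a ⊕ a₀)))))
      where
      found : ∃[ a ] χ a (inv v ⊗ u ⊗ a ⊕ (inv v ⊗ (𝟙 ⊕ u ⊗ a₀) ⊕ b₀)) ≡ true
      found = ∑₈≢0⇒∃ (λ a → χ a (inv v ⊗ u ⊗ a ⊕ (inv v ⊗ (𝟙 ⊕ u ⊗ a₀) ⊕ b₀))) (on≥1 (inv v ⊗ u) (inv v ⊗ (𝟙 ⊕ u ⊗ a₀) ⊕ b₀))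
      a = proj₁ found
      χab = proj₂ found
      line-at : ∀ u i a a₀ b₀ → i ⊗ u ⊗ a ⊕ (i ⊗ (𝟙 ⊕ u ⊗ a₀) ⊕ b₀) ⊕ b₀ ≡ i ⊗ (𝟙 ⊕ u ⊗ (a ⊕ a₀))
      line-at u i a a₀ b₀ = trans (S.solve 5
          (λ u i a a₀ b₀ → i S.:* u S.:* a S.:+ (i S.:* (S.con 1 S.:+ u S.:* a₀) S.:+ b₀) S.:+ b₀
          S.:= i S.:* (S.con 1 S.:+ u S.:* (a S.:+ a₀)) S.:+ (b₀ S.:+ b₀)) refl u i a a₀ b₀)
        (trans (cong (i ⊗ (𝟙 ⊕ u ⊗ (a ⊕ a₀)) ⊕_) (⊕-self b₀)) (⊕-identityʳ (i ⊗ (𝟙 ⊕ u ⊗ (a ⊕ a₀)))))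
      cancel : ∀ v x → v ≢ 𝟘 → v ⊗ (inv v ⊗ x) ≡ x
      cancel = from-yes (∀₈? λ v → ∀₈? λ x → ¬? (v ≟ 𝟘) →-dec (v ⊗ (inv v ⊗ x)) ≟ x)
    -- For v = 0 the zero line is the vertical at 1 / u, shifted back by `a₀`.
    ... | yes refl = vanishes u 𝟘 (inv u ⊕ a₀) b χab (root u a₀ (b ⊕ b₀) u≢𝟘)
      where
      u≢𝟘 : u ≢ 𝟘
      u≢𝟘 refl = contradiction uv≢𝟘 λ ()
      found : ∃[ b ] χ (inv u ⊕ a₀) b ≡ true
      found = ∑₈≢0⇒∃ (χ (inv u ⊕ a₀)) (on∞≥1 (inv u ⊕ a₀))
      b = proj₁ found
      χab = proj₂ found
      root : ∀ u a₀ t → u ≢ 𝟘 → 𝟙 ⊕ u ⊗ (inv u ⊕ a₀ ⊕ a₀) ⊕ 𝟘 ⊗ t ≡ 𝟘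
      root = from-yes (∀₈? λ u → ∀₈? λ a₀ → ∀₈? λ t → ¬? (u ≟ 𝟘) →-dec (𝟙 ⊕ u ⊗ (inv u ⊕ a₀ ⊕ a₀) ⊕ 𝟘 ⊗ t) ≟ 𝟘)
    forms-origin : ∀ Ps → forms Ps 𝟘 𝟘 ≡ 𝟙
    forms-origin [] = refl
    forms-origin ((a , b) ∷ Ps) = trans (cong₂ _⊗_ (cong₂ (λ s t → 𝟙 ⊕ s ⊕ t) (⊗-zeroˡ a) (⊗-zeroˡ b)) (forms-origin Ps)) refl
    value : ∀ u v t → zero? u ∧ zero? v ≡ t → forms Ps u v ≡ (if t then 𝟙 else 𝟘)
    value u v false eq = nonzero-value u v eq
    value u v true  eq with zero? u in zu | zero? v in zv
    ... | true | true rewrite zero?-sound u zu | zero?-sound v zv = forms-origin Ps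

-- Backtracking search with a soundness proof.

module Search where

  open Octal

  -- The i-th entry of lines is the index, within the i-th class of constraints, of the only constraint
  -- that can involve the cell.
  record Cell : Set where
    constructor cell
    field
      code  : ℕ
      lines : List ℕ

  open Cell

  -- At least t of the listed cells are true and at least f are false. The number s of cells minus t, and
  -- the priority m derived from it, only guide the search.
  data Constraint : Set where
    satisfied : Constraint
    open-on   : (m s t f : ℕ) → List Cell → Constraint

  State : Set
  State = List (List Constraint)

  -- Priority 0 marks a conflict or a constraint whose remaining cells are all forced, so
  -- propagation precedes splitting; otherwise the fewest spare cells `s` come first. The value 99
  -- equals that of `satisfied`, so an unforced demand for false cells alone is never selected.
  constraint : ℕ → ℕ → ℕ → List Cell → Constraint
  constraint s zero      zero f≡0 = satisfied
  constraint s zero      f    cs  = open-on (if s <ᵇ suc f then 0 else 99) s 0 f cs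
  constraint s t@(suc _) f    cs  = open-on (if s <ᵇ f then 0 else s) s t f cs

  delete : ℕ → List Cell → Maybe (List Cell)
  delete x [] = nothing
  delete x (c ∷ cs) with code c ≡ᵇ x
  ... | true = just cs
  ... | false with delete x cs
  ...   | nothing = nothing
  ...   | just ds = just (c ∷ ds)

  count-down : Bool → ℕ → ℕ → ℕ → List Cell → Constraint
  count-down true  s zero    f cs = constraint (s ∸ 1) 0 f cs
  count-down true  s (suc t) f cs = constraint s t f cs
  count-down false s t       f cs = constraint (s ∸ 1) t (f ∸ 1) cs

  assign₁ : Bool → ℕ → Constraint → Constraint
  assign₁ b x satisfied = satisfied
  assign₁ b x k@(open-on m s t f cs) with delete x cs
  ... | nothing = k
  ... | just ds = count-down b s t f ds

  assign-nth : Bool → ℕ → ℕ → List Constraint → List Constraint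
  assign-nth b x i       []       = []
  assign-nth b x zero    (k ∷ ks) = assign₁ b x k ∷ ks
  assign-nth b x (suc i) (k ∷ ks) = k ∷ assign-nth b x i ks

  assign-lines : Bool → ℕ → List ℕ → State → State
  assign-lines b x (i ∷ is) (ks ∷ kss) = assign-nth b x i ks ∷ assign-lines b x is kss
  assign-lines b x _        kss        = kss

  assign : Bool → Cell → State → State
  assign b c = assign-lines b (code c) (lines c)

  priority : Constraint → ℕ
  priority satisfied           = 99
  priority (open-on m _ _ _ _) = m

  -- The continuation carries the scan into the next class; a constraint of priority 0 ends the
  -- whole scan by not calling it.
  tightest₁ : Constraint → List Constraint → (Constraint → Constraint) → Constraint
  tightest₁ k [] continue = continue k
  tightest₁ k (satisfied ∷ ks) continue = tightest₁ k ks continue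
  tightest₁ k (k′@(open-on 0 _ _ _ _) ∷ ks) continue = k′
  tightest₁ k (k′@(open-on m _ _ _ _) ∷ ks) continue = tightest₁ (if m <ᵇ priority k then k′ else k) ks continue

  tightest : Constraint → State → Constraint
  tightest k [] = k
  tightest k (ks ∷ kss) = tightest₁ k ks (λ k′ → tightest k′ kss)

  -- The number is fuel, one unit per assigned cell. The value `false`, also returned when fuel or
  -- eligible constraints run out, claims nothing.
  refute : ℕ → State → Bool
  branch : ℕ → State → Constraint → Bool
  refute zero    st = false
  refute (suc n) st = branch n st (tightest satisfied st)
  branch n st satisfied = false
  branch n st (open-on _ _ t f cs) with length cs <ᵇ t + f
  ... | true = true
  branch n st (open-on _ _ t f []) | false = false
  -- Here every remaining cell is needed; if all demands are of one kind, the value of the cell is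
  -- forced.
  branch n st (open-on _ _ t f (c ∷ cs)) | false with length (c ∷ cs) ≡ᵇ t + f
  branch n st (open-on _ _ t zero (c ∷ cs)) | false | true = refute n (assign true c st)
  branch n st (open-on _ _ zero f@(suc _) (c ∷ cs)) | false | true = refute n (assign false c st)
  branch n st (open-on _ _ t f (c ∷ cs)) | false | _ = refute n (assign true c st) ∧ refute n (assign false c st)

  -- A data type, so that comparing refutations does not run the search.
  data Refuted (st : State) : Set where
    refuted-by : refute 64 st ≡ true → Refuted st

  module Soundness (ψ : ℕ → Bool) where

    trues falses : List Cell → ℕ
    trues []       = 0
    trues (c ∷ cs) = [ ψ (code c) ] + trues cs
    falses []       = 0
    falses (c ∷ cs) = [ not (ψ (code c)) ] + falses cs

    Holds : Constraint → Set
    Holds satisfied            = ⊤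
    Holds (open-on _ _ t f cs) = t ≤ trues cs × f ≤ falses cs

    Satisfies : State → Set
    Satisfies = All (All Holds)

    trues+falses : ∀ cs → trues cs + falses cs ≡ length cs
    trues+falses [] = refl
    trues+falses (c ∷ cs) with ψ (code c)
    ... | true  = cong suc (trues+falses cs)
    ... | false = trans (ℕₚ.+-suc (trues cs) (falses cs)) (cong suc (trues+falses cs))

    constraint-holds : ∀ s t f cs → t ≤ trues cs → f ≤ falses cs → Holds (constraint s t f cs)
    constraint-holds s zero    zero    cs t≤ f≤ = tt
    constraint-holds s zero    (suc f) cs t≤ f≤ = t≤ , f≤
    constraint-holds s (suc t) f       cs t≤ f≤ = t≤ , f≤

    delete-count : ∀ x cs {ds} → delete x cs ≡ just ds →
      trues cs ≡ [ ψ x ] + trues ds × falses cs ≡ [ not (ψ x) ] + falses ds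
    delete-count x (c ∷ cs) eq with code c ≡ᵇ x in code≡
    delete-count x (c ∷ cs) refl | true rewrite ℕₚ.≡ᵇ⇒≡ (code c) x (subst T (sym code≡) tt) = refl , refl
    ... | false with delete x cs in del
    delete-count x (c ∷ cs) refl | false | just ds with eqt , eqf ← delete-count x cs del =
      trans (cong ([ ψ (code c) ] +_) eqt) (swap [ ψ (code c) ] [ ψ x ] (trues ds)) ,
      trans (cong ([ not (ψ (code c)) ] +_) eqf) (swap [ not (ψ (code c)) ] [ not (ψ x) ] (falses ds))
      where
      swap : ∀ a b c → a + (b + c) ≡ b + (a + c)
      swap a b c = trans (sym (ℕₚ.+-assoc a b c)) (trans (cong (_+ c) (ℕₚ.+-comm a b)) (ℕₚ.+-assoc b a c))

    count-down-holds : ∀ b s t f ds → t ≤ [ b ] + trues ds → f ≤ [ not b ] + falses ds → Holds (count-down b s t f ds)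
    count-down-holds true  s zero    f ds t≤ f≤ = constraint-holds (s ∸ 1) 0 f ds z≤n f≤
    count-down-holds true  s (suc t) f ds t≤ f≤ = constraint-holds s t f ds (ℕₚ.≤-pred t≤) f≤
    count-down-holds false s t       f ds t≤ f≤ = constraint-holds (s ∸ 1) t (f ∸ 1) ds t≤ (ℕₚ.∸-monoˡ-≤ 1 f≤)

    assign₁-holds : ∀ {b x} k → ψ x ≡ b → Holds k → Holds (assign₁ b x k)
    assign₁-holds satisfied ψx≡b h = tt
    assign₁-holds {x = x} (open-on m s t f cs) refl (t≤ , f≤) with delete x cs in del
    ... | nothing = t≤ , f≤
    ... | just ds with eqt , eqf ← delete-count x cs del =
      count-down-holds (ψ x) s t f ds (subst (t ≤_) eqt t≤) (subst (f ≤_) eqf f≤)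

    assign-nth-holds : ∀ {b x} i {ks} → ψ x ≡ b → All Holds ks → All Holds (assign-nth b x i ks)
    assign-nth-holds i       ψx≡b []       = []
    assign-nth-holds zero    ψx≡b (h ∷ hs) = assign₁-holds _ ψx≡b h ∷ hs
    assign-nth-holds (suc i) ψx≡b (h ∷ hs) = h ∷ assign-nth-holds i ψx≡b hs

    assign-lines-satisfies : ∀ {b x} is {st} → ψ x ≡ b → Satisfies st → Satisfies (assign-lines b x is st)
    assign-lines-satisfies []       ψx≡b sat          = sat
    assign-lines-satisfies (i ∷ is) ψx≡b []           = []
    assign-lines-satisfies (i ∷ is) ψx≡b (hs ∷ sat) = assign-nth-holds i ψx≡b hs ∷ assign-lines-satisfies is ψx≡b sat

    assign-satisfies : ∀ {b} c {st} → ψ (code c) ≡ b → Satisfies st → Satisfies (assign b c st)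
    assign-satisfies c = assign-lines-satisfies (lines c)

    tightest₁-holds : ∀ {k ks continue} → Holds k → All Holds ks → (∀ {k} → Holds k → Holds (continue k)) →
      Holds (tightest₁ k ks continue)
    tightest₁-holds h [] cont = cont h
    tightest₁-holds {ks = satisfied ∷ _} h (_ ∷ hs) cont = tightest₁-holds h hs cont
    tightest₁-holds {ks = open-on zero _ _ _ _ ∷ _} h (h′ ∷ hs) cont = h′
    tightest₁-holds {k} {ks = open-on (suc m) _ _ _ _ ∷ _} h (h′ ∷ hs) cont with suc m <ᵇ priority k
    ... | true  = tightest₁-holds h′ hs cont
    ... | false = tightest₁-holds h hs cont

    tightest-holds : ∀ {k st} → Holds k → Satisfies st → Holds (tightest k st)
    tightest-holds h []         = h
    tightest-holds h (hs ∷ sat) = tightest₁-holds h hs (λ h′ → tightest-holds h′ sat)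

    -- `ψ` plays a hypothetical solution: following its values down the tree keeps all constraints
    -- true, so the conflict at the end is absurd.
    refute-sound : ∀ n st → refute n st ≡ true → Satisfies st → ⊥
    branch-sound : ∀ n st k → branch n st k ≡ true → Satisfies st → Holds k → ⊥
    both-sound : ∀ n st c → refute n (assign true c st) ∧ refute n (assign false c st) ≡ true → Satisfies st → ⊥

    refute-sound (suc n) st eq sat = branch-sound n st (tightest satisfied st) eq sat (tightest-holds tt sat)

    branch-sound n st (open-on _ _ t f cs) eq sat h with length cs <ᵇ t + f in conflict
    branch-sound n st (open-on _ _ t f cs) eq sat (t≤ , f≤) | true =
      ℕₚ.<⇒≱ (ℕₚ.<ᵇ⇒< (length cs) (t + f) (subst T (sym conflict) tt)) (subst (t + f ≤_) (trues+falses cs) (ℕₚ.+-mono-≤ t≤ f≤))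
    branch-sound n st (open-on _ _ t f (c ∷ cs)) eq sat h | false with length (c ∷ cs) ≡ᵇ t + f in full
    branch-sound n st (open-on _ _ t zero (c ∷ cs)) eq sat (t≤ , _) | false | true with ψ (code c) in ψc
    ... | true  = refute-sound n (assign true c st) eq (assign-satisfies c ψc sat)
    ... | false = ℕₚ.<⇒≱ (ℕₚ.≤-reflexive (trans (ℕₚ.≡ᵇ⇒≡ (length (c ∷ cs)) (t + 0) (subst T (sym full) tt)) (ℕₚ.+-identityʳ t)))
        (ℕₚ.≤-trans t≤ (subst (trues cs ≤_) (trues+falses cs) (ℕₚ.m≤m+n _ _)))
    branch-sound n st (open-on _ _ zero (suc f) (c ∷ cs)) eq sat (_ , f≤) | false | true with ψ (code c) in ψc
    ... | true  = ℕₚ.<⇒≱ (ℕₚ.≤-reflexive (ℕₚ.≡ᵇ⇒≡ (length (c ∷ cs)) (suc f) (subst T (sym full) tt)))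
        (ℕₚ.≤-trans f≤ (subst (falses cs ≤_) (trues+falses cs) (ℕₚ.m≤n+m _ _)))
    ... | false = refute-sound n (assign false c st) eq (assign-satisfies c ψc sat)
    branch-sound n st (open-on _ _ (suc t) (suc f) (c ∷ cs)) eq sat h | false | true  = both-sound n st c eq sat
    branch-sound n st (open-on _ _ zero    zero    (c ∷ cs)) eq sat h | false | false = both-sound n st c eq sat
    branch-sound n st (open-on _ _ zero    (suc f) (c ∷ cs)) eq sat h | false | false = both-sound n st c eq sat
    branch-sound n st (open-on _ _ (suc t) zero    (c ∷ cs)) eq sat h | false | false = both-sound n st c eq sat
    branch-sound n st (open-on _ _ (suc t) (suc f) (c ∷ cs)) eq sat h | false | false = both-sound n st c eq sat

    both-sound n st c eq sat with refute n (assign true c st) in eq₁ | ψ (code c) in ψc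
    ... | true | true  = refute-sound n (assign true c st) eq₁ (assign-satisfies c ψc sat)
    ... | true | false = refute-sound n (assign false c st) eq (assign-satisfies c ψc sat)

    refuted-sound : ∀ {st} → Refuted st → Satisfies st → ⊥
    refuted-sound {st} (refuted-by eq) = refute-sound 64 st eq

-- Grids as constraint systems.

module GridSearch where

  open Octal
  open Frames
  open Search

  elements : List F₈
  elements = List.tabulate element

  index₈ : F₈ → ℕ
  index₈ (a , b , c) = [ a ] + 2 * [ b ] + 4 * [ c ]

  fromIndex₈ : ℕ → F₈
  fromIndex₈ n = odd n , odd ⌊ n /2⌋ , odd ⌊ ⌊ n /2⌋ /2⌋
    where
    odd : ℕ → Bool
    odd zero    = false
    odd (suc n) = not (odd n)

  -- Verticals come first, then the slopes in the order of `elements`, as in the states below. The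
  -- line of slope `m` through the cell has intercept `b ⊕ m ⊗ a`, subtraction being addition.
  point : F₈ → F₈ → Cell
  point a b = cell (8 * index₈ a + index₈ b) (index₈ a ∷ List.map (λ m → index₈ (b ⊕ m ⊗ a)) elements)

  valuation : Grid → ℕ → Bool
  -- `fromIndex₈` reads only the three lowest bits, which reduces `n` modulo 8.
  valuation χ n = χ (fromIndex₈ (n / 8)) (fromIndex₈ n)

  valuation-point : ∀ χ a b → valuation χ (Cell.code (point a b)) ≡ χ a b
  valuation-point χ a b = cong₂ χ (first a b) (second a b)
    where
    first : ∀ a b → fromIndex₈ ((8 * index₈ a + index₈ b) / 8) ≡ a
    first = from-yes (∀₈? λ a → ∀₈? λ b → fromIndex₈ ((8 * index₈ a + index₈ b) / 8) ≟ a)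
    second : ∀ a b → fromIndex₈ (8 * index₈ a + index₈ b) ≡ b
    second = from-yes (∀₈? λ a → ∀₈? λ b → fromIndex₈ (8 * index₈ a + index₈ b) ≟ b)

  atLeast exactly : ℕ → List Cell → Constraint
  atLeast t = constraint (8 ∸ t) t 0
  exactly t = constraint (8 ∸ t) t (8 ∸ t)

  column : F₈ → List Cell
  column a = List.map (point a) elements

  row : F₈ → F₈ → List Cell
  row m c = List.map (λ a → point a (m ⊗ a ⊕ c)) elements

  cells : (F₈ → F₈ × F₈) → List Cell
  cells P = List.map (λ x → point (proj₁ (P x)) (proj₂ (P x))) elements

  module _ (χ : Grid) where

    open Soundness (valuation χ)

    count : (F₈ → F₈ × F₈) → ℕ
    count P = ∑₈ (λ x → [ χ (proj₁ (P x)) (proj₂ (P x)) ])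

    opaque
      unfolding ∑₈

      trues-map : ∀ (P : F₈ → F₈ × F₈) → trues (cells P) ≡ count P
      trues-map P = ∑₈-cong {λ x → [ valuation χ (Cell.code (point (proj₁ (P x)) (proj₂ (P x)))) ]}
          (λ x → cong [_] (valuation-point χ (proj₁ (P x)) (proj₂ (P x))))

    atLeast-holds : ∀ (P : F₈ → F₈ × F₈) t → t ≤ count P → Holds (atLeast t (cells P))
    atLeast-holds P t le = constraint-holds (8 ∸ t) t 0 _ (subst (t ≤_) (sym (trues-map P)) le) z≤n

    exactly-holds : ∀ (P : F₈ → F₈ × F₈) t → count P ≡ t → Holds (exactly t (cells P))
    exactly-holds P t eq = constraint-holds (8 ∸ t) t (8 ∸ t) _ (ℕₚ.≤-reflexive (sym trues≡t))
      (ℕₚ.≤-reflexive (trans (cong (8 ∸_) (sym trues≡t))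
          (trans (cong (_∸ trues cs) (sym (trues+falses cs))) (ℕₚ.m+n∸m≡n (trues cs) (falses cs)))))
      where
      cs = cells P
      trues≡t : trues cs ≡ t
      trues≡t = trans (trues-map P) eq

    all-elements : ∀ {A : Set} {Q : A → Set} (k : F₈ → A) → (∀ x → Q (k x)) → All Q (List.map k elements)
    all-elements k holds = Allₚ.map⁺ (All.universal holds elements)

  steep : List F₈
  steep = List.drop 2 elements

  -- The complement of a line with two points of the set, whose directions are those of the axes.
  state₂ : State
  state₂ = List.map (exactly 2 ∘ column) elements
         ∷ List.map (exactly 2 ∘ row 𝟘) elements
         ∷ List.map (atLeast 1 ∘ row 𝟙) elements
         ∷ List.map (λ m → List.map (atLeast 1 ∘ row m) elements) steep

  -- The complement of a line with three points of the set, with directions 0, 1 and ∞; the exceptional lines of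
  -- the three classes are concurrent.
  state₃ : State
  state₃ = List.map (λ a → exactly (2 + [ zero? a ]) (column a)) elements
         ∷ List.map (λ c → exactly (2 + [ zero? c ]) (row 𝟘 c)) elements
         ∷ List.map (λ c → exactly (2 + [ zero? c ]) (row 𝟙 c)) elements
         ∷ List.map (λ m → List.map (atLeast 1 ∘ row m) elements) steep

  -- Translations and independent scalings of the axes preserve both exact classes, so two cells of
  -- one column and a second cell in the row of one of them can be taken to be these three.
  start₂ : State
  start₂ = assign true (point 𝟘 𝟘) (assign true (point 𝟘 𝟙) (assign true (point 𝟙 𝟘) state₂))

  start₂-refuted : Refuted start₂
  start₂-refuted = refuted-by refl

  with-column : (F₈ → Bool) → State → State
  with-column p st = List.foldr (λ b → assign (p b) (point 𝟘 b)) st elements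

  ω : F₈
  ω = false , true , false

  among : List F₈ → F₈ → Bool
  among []       x = false
  among (y ∷ ys) x = if zero? (x ⊕ y) then true else among ys x

  -- Representatives of the triples of elements, up to multiplication by a scalar and the Frobenius map.
  patterns : List (List F₈)
  patterns = (𝟘 ∷ 𝟙 ∷ ω ∷ [])
           ∷ (𝟙 ∷ ω ∷ (𝟙 ⊕ ω) ∷ [])
           ∷ (𝟙 ∷ ω ∷ (ω ⊗ ω) ∷ [])
           ∷ (𝟙 ∷ ω ∷ (𝟙 ⊕ ω ⊕ ω ⊗ ω) ∷ [])
           ∷ []

  patterns-refuted : All (λ p → Refuted (with-column (among p) state₃)) patterns
  patterns-refuted = refuted-by refl ∷ refuted-by refl ∷ refuted-by refl ∷ refuted-by refl ∷ []

-- Normalisation by collineations; the cases of two and three directions.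

module GridTheorems where

  open Octal
  open Frames
  open Search
  open GridSearch

  Bijective : (F₈ → F₈) → Set
  Bijective π = ∀ d → ∑₈ (λ c → [ zero? (d ⊕ π c) ]) ≡ 1

  -- The coordinates transform separately, which keeps the verticals. `image` pulls a grid back, so
  -- bounds valid on all lines of `χ` pass to the image with no inverse map.
  record Collineation : Set where
    field
      A B : F₈ → F₈
      A-bijective : Bijective A
      B-bijective : Bijective B
      slope : F₈ → F₈
      intercept : F₈ → F₈ → F₈
      linear : ∀ m c a → B (m ⊗ a ⊕ c) ≡ slope m ⊗ A a ⊕ intercept m c

    image : Grid → Grid
    image χ a b = χ (A a) (B b)

    on-image : ∀ χ m c → on (image χ) m c ≡ on χ (slope m) (intercept m c)
    on-image χ m c = trans (∑₈-cong λ a → cong (λ b → [ χ (A a) b ]) (linear m c a))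
      (∑₈-reindex A A-bijective (λ a → [ χ a (slope m ⊗ a ⊕ intercept m c) ]))

    on∞-image : ∀ χ a → on∞ (image χ) a ≡ on∞ χ (A a)
    on∞-image χ a = ∑₈-reindex B B-bijective (λ b → [ χ (A a) b ])

  opaque
    unfolding ∑₈

    affine-bijective : ∀ s t → s ≢ 𝟘 → Bijective (λ c → s ⊗ c ⊕ t)
    affine-bijective = from-yes (∀₈? λ s → ∀₈? λ t → ¬? (s ≟ 𝟘) →-dec ∀₈? λ d → ∑₈ (λ c → [ zero? (d ⊕ (s ⊗ c ⊕ t)) ]) ℕ.≟ 1)

  opaque
    unfolding ∑₈

    shift-bijective : ∀ t → Bijective (t ⊕_)
    shift-bijective = from-yes (∀₈? λ t → ∀₈? λ d → ∑₈ (λ c → [ zero? (d ⊕ (t ⊕ c)) ]) ℕ.≟ 1)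

  scaling : ∀ s t u → s ≢ 𝟘 → t ≢ 𝟘 → Collineation
  scaling s t u s≢𝟘 t≢𝟘 = record
    { A = λ a → s ⊗ a ⊕ 𝟘
    ; B = λ b → t ⊗ b ⊕ u
    ; A-bijective = affine-bijective s 𝟘 s≢𝟘
    ; B-bijective = affine-bijective t u t≢𝟘
    ; slope = λ m → t ⊗ m ⊗ inv s
    ; intercept = λ m c → t ⊗ c ⊕ u
    ; linear = λ m c a → trans (cong (_⊕ u) (⊗-distribˡ t (m ⊗ a) c)) (trans (⊕-assoc (t ⊗ (m ⊗ a)) (t ⊗ c) u)
        (cong (_⊕ (t ⊗ c ⊕ u)) (trans (sym (⊗-assoc t m a)) (cancel (t ⊗ m) s a s≢𝟘))))
    }
    where
    cancel : ∀ x s a → s ≢ 𝟘 → x ⊗ a ≡ x ⊗ inv s ⊗ (s ⊗ a ⊕ 𝟘)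
    cancel = from-yes (∀₈? λ x → ∀₈? λ s → ∀₈? λ a → ¬? (s ≟ 𝟘) →-dec (x ⊗ a) ≟ (x ⊗ inv s ⊗ (s ⊗ a ⊕ 𝟘)))

  frobenius : ℕ → F₈ → F₈
  frobenius zero    x = x
  frobenius (suc i) x = frobenius i (x ⊗ x)

  opaque
    unfolding ∑₈

    semilinear-bijective : ∀ i s t → i < 3 → s ≢ 𝟘 → Bijective (λ c → s ⊗ frobenius i c ⊕ t)
    semilinear-bijective i s t i<3 = from-yes (ℕₚ.allUpTo? (λ i → ∀₈? λ s → ∀₈? λ t → ¬? (s ≟ 𝟘) →-dec ∀₈? λ d →
      ∑₈ (λ c → [ zero? (d ⊕ (s ⊗ frobenius i c ⊕ t)) ]) ℕ.≟ 1) 3) {i} i<3 s t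

  frobenius-⊕ : ∀ i x y → frobenius i (x ⊕ y) ≡ frobenius i x ⊕ frobenius i y
  frobenius-⊕ zero    x y = refl
  frobenius-⊕ (suc i) x y = trans (cong (frobenius i) (square x y)) (frobenius-⊕ i (x ⊗ x) (y ⊗ y))
    where
    square : ∀ x y → (x ⊕ y) ⊗ (x ⊕ y) ≡ x ⊗ x ⊕ y ⊗ y
    square = from-yes (∀₈? λ x → ∀₈? λ y → ((x ⊕ y) ⊗ (x ⊕ y)) ≟ (x ⊗ x ⊕ y ⊗ y))

  frobenius-⊗ : ∀ i x y → frobenius i (x ⊗ y) ≡ frobenius i x ⊗ frobenius i y
  frobenius-⊗ zero    x y = refl
  frobenius-⊗ (suc i) x y = trans (cong (frobenius i) (square x y)) (frobenius-⊗ i (x ⊗ x) (y ⊗ y))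
    where
    square : ∀ x y → (x ⊗ y) ⊗ (x ⊗ y) ≡ x ⊗ x ⊗ (y ⊗ y)
    square = from-yes (∀₈? λ x → ∀₈? λ y → ((x ⊗ y) ⊗ (x ⊗ y)) ≟ (x ⊗ x ⊗ (y ⊗ y)))

  -- The same scalar and the same Frobenius power act on both coordinates, so that the slopes 0, 1
  -- and ∞ are fixed.
  semilinear : ∀ i s a₀ b₀ → i < 3 → s ≢ 𝟘 → Collineation
  semilinear i s a₀ b₀ i<3 s≢𝟘 = record
    { A = λ a → s ⊗ frobenius i a ⊕ a₀
    ; B = λ b → s ⊗ frobenius i b ⊕ b₀
    ; A-bijective = semilinear-bijective i s a₀ i<3 s≢𝟘
    ; B-bijective = semilinear-bijective i s b₀ i<3 s≢𝟘
    ; slope = frobenius i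
    ; intercept = λ m c → s ⊗ frobenius i c ⊕ b₀ ⊕ frobenius i m ⊗ a₀
    ; linear = λ m c a → trans (cong (λ t → s ⊗ t ⊕ b₀)
        (trans (frobenius-⊕ i (m ⊗ a) c) (cong (_⊕ frobenius i c) (frobenius-⊗ i m a))))
        (rearrange s (frobenius i m) (frobenius i a) (frobenius i c) a₀ b₀)
    }
    where
    rearrange : ∀ s m a c a₀ b₀ → s ⊗ (m ⊗ a ⊕ c) ⊕ b₀ ≡ m ⊗ (s ⊗ a ⊕ a₀) ⊕ (s ⊗ c ⊕ b₀ ⊕ m ⊗ a₀)
    rearrange s m a c a₀ b₀ = trans
        (sym (trans (cong (s ⊗ (m ⊗ a ⊕ c) ⊕ b₀ ⊕_) (⊕-self (m ⊗ a₀))) (⊕-identityʳ (s ⊗ (m ⊗ a ⊕ c) ⊕ b₀))))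
      (S.solve 6 (λ s m a c a₀ b₀ → s S.:* (m S.:* a S.:+ c) S.:+ b₀ S.:+ (m S.:* a₀ S.:+ m S.:* a₀)
        S.:= m S.:* (s S.:* a S.:+ a₀) S.:+ (s S.:* c S.:+ b₀ S.:+ m S.:* a₀)) refl s m a c a₀ b₀)

  excess : ∀ (G : F₈ → ℕ) → (∀ x → 2 ≤ G x) → ∑₈ G ≡ 16 + ∑₈ (λ x → G x ∸ 2)
  excess G 2≤G = trans (∑₈-cong λ x → sym (ℕₚ.m+[n∸m]≡n (2≤G x)))
    (trans (∑₈-+ (λ _ → 2) (λ x → G x ∸ 2)) (cong (_+ ∑₈ (λ x → G x ∸ 2)) (∑₈-const 2)))

  no-excess : ∀ (G : F₈ → ℕ) → (∀ x → 2 ≤ G x) → ∑₈ G ≡ 16 → ∀ x → G x ≡ 2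
  no-excess G 2≤G ∑≡16 x = ℕₚ.≤-antisym
      (ℕₚ.m∸n≡0⇒m≤n (ℕₚ.n≤0⇒n≡0 (subst (G x ∸ 2 ≤_) zero-excess (term≤∑₈ (λ x → G x ∸ 2) x)))) (2≤G x)
    where
    zero-excess : ∑₈ (λ x → G x ∸ 2) ≡ 0
    zero-excess = ℕₚ.+-cancelˡ-≡ 16 _ 0 (trans (sym (excess G 2≤G)) ∑≡16)

  one-excess : ∀ (G : F₈ → ℕ) → (∀ x → 2 ≤ G x) → ∑₈ G ≡ 17 → ∃[ x₀ ] ∀ x → G x ≡ 2 + [ zero? (x ⊕ x₀) ]
  one-excess G 2≤G ∑≡17 = x₀ , λ x → trans (sym (ℕₚ.m+[n∸m]≡n (2≤G x))) (cong (2 +_) (at x))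
    where
    E : F₈ → ℕ
    E x = G x ∸ 2
    ∑E≡1 : ∑₈ E ≡ 1
    ∑E≡1 = ℕₚ.+-cancelˡ-≡ 16 _ 1 (trans (sym (excess G 2≤G)) ∑≡17)
    found : ∃[ x ] 1 ≤ E x
    found = ∑₈≥1⇒∃ E (ℕₚ.≤-reflexive (sym ∑E≡1))
    x₀ = proj₁ found
    E≤1 : ∀ x → E x ≤ 1
    E≤1 x = subst (E x ≤_) ∑E≡1 (term≤∑₈ E x)
    pair≤ : ∀ x → [ not (zero? (x ⊕ x₀)) ] * E x + E x₀ ≤ 1
    pair≤ x = subst ([ not (zero? (x ⊕ x₀)) ] * E x + E x₀ ≤_) (trans (sym (∑₈-split E x₀)) ∑E≡1)
      (ℕₚ.≤-trans (ℕₚ.≤-reflexive (ℕₚ.+-comm ([ not (zero? (x ⊕ x₀)) ] * E x) (E x₀)))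
        (ℕₚ.+-monoʳ-≤ (E x₀) (term≤∑₈ (λ y → [ not (zero? (y ⊕ x₀)) ] * E y) x)))
    at′ : ∀ x z → zero? (x ⊕ x₀) ≡ z → [ not z ] * E x + E x₀ ≤ 1 → E x ≡ [ z ]
    at′ x true  z le = trans (cong E (x⊕y≡𝟘⇒x≡y x x₀ (zero?-sound (x ⊕ x₀) z))) (ℕₚ.≤-antisym (E≤1 x₀) (proj₂ found))
    at′ x false z le = ℕₚ.n≤0⇒n≡0 (ℕₚ.≤-trans (ℕₚ.m≤m+n (E x) 0)
        (ℕₚ.+-cancelʳ-≤ 1 (E x + 0) 0 (ℕₚ.≤-trans (ℕₚ.+-monoʳ-≤ (E x + 0) (proj₂ found)) le)))
    at : ∀ x → E x ≡ [ zero? (x ⊕ x₀) ]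
    at x = at′ x (zero? (x ⊕ x₀)) refl (pair≤ x)

  -- As 16 = 8 · 2, every vertical and every horizontal has exactly two cells; this supplies the
  -- three cells of `start₂`.
  no-two-slopes : ∀ χ → total χ ≡ 16 → (∀ m c → 1 ≤ on χ m c) → (∀ a → 2 ≤ on∞ χ a) → (∀ c → 2 ≤ on χ 𝟘 c) → ⊥
  no-two-slopes χ total≡16 on≥1 on∞≥2 on𝟘≥2 = refuted-sound start₂-refuted
    (assign-satisfies (point 𝟘 𝟘) (trans (valuation-point χ′ 𝟘 𝟘) at₀₀)
        (assign-satisfies (point 𝟘 𝟙) (trans (valuation-point χ′ 𝟘 𝟙) at₀₁)
      (assign-satisfies (point 𝟙 𝟘) (trans (valuation-point χ′ 𝟙 𝟘) at₁₀)
        ( all-elements χ′ (exactly 2 ∘ column) (λ a → exactly-holds χ′ (λ b → a , b) 2 (trans (on∞-image χ a) (on∞≡2 (A a))))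
        ∷ all-elements χ′ (exactly 2 ∘ row 𝟘)
            (λ c → exactly-holds χ′ (λ a → a , 𝟘 ⊗ a ⊕ c) 2
            (trans (on-image χ 𝟘 c) (trans (cong (λ m → on χ m (intercept 𝟘 c)) slope-𝟘) (on𝟘≡2 (intercept 𝟘 c)))))
        ∷ all-elements χ′ (atLeast 1 ∘ row 𝟙) (rest 𝟙)
        ∷ Allₚ.map⁺ (All.universal (λ m → all-elements χ′ (atLeast 1 ∘ row m) (rest m)) steep)))))
    where
    on∞≡2 : ∀ a → on∞ χ a ≡ 2
    on∞≡2 = no-excess (on∞ χ) on∞≥2 total≡16
    on𝟘≡2 : ∀ c → on χ 𝟘 c ≡ 2
    on𝟘≡2 = no-excess (on χ 𝟘) on𝟘≥2 (trans (∑-on χ 𝟘) total≡16)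
    []≤1 : ∀ b → [ b ] ≤ 1
    []≤1 true  = ℕₚ.≤-refl
    []≤1 false = z≤n
    pos : ∀ b → 1 ≤ [ b ] → b ≡ true
    pos true _ = refl
    two : ∀ (p : F₈ → Bool) → ∑₈ (λ x → [ p x ]) ≡ 2 → ∀ x → ∃[ y ] (y ⊕ x ≢ 𝟘) × p y ≡ true
    two p ∑≡2 x with y , y≢x , le ← ∑₈≥2⇒∃ (λ x → [ p x ]) x ([]≤1 (p x)) (ℕₚ.≤-reflexive (sym ∑≡2)) = y , y≢x , pos (p y) le
    first : ∃[ b ] χ 𝟘 b ≡ true
    first = ∑₈≢0⇒∃ (χ 𝟘) (subst (1 ≤_) (sym (on∞≡2 𝟘)) (s≤s z≤n))
    b₁ = proj₁ first
    second : ∃[ b ] (b ⊕ b₁ ≢ 𝟘) × χ 𝟘 b ≡ true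
    second = two (χ 𝟘) (on∞≡2 𝟘) b₁
    b₂ = proj₁ second
    third : ∃[ a ] (a ⊕ 𝟘 ≢ 𝟘) × χ a (𝟘 ⊗ a ⊕ b₁) ≡ true
    third = two (λ a → χ a (𝟘 ⊗ a ⊕ b₁)) (on𝟘≡2 b₁) 𝟘
    a₁ = proj₁ third
    a₁≢𝟘 : a₁ ≢ 𝟘
    a₁≢𝟘 eq = proj₁ (proj₂ third) (trans (⊕-identityʳ a₁) eq)
    -- Sends (0 , 0), (0 , 1), (1 , 0) to the cells found: (0 , b₁), (0 , b₂), (a₁ , b₁).
    open Collineation (scaling a₁ (b₂ ⊕ b₁) b₁ a₁≢𝟘 (proj₁ (proj₂ second)))
    χ′ : Grid
    χ′ = image χ
    open Soundness (valuation χ′) using (refuted-sound; assign-satisfies)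
    rest : ∀ m c → Soundness.Holds (valuation χ′) (atLeast 1 (row m c))
    rest m c = atLeast-holds χ′ (λ a → a , m ⊗ a ⊕ c) 1 (subst (1 ≤_) (sym (on-image χ m c)) (on≥1 (slope m) (intercept m c)))
    slope-𝟘 : slope 𝟘 ≡ 𝟘
    slope-𝟘 = trans (cong (_⊗ inv a₁) (⊗-zeroʳ (b₂ ⊕ b₁))) (⊗-zeroˡ (inv a₁))
    A-𝟘 : A 𝟘 ≡ 𝟘
    A-𝟘 = trans (⊕-identityʳ (a₁ ⊗ 𝟘)) (⊗-zeroʳ a₁)
    A-𝟙 : A 𝟙 ≡ a₁
    A-𝟙 = trans (⊕-identityʳ (a₁ ⊗ 𝟙)) (⊗-identityʳ a₁)
    B-𝟘 : B 𝟘 ≡ b₁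
    B-𝟘 = trans (cong (_⊕ b₁) (⊗-zeroʳ (b₂ ⊕ b₁))) (⊕-identityˡ b₁)
    B-𝟙 : B 𝟙 ≡ b₂
    B-𝟙 = trans (cong (_⊕ b₁) (⊗-identityʳ (b₂ ⊕ b₁)))
        (trans (⊕-assoc b₂ b₁ b₁) (trans (cong (b₂ ⊕_) (⊕-self b₁)) (⊕-identityʳ b₂)))
    at₀₀ : χ′ 𝟘 𝟘 ≡ true
    at₀₀ = trans (cong₂ χ A-𝟘 B-𝟘) (proj₂ first)
    at₀₁ : χ′ 𝟘 𝟙 ≡ true
    at₀₁ = trans (cong₂ χ A-𝟘 B-𝟙) (proj₂ (proj₂ second))
    at₁₀ : χ′ 𝟙 𝟘 ≡ true
    at₁₀ = trans (cong₂ χ A-𝟙 (trans B-𝟘 (sym (trans (cong (_⊕ b₁) (⊗-zeroˡ a₁)) (⊕-identityˡ b₁))))) (proj₂ (proj₂ third))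

  weighted-on : ∀ χ m (G : F₈ → ℕ) → ∑₈ (λ c → G c * on χ m c) ≡ ∑₈ (λ a → ∑₈ (λ b → G (b ⊕ m ⊗ a) * [ χ a b ]))
  weighted-on χ m G = begin
    ∑₈ (λ c → G c * on χ m c)                                  ≡⟨ ∑₈-cong (λ c → ∑₈-* (G c) (λ a → [ χ a (m ⊗ a ⊕ c) ])) ⟨
    ∑₈ (λ c → ∑₈ (λ a → G c * [ χ a (m ⊗ a ⊕ c) ]))            ≡⟨ ∑₈-swap (λ c a → G c * [ χ a (m ⊗ a ⊕ c) ]) ⟩
    ∑₈ (λ a → ∑₈ (λ c → G c * [ χ a (m ⊗ a ⊕ c) ]))            ≡⟨ ∑₈-cong (λ a → trans
        (∑₈-cong (λ c → cong (λ t → G t * [ χ a (m ⊗ a ⊕ c) ]) (sym (unshift (m ⊗ a) c))))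
        (∑₈-reindex (λ c → m ⊗ a ⊕ c) (shift-bijective (m ⊗ a)) (λ b → G (b ⊕ m ⊗ a) * [ χ a b ]))) ⟩
    ∑₈ (λ a → ∑₈ (λ b → G (b ⊕ m ⊗ a) * [ χ a b ]))            ∎
    where
    open ≡-Reasoning
    unshift : ∀ t c → t ⊕ c ⊕ t ≡ c
    unshift t c = trans (cong (_⊕ t) (⊕-comm t c)) (trans (⊕-assoc c t t) (trans (cong (c ⊕_) (⊕-self t)) (⊕-identityʳ c)))

  -- Modulo 2, the sum of the points of the set can be read off each of the three classes.
  concurrent : ∀ χ {a₀ c₀ d₀} →
    (∀ a → on∞ χ a ≡ 2 + [ zero? (a ⊕ a₀) ]) →
    (∀ c → on χ 𝟘 c ≡ 2 + [ zero? (c ⊕ c₀) ]) →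
    (∀ c → on χ 𝟙 c ≡ 2 + [ zero? (c ⊕ d₀) ]) → d₀ ≡ c₀ ⊕ a₀
  concurrent χ {a₀} {c₀} {d₀} on∞≡ on𝟘≡ on𝟙≡ =
    cong₂ _,_ (coordinate proj₁ (λ _ _ → refl))
      (cong₂ _,_ (coordinate (proj₁ ∘ proj₂) (λ _ _ → refl)) (coordinate (proj₂ ∘ proj₂) (λ _ _ → refl)))
    where
    special : ∀ (G : F₈ → ℕ) (H : F₈ → ℕ) x₀ → (∀ x → H x ≡ 2 + [ zero? (x ⊕ x₀) ]) → ∑₈ (λ x → G x * H x) ≡ 2 * ∑₈ G + G x₀
    special G H x₀ H≡ = begin
      ∑₈ (λ x → G x * H x)                                  ≡⟨ ∑₈-cong
          (λ x → trans (cong (G x *_) (H≡ x)) (expand (G x) [ zero? (x ⊕ x₀) ])) ⟩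
      ∑₈ (λ x → 2 * G x + [ zero? (x ⊕ x₀) ] * G x)         ≡⟨ ∑₈-+ (λ x → 2 * G x) (λ x → [ zero? (x ⊕ x₀) ] * G x) ⟩
      ∑₈ (λ x → 2 * G x) + ∑₈ (λ x → [ zero? (x ⊕ x₀) ] * G x)  ≡⟨ cong₂ _+_ (∑₈-* 2 G) (∑₈-δ x₀ G) ⟩
      2 * ∑₈ G + G x₀                                       ∎
      where
      open ≡-Reasoning
      expand : ∀ g z → g * (2 + z) ≡ 2 * g + z * g
      expand = solve 2 (λ g z → g :* (con 2 :+ z) := con 2 :* g :+ z :* g) refl
        where open +-*-Solver
    module _ (λ′ : F₈ → Bool) (additive : ∀ x y → λ′ (x ⊕ y) ≡ λ′ x xor λ′ y) where
      L : F₈ → ℕ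
      L x = [ λ′ x ]
      both : ℕ
      both = ∑₈ (λ a → ∑₈ (λ b → [ λ′ a ∧ λ′ b ] * [ χ a b ]))
      -- `λ′` is one of the three coordinates over 𝔽₂, and on bits p xor q = p + q - 2pq. Carrying
      -- the doubled product along as `both` keeps the sums in ℕ until `parity` compares them.
      pointwise : ∀ a b x → L (b ⊕ 𝟙 ⊗ a) * x + 2 * ([ λ′ a ∧ λ′ b ] * x) ≡ L a * x + L (b ⊕ 𝟘 ⊗ a) * x
      pointwise a b x = trans (cong (λ t → [ t ] * x + 2 * ([ λ′ a ∧ λ′ b ] * x))
          (trans (additive b (𝟙 ⊗ a)) (cong (λ t → λ′ b xor λ′ t) (⊗-identityˡ a))))
        (trans (bits (λ′ a) (λ′ b) x)
          (cong (λ t → [ λ′ a ] * x + [ λ′ t ] * x) (sym (trans (cong (b ⊕_) (⊗-zeroˡ a)) (⊕-identityʳ b)))))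
        where
        bits : ∀ p q x → [ q xor p ] * x + 2 * ([ p ∧ q ] * x) ≡ [ p ] * x + [ q ] * x
        bits true  true  = solve 1 (λ x → con 0 :* x :+ con 2 :* (con 1 :* x) := con 1 :* x :+ con 1 :* x) refl
          where open +-*-Solver
        bits true  false = solve 1 (λ x → con 1 :* x :+ con 2 :* (con 0 :* x) := con 1 :* x :+ con 0 :* x) refl
          where open +-*-Solver
        bits false true  = solve 1 (λ x → con 1 :* x :+ con 2 :* (con 0 :* x) := con 0 :* x :+ con 1 :* x) refl
          where open +-*-Solver
        bits false false = solve 1 (λ x → con 0 :* x :+ con 2 :* (con 0 :* x) := con 0 :* x :+ con 0 :* x) refl
          where open +-*-Solver
      summed : ∑₈ (λ c → L c * on χ 𝟙 c) + 2 * both ≡ ∑₈ (λ a → L a * on∞ χ a) + ∑₈ (λ c → L c * on χ 𝟘 c)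
      summed = begin
        ∑₈ (λ c → L c * on χ 𝟙 c) + 2 * both
          ≡⟨ cong₂ _+_ (weighted-on χ 𝟙 L)
              (trans (sym (∑₈-* 2 (λ a → ∑₈ (λ b → [ λ′ a ∧ λ′ b ] * [ χ a b ]))))
              (∑₈-cong λ a → sym (∑₈-* 2 (λ b → [ λ′ a ∧ λ′ b ] * [ χ a b ])))) ⟩
        ∑₈ (λ a → ∑₈ (λ b → L (b ⊕ 𝟙 ⊗ a) * [ χ a b ])) + ∑₈ (λ a → ∑₈ (λ b → 2 * ([ λ′ a ∧ λ′ b ] * [ χ a b ])))
          ≡⟨ merge (λ a b → L (b ⊕ 𝟙 ⊗ a) * [ χ a b ]) (λ a b → 2 * ([ λ′ a ∧ λ′ b ] * [ χ a b ])) ⟨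
        ∑₈ (λ a → ∑₈ (λ b → L (b ⊕ 𝟙 ⊗ a) * [ χ a b ] + 2 * ([ λ′ a ∧ λ′ b ] * [ χ a b ])))
          ≡⟨ ∑₈-cong (λ a → ∑₈-cong (λ b → pointwise a b [ χ a b ])) ⟩
        ∑₈ (λ a → ∑₈ (λ b → L a * [ χ a b ] + L (b ⊕ 𝟘 ⊗ a) * [ χ a b ]))
          ≡⟨ merge (λ a b → L a * [ χ a b ]) (λ a b → L (b ⊕ 𝟘 ⊗ a) * [ χ a b ]) ⟩
        ∑₈ (λ a → ∑₈ (λ b → L a * [ χ a b ])) + ∑₈ (λ a → ∑₈ (λ b → L (b ⊕ 𝟘 ⊗ a) * [ χ a b ]))
          ≡⟨ cong₂ _+_ (∑₈-cong λ a → ∑₈-* (L a) (λ b → [ χ a b ])) (sym (weighted-on χ 𝟘 L)) ⟩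
        ∑₈ (λ a → L a * on∞ χ a) + ∑₈ (λ c → L c * on χ 𝟘 c) ∎
        where
        open ≡-Reasoning
        merge : ∀ (G H : F₈ → F₈ → ℕ) → ∑₈ (λ a → ∑₈ (λ b → G a b + H a b)) ≡ ∑₈ (λ a → ∑₈ (G a)) + ∑₈ (λ a → ∑₈ (H a))
        merge G H = trans (∑₈-cong λ a → ∑₈-+ (G a) (H a)) (∑₈-+ (λ a → ∑₈ (G a)) (λ a → ∑₈ (H a)))
      parity : ∀ d a c p q → [ d ] + 2 * p ≡ [ a ] + [ c ] + 2 * q → d ≡ c xor a
      parity true  true  true  p q eq = contradiction (trans (ℕₚ.*-suc 2 q) (sym eq)) (ℕₚ.even≢odd (suc q) p)
      parity true  true  false p q eq = refl
      parity true  false true  p q eq = refl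
      parity true  false false p q eq = contradiction (sym eq) (ℕₚ.even≢odd q p)
      parity false true  true  p q eq = refl
      parity false true  false p q eq = contradiction eq (ℕₚ.even≢odd p q)
      parity false false true  p q eq = contradiction eq (ℕₚ.even≢odd p q)
      parity false false false p q eq = refl
      coordinate : λ′ d₀ ≡ λ′ (c₀ ⊕ a₀)
      coordinate = trans (parity (λ′ d₀) (λ′ a₀) (λ′ c₀) (∑₈ L + both) (∑₈ L + ∑₈ L) (begin
        [ λ′ d₀ ] + 2 * (∑₈ L + both)                 ≡⟨ solve 3
            (λ d s b → d :+ con 2 :* (s :+ b) := con 2 :* s :+ d :+ con 2 :* b) refl [ λ′ d₀ ] (∑₈ L) both ⟩
        2 * ∑₈ L + [ λ′ d₀ ] + 2 * both               ≡⟨ cong (_+ 2 * both) (special L (on χ 𝟙) d₀ on𝟙≡) ⟨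
        ∑₈ (λ c → L c * on χ 𝟙 c) + 2 * both          ≡⟨ summed ⟩
        ∑₈ (λ a → L a * on∞ χ a) + ∑₈ (λ c → L c * on χ 𝟘 c)   ≡⟨ cong₂ _+_ (special L (on∞ χ) a₀ on∞≡)
            (special L (on χ 𝟘) c₀ on𝟘≡) ⟩
        2 * ∑₈ L + [ λ′ a₀ ] + (2 * ∑₈ L + [ λ′ c₀ ]) ≡⟨ solve 3
            (λ s a c → con 2 :* s :+ a :+ (con 2 :* s :+ c) := a :+ c :+ con 2 :* (s :+ s)) refl (∑₈ L) [ λ′ a₀ ] [ λ′ c₀ ] ⟩
        [ λ′ a₀ ] + [ λ′ c₀ ] + 2 * (∑₈ L + ∑₈ L)     ∎)) (sym (additive c₀ a₀))
        where
        open ≡-Reasoning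
        open +-*-Solver

  semilinearMaps : List (ℕ × F₈)
  semilinearMaps = List.cartesianProduct (0 ∷ 1 ∷ 2 ∷ []) (List.drop 1 elements)

  semilinearMaps-valid : All (λ (i , s) → i < 3 × s ≢ 𝟘) semilinearMaps
  semilinearMaps-valid = from-yes (All.all? (λ (i , s) → (i ℕₚ.<? 3) ×-dec ¬? (s ≟ 𝟘)) semilinearMaps)

  -- Every function from 𝔽₈ to `Bool` is pointwise such a table, which turns a quantifier over
  -- functions into a check of 256 cases.
  table : (x₀ x₁ x₂ x₃ x₄ x₅ x₆ x₇ : Bool) → F₈ → Bool
  table x₀ x₁ x₂ x₃ x₄ x₅ x₆ x₇ (false , false , false) = x₀
  table x₀ x₁ x₂ x₃ x₄ x₅ x₆ x₇ (true  , false , false) = x₁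
  table x₀ x₁ x₂ x₃ x₄ x₅ x₆ x₇ (false , true  , false) = x₂
  table x₀ x₁ x₂ x₃ x₄ x₅ x₆ x₇ (true  , true  , false) = x₃
  table x₀ x₁ x₂ x₃ x₄ x₅ x₆ x₇ (false , false , true ) = x₄
  table x₀ x₁ x₂ x₃ x₄ x₅ x₆ x₇ (true  , false , true ) = x₅
  table x₀ x₁ x₂ x₃ x₄ x₅ x₆ x₇ (false , true  , true ) = x₆
  table x₀ x₁ x₂ x₃ x₄ x₅ x₆ x₇ (true  , true  , true ) = x₇

  Normalised : (F₈ → Bool) → Set
  Normalised X = Any (λ (i , s) → Any (λ p → ∀ b → X (s ⊗ frobenius i b) ≡ among p b) patterns) semilinearMaps

  opaque
    unfolding ∑₈

    normalise-table : ∀ x₀ x₁ x₂ x₃ x₄ x₅ x₆ x₇ → let X = table x₀ x₁ x₂ x₃ x₄ x₅ x₆ x₇ in ∑₈ (λ b → [ X b ]) ≡ 3 → Normalised X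
    normalise-table = from-yes (∀𝔹? λ x₀ → ∀𝔹? λ x₁ → ∀𝔹? λ x₂ → ∀𝔹? λ x₃ → ∀𝔹? λ x₄ → ∀𝔹? λ x₅ → ∀𝔹? λ x₆ → ∀𝔹? λ x₇ →
      let X = table x₀ x₁ x₂ x₃ x₄ x₅ x₆ x₇ in (∑₈ (λ b → [ X b ]) ℕ.≟ 3) →-dec
        Any.any? (λ (i , s) → Any.any? (λ p → ∀₈? (λ b → X (s ⊗ frobenius i b) Boolₚ.≟ among p b)) patterns) semilinearMaps)

  normalise : ∀ (X : F₈ → Bool) → ∑₈ (λ b → [ X b ]) ≡ 3 → Normalised X
  normalise X ∑≡3 = Any.map (Any.map (λ eq b → trans (X≗ _) (eq b)))
    (normalise-table _ _ _ _ _ _ _ _ (trans (∑₈-cong λ b → cong [_] (sym (X≗ b))) ∑≡3))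
    where
    X≗ : ∀ b → X b ≡ table (X (false , false , false)) (X (true , false , false)) (X (false , true , false))
        (X (true , true , false))
      (X (false , false , true)) (X (true , false , true)) (X (false , true , true)) (X (true , true , true)) b
    X≗ (false , false , false) = refl
    X≗ (true  , false , false) = refl
    X≗ (false , true  , false) = refl
    X≗ (true  , true  , false) = refl
    X≗ (false , false , true ) = refl
    X≗ (true  , false , true ) = refl
    X≗ (false , true  , true ) = refl
    X≗ (true  , true  , true ) = refl

  frobenius-𝟘 : ∀ i → frobenius i 𝟘 ≡ 𝟘
  frobenius-𝟘 zero    = refl
  frobenius-𝟘 (suc i) = frobenius-𝟘 i

  frobenius-𝟙 : ∀ i → frobenius i 𝟙 ≡ 𝟙
  frobenius-𝟙 zero    = refl
  frobenius-𝟙 (suc i) = frobenius-𝟙 i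

  zero?-frobenius : ∀ i x → zero? (frobenius i x) ≡ zero? x
  zero?-frobenius zero    x = refl
  zero?-frobenius (suc i) x = trans (zero?-frobenius i (x ⊗ x)) (square x)
    where
    square : ∀ x → zero? (x ⊗ x) ≡ zero? x
    square = from-yes (∀₈? λ x → zero? (x ⊗ x) Boolₚ.≟ zero? x)

  -- Translating (a₀ , c₀) to the origin makes the exceptional lines those with intercept 0 required
  -- by `state₃`; `concurrent` ensures that the one of slope 1 passes through this point too.
  refute-pattern : ∀ χ {a₀ c₀ d₀} → (∀ m c → 1 ≤ on χ m c) →
    (∀ a → on∞ χ a ≡ 2 + [ zero? (a ⊕ a₀) ]) →
    (∀ c → on χ 𝟘 c ≡ 2 + [ zero? (c ⊕ c₀) ]) →
    (∀ c → on χ 𝟙 c ≡ 2 + [ zero? (c ⊕ d₀) ]) →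
    ∀ i s → i < 3 → s ≢ 𝟘 → ∀ p → Refuted (with-column (among p) state₃) →
    (∀ b → χ a₀ (s ⊗ frobenius i b ⊕ c₀) ≡ among p b) → ⊥
  refute-pattern χ {a₀} {c₀} {d₀} on≥1 on∞≡ on𝟘≡ on𝟙≡ i s i<3 s≢𝟘 p refuted column≡ =
    refuted-sound refuted (with-column-satisfies (among p) (λ b → trans (at-column b) (column≡ b)) elements)
    where
    open Collineation (semilinear i s a₀ c₀ i<3 s≢𝟘)
    χ′ : Grid
    χ′ = image χ
    open Soundness (valuation χ′)
    at-column : ∀ b → χ′ 𝟘 b ≡ χ a₀ (s ⊗ frobenius i b ⊕ c₀)
    at-column b = cong (λ a → χ a (s ⊗ frobenius i b ⊕ c₀))
      (trans (cong (λ t → s ⊗ t ⊕ a₀) (frobenius-𝟘 i)) (trans (cong (_⊕ a₀) (⊗-zeroʳ s)) (⊕-identityˡ a₀)))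
    at-shift : ∀ x t → zero? (s ⊗ frobenius i x ⊕ t ⊕ t) ≡ zero? x
    at-shift x t = trans (cong zero?
        (trans (⊕-assoc (s ⊗ frobenius i x) t t)
        (trans (cong (s ⊗ frobenius i x ⊕_) (⊕-self t)) (⊕-identityʳ (s ⊗ frobenius i x)))))
      (trans (scalar s (frobenius i x) s≢𝟘) (zero?-frobenius i x))
      where
      scalar : ∀ s x → s ≢ 𝟘 → zero? (s ⊗ x) ≡ zero? x
      scalar = from-yes (∀₈? λ s → ∀₈? λ x → ¬? (s ≟ 𝟘) →-dec (zero? (s ⊗ x) Boolₚ.≟ zero? x))
    columns : ∀ a → on∞ χ′ a ≡ 2 + [ zero? a ]
    columns a = trans (on∞-image χ a) (trans (on∞≡ (A a)) (cong (λ t → 2 + [ t ]) (at-shift a a₀)))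
    rows : ∀ c → on χ′ 𝟘 c ≡ 2 + [ zero? c ]
    rows c = trans (on-image χ 𝟘 c) (trans (cong₂ (on χ) (frobenius-𝟘 i)
        (trans (cong (λ t → s ⊗ frobenius i c ⊕ c₀ ⊕ t ⊗ a₀) (frobenius-𝟘 i))
            (trans (cong (s ⊗ frobenius i c ⊕ c₀ ⊕_) (⊗-zeroˡ a₀)) (⊕-identityʳ (s ⊗ frobenius i c ⊕ c₀)))))
      (trans (on𝟘≡ (s ⊗ frobenius i c ⊕ c₀)) (cong (λ t → 2 + [ t ]) (at-shift c c₀))))
    diagonals : ∀ c → on χ′ 𝟙 c ≡ 2 + [ zero? c ]
    diagonals c = trans (on-image χ 𝟙 c) (trans (cong₂ (on χ) (frobenius-𝟙 i)
        (trans (cong (λ t → s ⊗ frobenius i c ⊕ c₀ ⊕ t ⊗ a₀) (frobenius-𝟙 i))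
            (trans (cong (s ⊗ frobenius i c ⊕ c₀ ⊕_) (⊗-identityˡ a₀))
          (trans (⊕-assoc (s ⊗ frobenius i c) c₀ a₀)
              (cong (s ⊗ frobenius i c ⊕_) (sym (concurrent χ {a₀} {c₀} {d₀} on∞≡ on𝟘≡ on𝟙≡)))))))
      (trans (on𝟙≡ (s ⊗ frobenius i c ⊕ d₀)) (cong (λ t → 2 + [ t ]) (at-shift c d₀))))
    state₃-satisfied : Satisfies state₃
    state₃-satisfied =
        all-elements χ′ (λ a → exactly (2 + [ zero? a ]) (column a))
            (λ a → exactly-holds χ′ (λ b → a , b) (2 + [ zero? a ]) (columns a))
      ∷ all-elements χ′ (λ c → exactly (2 + [ zero? c ]) (row 𝟘 c))
          (λ c → exactly-holds χ′ (λ a → a , 𝟘 ⊗ a ⊕ c) (2 + [ zero? c ]) (rows c))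
      ∷ all-elements χ′ (λ c → exactly (2 + [ zero? c ]) (row 𝟙 c))
          (λ c → exactly-holds χ′ (λ a → a , 𝟙 ⊗ a ⊕ c) (2 + [ zero? c ]) (diagonals c))
      ∷ Allₚ.map⁺ (All.universal (λ m → all-elements χ′ (atLeast 1 ∘ row m) (λ c →
          atLeast-holds χ′ (λ a → a , m ⊗ a ⊕ c) 1
              (subst (1 ≤_) (sym (on-image χ m c)) (on≥1 (slope m) (intercept m c))))) steep)
    with-column-satisfies : ∀ p → (∀ b → χ′ 𝟘 b ≡ p b) → ∀ bs → Satisfies
        (List.foldr (λ b → assign (p b) (point 𝟘 b)) state₃ bs)
    with-column-satisfies p eq []       = state₃-satisfied
    with-column-satisfies p eq (b ∷ bs) = assign-satisfies (point 𝟘 b) (trans (valuation-point χ′ 𝟘 b) (eq b))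
        (with-column-satisfies p eq bs)

  contradict : ∀ {A : Set} {P Q : A → Set} {xs} → All P xs → Any Q xs → (∀ x → P x → Q x → ⊥) → ⊥
  contradict (p ∷ ps) (here q)  f = f _ p q
  contradict (p ∷ ps) (there q) f = contradict ps q f

  -- As 17 = 8 · 2 + 1, each of the three classes has one line with three cells. Those of the
  -- exceptional column, measured from the common point, form a triple that `normalise` matches with
  -- a pattern.
  no-three-slopes : ∀ χ → total χ ≡ 17 → (∀ m c → 1 ≤ on χ m c) → (∀ a → 2 ≤ on∞ χ a) → (∀ c → 2 ≤ on χ 𝟘 c) →
      (∀ c → 2 ≤ on χ 𝟙 c) → ⊥
  no-three-slopes χ total≡17 on≥1 on∞≥2 on𝟘≥2 on𝟙≥2 =
    contradict semilinearMaps-valid (normalise (λ b → χ a₀ (b ⊕ c₀)) three)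
      λ (i , s) (i<3 , s≢𝟘) → λ matching → contradict patterns-refuted matching
        (refute-pattern χ on≥1 (proj₂ columns) (proj₂ rows) (proj₂ diagonals) i s i<3 s≢𝟘)
    where
    columns : ∃[ a₀ ] ∀ a → on∞ χ a ≡ 2 + [ zero? (a ⊕ a₀) ]
    columns = one-excess (on∞ χ) on∞≥2 total≡17
    rows : ∃[ c₀ ] ∀ c → on χ 𝟘 c ≡ 2 + [ zero? (c ⊕ c₀) ]
    rows = one-excess (on χ 𝟘) on𝟘≥2 (trans (∑-on χ 𝟘) total≡17)
    diagonals : ∃[ d₀ ] ∀ c → on χ 𝟙 c ≡ 2 + [ zero? (c ⊕ d₀) ]
    diagonals = one-excess (on χ 𝟙) on𝟙≥2 (trans (∑-on χ 𝟙) total≡17)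
    a₀ c₀ : F₈
    a₀ = proj₁ columns
    c₀ = proj₁ rows
    three : ∑₈ (λ b → [ χ a₀ (b ⊕ c₀) ]) ≡ 3
    three = trans (∑₈-reindex (_⊕ c₀)
        (λ d → trans (∑₈-cong λ c → cong (λ t → [ zero? (d ⊕ t) ]) (⊕-comm c c₀)) (shift-bijective c₀ d)) (λ b → [ χ a₀ b ]))
      (trans (proj₂ columns a₀) (cong (λ t → 2 + [ t ]) (zero?-𝟘 (⊕-self a₀))))

-- Systems over 𝔽₈ and the exact values 49 and 74.

module OctalSystems where

  open FiniteVectorSpaces
  open SpanSystems
  open Octal
  open Arcs
  open Frames
  open FiftyPoints
  open Jamison
  open GridSearch
  open GridTheorems
  open BinarySystems

  open FieldTheory 𝔽₈ using (⟨_,_⟩; Nonzero)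

  toTriple : (Fin 3 → F₈) → Triple
  toTriple v = v zero , v (suc zero) , v (suc (suc zero))

  fromTriple : Triple → Fin 3 → F₈
  fromTriple (a , b , c) zero             = a
  fromTriple (a , b , c) (suc zero)       = b
  fromTriple (a , b , c) (suc (suc zero)) = c

  opaque
    unfolding _∙_

    -- The detour through variables keeps the conversion checker from unfolding ⊕ and ⊗.
    ⟨,⟩≡∙ : ∀ f v → ⟨ f , v ⟩ ≡ toTriple f ∙ toTriple v
    ⟨,⟩≡∙ f v = trans (generic f v)
        (trans (sum₃ (λ i → f i ⊗ v i))
        (unfolded (f zero) (f (suc zero)) (f (suc (suc zero))) (v zero) (v (suc zero)) (v (suc (suc zero)))))
      where
      generic : ∀ {n} (f v : Fin n → F₈) → ⟨ f , v ⟩ ≡ F₈Σ.sum {n} (λ i → f i ⊗ v i)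
      generic f v = refl
      sum₃ : ∀ (t : Fin 3 → F₈) → F₈Σ.sum t ≡ t zero ⊕ t (suc zero) ⊕ t (suc (suc zero))
      sum₃ t = trans (sym (⊕-assoc (t zero) (t (suc zero)) (t (suc (suc zero)) ⊕ 𝟘)))
        (cong (t zero ⊕ t (suc zero) ⊕_) (⊕-identityʳ (t (suc (suc zero)))))
      unfolded : ∀ a b c x y z → a ⊗ x ⊕ b ⊗ y ⊕ c ⊗ z ≡ (a , b , c) ∙ (x , y , z)
      unfolded a b c x y z = refl

  toTriple≢𝟎 : ∀ {f} → Nonzero f → toTriple f ≢ 𝟎
  toTriple≢𝟎 (zero           , fi≢𝟘) eq = fi≢𝟘 (cong proj₁ eq)
  toTriple≢𝟎 (suc zero       , fi≢𝟘) eq = fi≢𝟘 (cong (proj₁ ∘ proj₂) eq)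
  toTriple≢𝟎 (suc (suc zero) , fi≢𝟘) eq = fi≢𝟘 (cong (proj₂ ∘ proj₂) eq)

  fromTriple-nonzero : ∀ f → f ≢ 𝟎 → Nonzero (fromTriple f)
  fromTriple-nonzero (a , b , c) f≢𝟎 with a ≟ 𝟘 | b ≟ 𝟘 | c ≟ 𝟘
  ... | no a≢𝟘   | _        | _        = zero , a≢𝟘
  ... | yes _    | no b≢𝟘   | _        = suc zero , b≢𝟘
  ... | yes _    | yes _    | no c≢𝟘   = suc (suc zero) , c≢𝟘
  ... | yes refl | yes refl | yes refl = contradiction refl f≢𝟎

  prefix-sum : ∀ {m n} (m≤n : m ≤ n) (t : Fin n → ℕ) → sum (λ i → t (inject≤ i m≤n)) ≤ sum t
  prefix-sum {zero}          m≤n t = z≤n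
  prefix-sum {suc m} {suc n} m≤n t = ℕₚ.+-monoʳ-≤ (t zero) (prefix-sum (s≤s⁻¹ m≤n) (t ∘ suc))

  private
    open CommutativeRing (FiniteField.commutativeRing 𝔽₈) using (_≈_; 0#)

    ≈⇒≡ : ∀ x → x ≈ 0# → x ≡ 𝟘
    ≈⇒≡ x eq = eq

    ≡⇒≈ : ∀ x → x ≡ 𝟘 → x ≈ 0#
    ≡⇒≈ x eq = eq

  module _ {s : ℕ} where

    open Systems 𝔽₈ 1 3 s

    opaque
      unfolding Points.k

      degree≡k : ∀ {n} (b : Family n) f → degree b f ≡ Points.k (λ i → toTriple (b i zero)) (toTriple f)
      degree≡k {n} b f = trans (∣∣≡sum (incident? b f)) (sum-cong-≗ {n} λ i → pointwise i (incident? b f i))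
        where
        pointwise : ∀ i (d : Dec (∀ j → ⟨ f , b i j ⟩ ≈ 0#)) → indicator d ≡ [ zero? (toTriple f ∙ toTriple (b i zero)) ]
        pointwise i (yes p) = cong [_] (sym (zero?-𝟘 (trans (sym (⟨,⟩≡∙ f (b i zero))) (≈⇒≡ ⟨ f , b i zero ⟩ (p zero)))))
        pointwise i (no ¬p) = cong [_] (sym
            (zero?-≢ λ eq → ¬p λ { zero → ≡⇒≈ ⟨ f , b i zero ⟩ (trans (⟨,⟩≡∙ f (b i zero)) eq) }))

      prefix-k : ∀ {m n} (m≤n : m ≤ n) (p : Fin n → Triple) f → Points.k (λ i → p (inject≤ i m≤n)) f ≤ Points.k p f
      prefix-k m≤n p f = prefix-sum m≤n (λ i → [ zero? (f ∙ p i) ])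

    -- Passing to the first `m` members can only lower the counts, so excluding 50 or 75 members
    -- excludes all larger systems.
    points-of-system : ∀ {n} m → m ≤ n → ProjectiveSystem 𝔽₈ 1 n 3 s →
      ∃[ p ] (∀ f → f ≢ 𝟎 → Points.k {m} p f ≤ s)
    points-of-system {n} m m≤n PS = (λ i → p (inject≤ i m≤n)) , λ f f≢𝟎 → ℕₚ.≤-trans (prefix-k m≤n p f) (bounded f f≢𝟎)
      where
      b : Family n
      b = proj₁ (fromProjectiveSystem PS)
      bound : ∀ f → Nonzero f → degree b f ≤ s
      bound = proj₁ (proj₂ (fromProjectiveSystem PS))
      p : Fin n → Triple
      p i = toTriple (b i zero)
      bounded : ∀ f → f ≢ 𝟎 → Points.k p f ≤ s
      bounded f f≢𝟎 = subst (_≤ s) (degree≡k b (fromTriple f)) (bound (fromTriple f) (fromTriple-nonzero f f≢𝟎))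

    system-of-points : (ps : List Triple) → (∀ a b c → (a , b , c) ≢ 𝟎 → Points.k (List.lookup ps) (a , b , c) ≤ s) →
      ∀ f → f ≢ 𝟎 → Points.k (List.lookup ps) f ≡ s → ProjectiveSystem 𝔽₈ 1 (List.length ps) 3 s
    system-of-points ps k≤s f₀ f₀≢𝟎 k≡s = toProjectiveSystem b
      ( (λ f f≢0 → subst (_≤ s) (sym (degree≡k b f)) (k≤s (f zero) (f (suc zero)) (f (suc (suc zero))) (toTriple≢𝟎 f≢0)))
      , fromTriple f₀ , fromTriple-nonzero f₀ f₀≢𝟎 , trans (degree≡k b (fromTriple f₀)) k≡s )
      where
      b : Family (List.length ps)
      b i _ = fromTriple (List.lookup ps i)

  -- The points off a triangle.
  points₄₉ : List Triple
  points₄₉ = List.map (𝟙 ,_) (List.cartesianProduct (List.drop 1 elements) (List.drop 1 elements))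

  -- All points of the plane, and the zero space, which lies on every line.
  points₇₄ : List Triple
  points₇₄ = List.map (𝟙 ,_) (List.cartesianProduct elements elements)
    ++ List.map (λ a → 𝟘 , 𝟙 , a) elements ++ (𝟘 , 𝟘 , 𝟙) ∷ 𝟎 ∷ []

  opaque
    unfolding Points.k _∙_

    k≤7 : ∀ a b c → (a , b , c) ≢ 𝟎 → Points.k (List.lookup points₄₉) (a , b , c) ≤ 7
    k≤7 = from-yes (∀₈? λ a → ∀₈? λ b → ∀₈? λ c → ¬? ((a , b , c) ≟₃ 𝟎) →-dec Points.k (List.lookup points₄₉)
        (a , b , c) ℕₚ.≤? 7)

    -- This line passes through a vertex of the triangle without being a side, so it loses only two
    -- of its nine points; a line through no vertex loses three.
    k≡7 : Points.k (List.lookup points₄₉) (𝟙 , 𝟙 , 𝟘) ≡ 7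
    k≡7 = refl

    k≤10 : ∀ a b c → (a , b , c) ≢ 𝟎 → Points.k (List.lookup points₇₄) (a , b , c) ≤ 10
    k≤10 = from-yes (∀₈? λ a → ∀₈? λ b → ∀₈? λ c → ¬? ((a , b , c) ≟₃ 𝟎) →-dec Points.k (List.lookup points₇₄)
        (a , b , c) ℕₚ.≤? 10)

    k≡10 : Points.k (List.lookup points₇₄) (𝟙 , 𝟘 , 𝟘) ≡ 10
    k≡10 = refl

  n̄-7 : IsN̄ 2 9 3 𝔽₈ 7 49
  n̄-7 = system-of-points points₄₉ k≤7 (𝟙 , 𝟙 , 𝟘) (λ ()) k≡7 , λ m PS → ℕₚ.≮⇒≥ λ 49<m →
    let p , k≤7 = points-of-system 50 49<m PS
    in NoFifty.impossible (no-14-blocking , no-two-slopes , no-three-slopes) p refl k≤7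

  n̄-10 : IsN̄ 2 9 3 𝔽₈ 10 74
  n̄-10 = system-of-points points₇₄ k≤10 (𝟙 , 𝟘 , 𝟘) (λ ()) k≡10 , λ m PS → ℕₚ.≮⇒≥ λ 74<m →
    let p , k≤10 = points-of-system 75 74<m PS
    in no-75-points p refl k≤10

open BinarySystems using (n₂-9-3-7; n₂-9-3-10)
open OctalSystems using (n̄-7; n̄-10)

theorem8 : ((∃[ N ] (IsN 𝔽₂ 9 3 7 N × N ≥ 51)) × 51 > 49 × IsN̄ 2 9 3 𝔽₈ 7 49) ×
    ((∃[ N ] (IsN 𝔽₂ 9 3 10 N × N ≥ 76)) × 76 > 74 × IsN̄ 2 9 3 𝔽₈ 10 74)
theorem8 = (n₂-9-3-7 , ℕₚ.m≤m+n 50 1 , n̄-7) , (n₂-9-3-10 , ℕₚ.m≤m+n 75 1 , n̄-10)
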